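{- For every prime $p$, let $g^{\Box}(p)$ denote the least positive square-free integer that is a primitive root modulo $p$. Then $$g^{\Box}(p) < p^{0.88}\quad\text{for all primes } p.$$
   Context: An integer $r$ coprime to $p$ is a primitive root modulo the prime $p$ if its multiplicative order modulo $p$ equals $p-1$. A positive integer is square-free if it is not divisible by the square of any prime (so $1$ is square-free). -}

module Defs where

open import Data.Nat using (ℕ; _∸_; _^_; _*_; _≤_; _<_)
open import Data.Nat.Divisibility using (_∣_)
open import Data.Nat.Primality using (Prime)
open import Data.Nat.Coprimality using (Coprime)
open import Data.Product using (_×_)
open import Relation.Nullary using (¬_)

-- a ≡ b (mod n), i.e. n ∣ |a - b| (one of the truncated differences is 0)
_≡_[mod_] : ℕ → ℕ → ℕ → Set
a ≡ b [mod n ] = (n ∣ (a ∸ b)) × (n ∣ (b ∸ a))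

IsMultOrder : ℕ → ℕ → ℕ → Set
IsMultOrder n r k =
  (0 < k) × ((r ^ k) ≡ 1 [mod n ]) ×
  (∀ j → 0 < j → j < k → ¬ ((r ^ j) ≡ 1 [mod n ]))

IsPrimitiveRoot : ℕ → ℕ → Set
IsPrimitiveRoot p r = Coprime r p × IsMultOrder p r (p ∸ 1)

SquareFree : ℕ → Set
SquareFree n = ∀ q → Prime q → ¬ (q * q ∣ n)

IsLeastSqFreePrimRoot : ℕ → ℕ → Set
IsLeastSqFreePrimRoot p g =
  (0 < g) × SquareFree g × IsPrimitiveRoot p g ×
  (∀ h → 0 < h → SquareFree h → IsPrimitiveRoot p h → g ≤ h)

{-# OPTIONS --safe #-}

-- Let F be the indicator of a set of N residues mod p that is invariant under the group H of M-th
-- roots of unity, with N = φ M.  Averaging a second moment over H, then enlarging the average to all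
-- dilations, shows without character sums that Σ_{i,j<K} F (u + v (i + j)) differs from N K² / p by at
-- most K √(φ (p − φ M)), where p ∤ v.  Put e for a product of primes dividing p − 1.  The estimate
-- applies to the e-free residues (φ = φ(e), M = (p − 1)/e) and to those e-free residues which are
-- r-th powers.  Among the odd n = 1 + 2 (i + j) < p^0.88 one counts the e-free ones, and subtracts the
-- r-th powers for the remaining primes r ∣ p − 1, the multiples of q² for the small primes q (again by
-- the estimate), and the multiples of q² for larger q (trivially).  A positive difference produces a
-- square-free primitive root.
--
-- For p ≥ 2²⁰⁰ take for e the product of the smaller half of the primes of p − 1, so that φ(e)² ≤ p.
-- For smaller p the inequality depends only on the size of p and on which small primes divide p − 1,
-- so it is decided by computation on intervals.  The residue classes where it fails are
-- searched for prime primitive roots.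
module Submission where

open import Defs
open import Algebra.Bundles using (CommutativeMonoid; CommutativeSemiring)
open import Data.Fin.Base using (Fin; toℕ; fromℕ<)
open import Data.Fin.Permutation using (Permutation; permutation)
open import Data.Fin.Properties using (toℕ<n; toℕ-fromℕ<; toℕ-injective)
import Data.Nat.Base as ℕ
open import Data.Nat.Base using (ℕ; zero; suc; NonZero; _≤_; _<_)
import Data.Nat.Properties as ℕₚ
open import Function.Base using (_∘_)
open import Relation.Binary.PropositionalEquality hiding (setoid)

-- The estimate costs K √(φ p) against a main term K² φ / e, so it says something only when K
-- exceeds (e / φ) √(φ p). The error grows with φ(e), hence e cannot absorb every prime of p - 1. A
-- prime r left outside e costs the density 1 / r and one more error term of the same kind: the r-th
-- powers among the e-free residues number φ M / r and are invariant under the group of order M / r,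
-- with the same φ. With φ² ≤ p one error term is of order p^(3/4), so p^0.88 leaves a factor p^0.13
-- to pay for a multiple of m², where m bounds both e / φ and the number of remaining primes.
--
-- The argument i + j with two indices lets Cauchy-Schwarz in one of them produce a sum of squares
-- over translates, which can be enlarged to all residues. Enlarging the dilations from H to all c
-- is what kills the correlations between different i.
--
-- Restricting to odd n disposes of the square 4; the squares of the odd q take at most a quarter of
-- the density, by comparing 1 / (2a + 1)² with a telescoping series.

-- Finite sums in commutative monoids and semirings

module BigOp {c ℓ} (M : CommutativeMonoid c ℓ) where
  open CommutativeMonoid M renaming
    ( _∙_ to _+_; ε to 0#; ∙-cong to +-cong; ∙-congˡ to +-congˡ; ∙-congʳ to +-congʳ
    ; assoc to +-assoc; comm to +-comm; identityˡ to +-identityˡ; identityʳ to +-identityʳ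
    ; monoid to +-monoid; commutativeSemigroup to +-commutativeSemigroup
    ; refl to ≈-refl; sym to ≈-sym; trans to ≈-trans)
  open import Relation.Binary.Reasoning.Setoid setoid
  open import Algebra.Properties.CommutativeMonoid.Sum M using (sum; sum-permute)
  open import Algebra.Properties.CommutativeSemigroup +-commutativeSemigroup
    using (interchange)

  ∑ : ℕ → (ℕ → Carrier) → Carrier
  ∑ zero    f = 0#
  ∑ (suc n) f = ∑ n f + f n

  ∑-cong : ∀ n {f g} → (∀ i → i < n → f i ≈ g i) → ∑ n f ≈ ∑ n g
  ∑-cong zero    eq = ≈-refl
  ∑-cong (suc n) eq =
    +-cong (∑-cong n λ i i<n → eq i (ℕₚ.m<n⇒m<1+n i<n)) (eq n ℕₚ.≤-refl)

  ∑-ext : ∀ n {f g} → (∀ i → f i ≈ g i) → ∑ n f ≈ ∑ n g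
  ∑-ext n eq = ∑-cong n λ i _ → eq i

  ∑-zero : ∀ n → ∑ n (λ _ → 0#) ≈ 0#
  ∑-zero zero    = ≈-refl
  ∑-zero (suc n) = ≈-trans (+-identityʳ _) (∑-zero n)

  ∑-distrib-+ : ∀ n f g → ∑ n (λ i → f i + g i) ≈ ∑ n f + ∑ n g
  ∑-distrib-+ zero    f g = ≈-sym (+-identityˡ 0#)
  ∑-distrib-+ (suc n) f g =
    ≈-trans (+-congʳ (∑-distrib-+ n f g)) (interchange _ _ _ _)

  ∑-swap : ∀ m n (f : ℕ → ℕ → Carrier) →
           ∑ m (λ i → ∑ n (f i)) ≈ ∑ n (λ j → ∑ m (λ i → f i j))
  ∑-swap zero    n f = ≈-sym (∑-zero n)
  ∑-swap (suc m) n f =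
    ≈-trans (+-congʳ (∑-swap m n f)) (≈-sym (∑-distrib-+ n _ _))

  ∑-head : ∀ n f → f 0 + ∑ n (f ∘ suc) ≈ ∑ (suc n) f
  ∑-head zero    f = +-comm _ _
  ∑-head (suc n) f = ≈-trans (≈-sym (+-assoc _ _ _)) (+-congʳ (∑-head n f))

  -- A shift by one trades the first term for the one just past the end, and these agree by
  -- periodicity.
  ∑-shift : ∀ n f → (∀ x → f (x ℕ.+ n) ≈ f x) → ∀ k → ∑ n (λ x → f (x ℕ.+ k)) ≈ ∑ n f
  ∑-shift n f per zero    = ∑-ext n λ x → reflexive (cong f (ℕₚ.+-identityʳ x))
  ∑-shift n f per (suc k) = ≈-trans step (∑-shift n f per k)
    where
    g = λ x → f (x ℕ.+ k)

    rot : ∀ m h → h m ≈ h 0 → ∑ m (h ∘ suc) ≈ ∑ m h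
    rot zero    h eq = ≈-refl
    rot (suc m) h eq = begin
      ∑ m (h ∘ suc) + h (suc m)  ≈⟨ +-congˡ eq ⟩
      ∑ m (h ∘ suc) + h 0        ≈⟨ +-comm _ _ ⟩
      h 0 + ∑ m (h ∘ suc)        ≈⟨ ∑-head m h ⟩
      ∑ (suc m) h                ∎

    step : ∑ n (λ x → f (x ℕ.+ suc k)) ≈ ∑ n g
    step = ≈-trans
      (∑-ext n λ x → reflexive (cong f (ℕₚ.+-suc x k)))
      (rot n g (begin
        f (n ℕ.+ k) ≡⟨ cong f (ℕₚ.+-comm n k) ⟩
        f (k ℕ.+ n) ≈⟨ per k ⟩
        f k         ∎))

  sum-∑ : ∀ n f → sum {n} (f ∘ toℕ) ≈ ∑ n f
  sum-∑ zero    f = ≈-refl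
  sum-∑ (suc n) f = ≈-trans (+-congˡ (sum-∑ n (f ∘ suc))) (∑-head n f)

  ∑-permute : ∀ n f (σ τ : ℕ → ℕ) →
              (∀ {i} → i < n → σ i < n) → (∀ {i} → i < n → τ i < n) →
              (∀ {i} → i < n → σ (τ i) ≡ i) → (∀ {i} → i < n → τ (σ i) ≡ i) →
              ∑ n (f ∘ σ) ≈ ∑ n f
  ∑-permute n f σ τ σ< τ< στ τσ = begin
    ∑ n (f ∘ σ)                                     ≈⟨ sum-∑ n (f ∘ σ) ⟨
    sum {n} (λ i → f (σ (toℕ i)))                   ≡⟨ sum-≗ (λ i → cong f (sym (toℕ-fromℕ< (σ< (toℕ<n i))))) ⟩
    sum {n} (λ i → f (toℕ (fromℕ< (σ< (toℕ<n i))))) ≈⟨ sum-permute (f ∘ toℕ) π ⟨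
    sum {n} (f ∘ toℕ)                               ≈⟨ sum-∑ n f ⟩
    ∑ n f                                           ∎
    where
    open import Algebra.Properties.Monoid.Sum +-monoid using () renaming (sum-cong-≗ to sum-≗)
    open import Data.Fin.Properties using (toℕ-injective)
    lift : (ρ : ℕ → ℕ) → (∀ {i} → i < n → ρ i < n) → Fin n → Fin n
    lift ρ ρ< i = fromℕ< (ρ< (toℕ<n i))
    inv : ∀ (ρ ρ′ : ℕ → ℕ) (ρ< : ∀ {i} → i < n → ρ i < n) (ρ′< : ∀ {i} → i < n → ρ′ i < n) →
          (∀ {i} → i < n → ρ (ρ′ i) ≡ i) → ∀ i → lift ρ ρ< (lift ρ′ ρ′< i) ≡ i
    inv ρ ρ′ ρ< ρ′< eq i = toℕ-injective
      (trans (toℕ-fromℕ< _) (trans (cong ρ (toℕ-fromℕ< _)) (eq (toℕ<n i))))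
    π : Permutation n n
    π = permutation (lift σ σ<) (lift τ τ<) (inv σ τ σ< τ< στ) (inv τ σ τ< σ< τσ)

module Sum {c ℓ} (R : CommutativeSemiring c ℓ) where
  open CommutativeSemiring R renaming (trans to ≈-trans)
  open BigOp +-commutativeMonoid public

  ∑-distribˡ-* : ∀ n a f → a * ∑ n f ≈ ∑ n (λ i → a * f i)
  ∑-distribˡ-* zero    a f = zeroʳ a
  ∑-distribˡ-* (suc n) a f =
    ≈-trans (distribˡ a _ _) (+-congʳ (∑-distribˡ-* n a f))

  ∑-distribʳ-* : ∀ n a f → ∑ n f * a ≈ ∑ n (λ i → f i * a)
  ∑-distribʳ-* zero    a f = zeroˡ a
  ∑-distribʳ-* (suc n) a f =
    ≈-trans (distribʳ a _ _) (+-congʳ (∑-distribʳ-* n a f))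

  ∑-*-∑ : ∀ m n f g → ∑ m f * ∑ n g ≈ ∑ m (λ i → ∑ n (λ j → f i * g j))
  ∑-*-∑ m n f g = ≈-trans (∑-distribʳ-* m _ f) (∑-ext m λ i → ∑-distribˡ-* n (f i) g)

open import Data.Bool.Base as Bool using (Bool; true; false; _∧_; _∨_; not; if_then_else_)
open import Data.Empty using (⊥; ⊥-elim)
open import Data.List.Base using (List; []; _∷_; length; _++_; take; drop; replicate)
open import Data.List.Membership.Propositional using (_∈_)
open import Data.List.Membership.Propositional.Properties using (∈-++⁺ˡ; ∈-++⁺ʳ; ∈-++⁻)
open import Data.List.Properties using (take++drop≡id; length-drop; length-take; length-replicate)
open import Data.List.Relation.Unary.All as All using (All; []; _∷_)
open import Data.List.Relation.Unary.All.Properties using (++⁺; ++⁻ˡ; ++⁻ʳ; ¬All⇒Any¬)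
open import Data.List.Relation.Unary.AllPairs as AllPairs using (AllPairs; []; _∷_)
open import Data.List.Relation.Unary.Any using (Any; here; there)
open import Data.Maybe.Base using (Maybe; just; nothing) renaming (map to mapMaybe)
open import Data.Nat.Base
open import Data.Nat.Coprimality as Cop using (Coprime)
open import Data.Nat.Divisibility
open import Data.Nat.DivMod
open import Data.Nat.GCD using (gcd; gcd[m,n]∣m; gcd[m,n]∣n; gcd[m,n]≡0⇒m≡0; module Bézout)
open import Data.Nat.ListAction using (product)
open import Data.Nat.ListAction.Properties using (product-++)
open import Data.Nat.Primality
open import Data.Nat.Primality.Factorisation using (factorise; factorisationHasAllPrimeFactors)
open import Data.Nat.Properties
open import Data.Nat.Tactic.RingSolver using (solve-∀)
open import Data.List.Membership.DecPropositional _≟_ using (_∈?_)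
open import Data.Product.Base using (_×_; _,_; proj₁; proj₂; ∃-syntax)
open import Data.Sum.Base using (_⊎_; inj₁; inj₂; [_,_]′)
open import Data.Unit.Base using (tt)
open import Relation.Binary.Definitions using (tri<; tri≈; tri>)
open import Relation.Nullary using (¬_; Dec; yes; no; ¬?; _×-dec_; _→-dec_; map′; decidable-stable)
open import Relation.Nullary.Decidable using (from-yes)

-- Residues modulo a prime

module ∑ℕ = Sum +-*-commutativeSemiring
module ∏ℕ = BigOp *-1-commutativeMonoid

module Mod (p : ℕ) .{{_ : NonZero p}} where
  infix 4 _∼_
  -- Congruence as equality of remainders: an equivalence and decidable without further work, and
  -- free of subtraction.
  _∼_ : ℕ → ℕ → Set
  a ∼ b = a % p ≡ b % p

  +-∼ : ∀ {a b c d} → a ∼ b → c ∼ d → a + c ∼ b + d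
  +-∼ {a} {b} {c} {d} e f = begin
    (a + c) % p           ≡⟨ %-distribˡ-+ a c p ⟩
    (a % p + c % p) % p   ≡⟨ cong₂ (λ x y → (x + y) % p) e f ⟩
    (b % p + d % p) % p   ≡⟨ %-distribˡ-+ b d p ⟨
    (b + d) % p           ∎
    where open ≡-Reasoning

  *-∼ : ∀ {a b c d} → a ∼ b → c ∼ d → a * c ∼ b * d
  *-∼ {a} {b} {c} {d} e f = begin
    (a * c) % p             ≡⟨ %-distribˡ-* a c p ⟩
    ((a % p) * (c % p)) % p ≡⟨ cong₂ (λ x y → (x * y) % p) e f ⟩
    ((b % p) * (d % p)) % p ≡⟨ %-distribˡ-* b d p ⟨
    (b * d) % p             ∎
    where open ≡-Reasoning

  ^-∼ : ∀ {a b} n → a ∼ b → a ^ n ∼ b ^ n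
  ^-∼ zero    e = refl
  ^-∼ {a} {b} (suc n) e = *-∼ {a} {b} {a ^ n} {b ^ n} e (^-∼ n e)

  1^∼ : ∀ {a} n → a ∼ 1 → a ^ n ∼ 1
  1^∼ {a} n e = trans (^-∼ {a} {1} n e) (cong (_% p) (^-zeroˡ n))

  %-∼ : ∀ a → a % p ∼ a
  %-∼ a = m%n%n≡m%n a p

  ∼⇒∣ : ∀ {a b} → a ≤ b → a ∼ b → p ∣ b ∸ a
  ∼⇒∣ {a} {b} a≤b e = divides (b / p ∸ a / p) (begin
    b ∸ a                                         ≡⟨ cong₂ _∸_ (m≡m%n+[m/n]*n b p) (m≡m%n+[m/n]*n a p) ⟩
    (b % p + b / p * p) ∸ (a % p + a / p * p)     ≡⟨ cong (λ r → (b % p + b / p * p) ∸ (r + a / p * p)) e ⟩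
    (b % p + b / p * p) ∸ (b % p + a / p * p)     ≡⟨ [m+n]∸[m+o]≡n∸o (b % p) _ _ ⟩
    b / p * p ∸ a / p * p                         ≡⟨ *-distribʳ-∸ p (b / p) (a / p) ⟨
    (b / p ∸ a / p) * p                           ∎)
    where open ≡-Reasoning

  ∣⇒∼ : ∀ {a b} → a ≤ b → p ∣ b ∸ a → a ∼ b
  ∣⇒∼ {a} {b} a≤b d = sym (begin
    b % p             ≡⟨ cong (_% p) (m+[n∸m]≡n a≤b) ⟨
    (a + (b ∸ a)) % p ≡⟨ %-remove-+ʳ a d ⟩
    a % p             ∎)
    where open ≡-Reasoning

  ∣⇒∼0 : ∀ {a} → p ∣ a → a ∼ 0
  ∣⇒∼0 {a} d = trans (n∣m⇒m%n≡0 a p d) (sym (0%n≡0 p))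
    where
    0%n≡0 : ∀ n .{{_ : NonZero n}} → 0 % n ≡ 0
    0%n≡0 (suc n) = refl

module ModPrime (p : ℕ) (pp : Prime p) where
  instance
    p≢0 : NonZero p
    p≢0 = prime⇒nonZero pp
  open Mod p public

  1<p : 1 < p
  1<p = nonTrivial⇒n>1 p {{prime⇒nonTrivial pp}}

  1%p : 1 % p ≡ 1
  1%p = m<n⇒m%n≡m 1<p

  inverse : ∀ c → ¬ (p ∣ c) → ∃[ c′ ] c′ * c ∼ 1
  inverse c p∤c with Cop.coprime-Bézout (Cop.sym (Cop.prime⇒coprime pp {{≢-nonZero r≢0}} (m%n<n c p)))
    where
    r≢0 : c % p ≢ 0
    r≢0 e = p∤c (m%n≡0⇒n∣m c p e)
  ... | Bézout.+- x y eq = x , (begin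
    (x * c) % p             ≡⟨ *-∼ {x} {x} {c} {c % p} refl (sym (%-∼ c)) ⟩
    (x * (c % p)) % p       ≡⟨ cong (_% p) (sym eq) ⟩
    (1 + y * p) % p         ≡⟨ [m+kn]%n≡m%n 1 y p ⟩
    1 % p                   ∎)
    where open ≡-Reasoning
  -- Here Bézout makes x c congruent to -1, and the factor `p ∸ 1` restores the sign.
  ... | Bézout.-+ x y eq = (p ∸ 1) * x , (begin
    ((p ∸ 1) * x * c) % p                 ≡⟨ *-∼ {(p ∸ 1) * x} {(p ∸ 1) * x} {c} {c % p} refl (sym (%-∼ c)) ⟩
    ((p ∸ 1) * x * (c % p)) % p           ≡⟨ cong (_% p) (*-assoc (p ∸ 1) x _) ⟩
    ((p ∸ 1) * (x * (c % p))) % p         ≡⟨ [m+kn]%n≡m%n _ 1 p ⟨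
    ((p ∸ 1) * (x * (c % p)) + 1 * p) % p ≡⟨ cong (_% p) key ⟩
    (1 + ((p ∸ 1) * y) * p) % p           ≡⟨ [m+kn]%n≡m%n 1 ((p ∸ 1) * y) p ⟩
    1 % p                                 ∎)
    where
    open ≡-Reasoning
    ring : ∀ q t → q * t + 1 * (1 + q) ≡ 1 + q * (1 + t)
    ring = solve-∀
    key : (p ∸ 1) * (x * (c % p)) + 1 * p ≡ 1 + ((p ∸ 1) * y) * p
    key = begin
      (p ∸ 1) * (x * (c % p)) + 1 * p             ≡⟨ cong (λ z → (p ∸ 1) * (x * (c % p)) + 1 * z) (m+[n∸m]≡n (<⇒≤ 1<p)) ⟨
      (p ∸ 1) * (x * (c % p)) + 1 * (1 + (p ∸ 1)) ≡⟨ ring (p ∸ 1) (x * (c % p)) ⟩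
      1 + (p ∸ 1) * (1 + x * (c % p))             ≡⟨ cong (λ z → 1 + (p ∸ 1) * z) eq ⟩
      1 + (p ∸ 1) * (y * p)                       ≡⟨ cong suc (*-assoc (p ∸ 1) y p) ⟨
      1 + (p ∸ 1) * y * p                         ∎

  cancelˡ : ∀ c {a b} → ¬ (p ∣ c) → c * a ∼ c * b → a ∼ b
  cancelˡ c {a} {b} p∤c e with inverse c p∤c
  ... | c′ , inv = begin
    a % p              ≡⟨ unit a ⟨
    (c′ * (c * a)) % p ≡⟨ *-∼ {c′} {c′} {c * a} {c * b} refl e ⟩
    (c′ * (c * b)) % p ≡⟨ unit b ⟩
    b % p              ∎
    where
    open ≡-Reasoning
    unit : ∀ x → c′ * (c * x) ∼ x
    unit x = begin
      (c′ * (c * x)) % p ≡⟨ cong (_% p) (*-assoc c′ c x) ⟨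
      (c′ * c * x) % p   ≡⟨ *-∼ {c′ * c} {1} {x} {x} inv refl ⟩
      (1 * x) % p        ≡⟨ cong (_% p) (*-identityˡ x) ⟩
      x % p              ∎

  module Dilate {a ℓ} (M : Algebra.Bundles.CommutativeMonoid a ℓ) where
    open BigOp M
    open Algebra.Bundles.CommutativeMonoid M using (Carrier; _≈_)

    -- Stated over any commutative monoid, because it serves products in `fermat` and integer sums
    -- in the second moment.
    ∑-dilate : ∀ c → ¬ (p ∣ c) → (f : ℕ → Carrier) → ∑ p (λ x → f ((c * x) % p)) ≈ ∑ p f
    ∑-dilate c p∤c f with inverse c p∤c
    ... | c′ , inv = ∑-permute p f (λ x → (c * x) % p) (λ x → (c′ * x) % p)
      (λ _ → m%n<n _ p) (λ _ → m%n<n _ p) (λ i< → trans (undo c c′ (trans (cong (_% p) (*-comm c c′)) inv)) (m<n⇒m%n≡m i<))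
      (λ i< → trans (undo c′ c inv) (m<n⇒m%n≡m i<))
      where
      open ≡-Reasoning
      undo : ∀ a b {x} → a * b ∼ 1 → a * ((b * x) % p) ∼ x
      undo a b {x} e = begin
        (a * ((b * x) % p)) % p ≡⟨ *-∼ {a} {a} {(b * x) % p} {b * x} refl (%-∼ (b * x)) ⟩
        (a * (b * x)) % p       ≡⟨ cong (_% p) (*-assoc a b x) ⟨
        (a * b * x) % p         ≡⟨ *-∼ {a * b} {1} {x} {x} e refl ⟩
        (1 * x) % p             ≡⟨ cong (_% p) (*-identityˡ x) ⟩
        x % p                   ∎

  -- Dilation by c permutes the residues and so preserves the product of the nonzero ones; factor by
  -- factor it multiplies that product by c^(p - 1). The product is prime to p and cancels.
  fermat : ∀ c → ¬ (p ∣ c) → c ^ (p ∸ 1) ∼ 1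
  fermat c p∤c = cancelˡ (∏ p h) p∤∏ (begin
    (∏ p h * c ^ (p ∸ 1)) % p             ≡⟨ cong (_% p) (*-comm (∏ p h) _) ⟩
    (c ^ (p ∸ 1) * ∏ p h) % p             ≡⟨ cong (λ z → (z * ∏ p h) % p) ∏e ⟨
    (∏ p e * ∏ p h) % p                   ≡⟨ cong (_% p) (∏ℕ.∑-distrib-+ p e h) ⟨
    ∏ p (λ x → e x * h x) % p             ≡⟨ ∏-∼ p _ _ (λ x → sym ∘ step x) ⟩
    ∏ p (λ x → h ((c * x) % p)) % p       ≡⟨ cong (_% p) (Dilate.∑-dilate *-1-commutativeMonoid c p∤c h) ⟩
    ∏ p h % p                             ≡⟨ cong (_% p) (*-identityʳ (∏ p h)) ⟨
    (∏ p h * 1) % p                       ∎)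
    where
    open ≡-Reasoning
    ∏ = ∏ℕ.∑
    -- The residue 0 is given the factor 1 on both sides, so that the products can run over all
    -- residues.
    h e : ℕ → ℕ
    h zero    = 1
    h (suc x) = suc x
    e zero    = 1
    e (suc _) = c
    ∏-∼ : ∀ n f g → (∀ x → x < n → f x ∼ g x) → ∏ n f ∼ ∏ n g
    ∏-∼ zero    f g eq = refl
    ∏-∼ (suc n) f g eq =
      *-∼ {∏ n f} {∏ n g} {f n} {g n} (∏-∼ n f g λ x x<n → eq x (m<n⇒m<1+n x<n)) (eq n ≤-refl)
    h-id : ∀ {x} → x ≢ 0 → h x ≡ x
    h-id {zero}  ne = ⊥-elim (ne refl)
    h-id {suc x} ne = refl
    step : ∀ x → x < p → h ((c * x) % p) ∼ e x * h x
    step zero    _   = cong (λ z → h (z % p) % p) (*-zeroʳ c) ∙ cong (λ z → h z % p) (n∣m⇒m%n≡0 0 p (p ∣0))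
      where _∙_ = trans
    step (suc x) x<p = trans (cong (_% p) (h-id nz)) (%-∼ (c * suc x))
      where
      nz : (c * suc x) % p ≢ 0
      nz eq = [ p∤c , (λ d → <⇒≱ x<p (∣⇒≤ d)) ]′ (euclidsLemma c (suc x) pp (m%n≡0⇒n∣m _ p eq))
    ∏e : ∏ p e ≡ c ^ (p ∸ 1)
    ∏e = subst (λ n → ∏ n e ≡ c ^ (p ∸ 1)) (m+[n∸m]≡n (<⇒≤ 1<p)) (go (p ∸ 1))
      where
      go : ∀ n → ∏ (suc n) e ≡ c ^ n
      go zero    = refl
      go (suc n) = trans (cong (_* c) (go n)) (*-comm (c ^ n) c)
    p∤∏ : ¬ (p ∣ ∏ p h)
    p∤∏ = go p ≤-refl
      where
      h≢ : ∀ x → x < p → ¬ (p ∣ h x)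
      h≢ zero    _   d = <⇒≱ 1<p (∣⇒≤ d)
      h≢ (suc x) x<p d = <⇒≱ x<p (∣⇒≤ d)
      go : ∀ n → n ≤ p → ¬ (p ∣ ∏ n h)
      go zero    _   d = <⇒≱ 1<p (∣⇒≤ d)
      go (suc n) n<p d = [ go n (<⇒≤ n<p) , h≢ n n<p ]′ (euclidsLemma (∏ n h) (h n) pp d)

-- Roots of polynomials modulo p and the number of m-th roots of unity

open ∑ℕ using (∑)

𝟙 : ∀ {a} {A : Set a} → Dec A → ℕ
𝟙 (yes _) = 1
𝟙 (no _)  = 0

𝟙-cong : ∀ {a b} {A : Set a} {B : Set b} (A? : Dec A) (B? : Dec B) →
         (A → B) → (B → A) → 𝟙 A? ≡ 𝟙 B?
𝟙-cong (yes _) (yes _) f g = refl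
𝟙-cong (yes a) (no ¬b) f g = ⊥-elim (¬b (f a))
𝟙-cong (no ¬a) (yes b) f g = ⊥-elim (¬a (g b))
𝟙-cong (no _)  (no _)  f g = refl

𝟙-yes : ∀ {a} {A : Set a} (A? : Dec A) → A → 𝟙 A? ≡ 1
𝟙-yes (yes _) a = refl
𝟙-yes (no ¬a) a = ⊥-elim (¬a a)

∑-mono : ∀ n {f g} → (∀ i → i < n → f i ≤ g i) → ∑ n f ≤ ∑ n g
∑-mono zero    le = z≤n
∑-mono (suc n) le = +-mono-≤ (∑-mono n λ i i<n → le i (m<n⇒m<1+n i<n)) (le n ≤-refl)

∑-const : ∀ n c → ∑ n (λ _ → c) ≡ n * c
∑-const zero    c = refl
∑-const (suc n) c = trans (cong (_+ c) (∑-const n c)) (+-comm (n * c) c)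

-- The list c₀ ∷ … ∷ cₖ₋₁ ∷ [] stands for the monic polynomial c₀ + … + cₖ₋₁ xᵏ⁻¹ + xᵏ.
monic : List ℕ → ℕ → ℕ
monic []       x = 1
monic (c ∷ cs) x = c + x * monic cs x

-- Synthetic division of `monic (c ∷ cs)` by x - a: the coefficients of the quotient are the values
-- at a of the successive tails.
quot : ℕ → ℕ → List ℕ → List ℕ
quot a c []        = []
quot a c (c′ ∷ cs) = monic (c′ ∷ cs) a ∷ quot a c′ cs

length-quot : ∀ a c cs → length (quot a c cs) ≡ length cs
length-quot a c []        = refl
length-quot a c (c′ ∷ cs) = cong suc (length-quot a c′ cs)

-- P(x) − P(a) = (x − a) Q(x) without subtraction.
quot-correct : ∀ a x c cs → monic (c ∷ cs) x + a * monic (quot a c cs) x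
                          ≡ monic (c ∷ cs) a + x * monic (quot a c cs) x
quot-correct a x c []        = ring a x c
  where
  ring : ∀ a x c → c + x * 1 + a * 1 ≡ c + a * 1 + x * 1
  ring = solve-∀
quot-correct a x c (c′ ∷ cs) = begin
  c + x * R + a * (r + x * q)         ≡⟨ ring₁ a x c R r q ⟩
  c + a * r + x * (R + a * q)         ≡⟨ cong (λ z → c + a * r + x * z) (quot-correct a x c′ cs) ⟩
  c + a * r + x * (r + x * q)         ∎
  where
  open ≡-Reasoning
  R = monic (c′ ∷ cs) x
  r = monic (c′ ∷ cs) a
  q = monic (quot a c′ cs) x
  ring₁ : ∀ a x c R r q → c + x * R + a * (r + x * q) ≡ c + a * r + x * (R + a * q)
  ring₁ = solve-∀

selectBelow : ∀ {ℓ} {P : ℕ → Set ℓ} → (∀ x → Dec (P x)) → ℕ → List ℕ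
selectBelow P? zero    = []
selectBelow P? (suc n) with P? n
... | yes _ = n ∷ selectBelow P? n
... | no _  = selectBelow P? n

module _ {ℓ} {P : ℕ → Set ℓ} (P? : ∀ x → Dec (P x)) where
  selectBelow-< : ∀ n → All (_< n) (selectBelow P? n)
  selectBelow-< zero    = []
  selectBelow-< (suc n) with P? n
  ... | yes _ = ≤-refl ∷ All.map m<n⇒m<1+n (selectBelow-< n)
  ... | no _  = All.map m<n⇒m<1+n (selectBelow-< n)

  selectBelow-P : ∀ n → All P (selectBelow P? n)
  selectBelow-P zero    = []
  selectBelow-P (suc n) with P? n
  ... | yes Pn = Pn ∷ selectBelow-P n
  ... | no _   = selectBelow-P n

  selectBelow-sorted : ∀ n → AllPairs (λ a b → b < a) (selectBelow P? n)
  selectBelow-sorted zero    = []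
  selectBelow-sorted (suc n) with P? n
  ... | yes _ = selectBelow-< n ∷ selectBelow-sorted n
  ... | no _  = selectBelow-sorted n

  length-selectBelow : ∀ n → length (selectBelow P? n) ≡ ∑ n (𝟙 ∘ P?)
  length-selectBelow zero    = refl
  length-selectBelow (suc n) with P? n
  ... | yes _ = trans (cong suc (length-selectBelow n)) (+-comm 1 _)
  ... | no _  = trans (length-selectBelow n) (sym (+-identityʳ _))

module PowerKernels (p : ℕ) (pp : Prime p) where
  open ModPrime p pp public

  ∼-distinct : ∀ {a b} → a < p → b < a → ¬ a ∼ b
  ∼-distinct a<p b<a e =
    <⇒≢ b<a (sym (trans (sym (m<n⇒m%n≡m a<p)) (trans e (m<n⇒m%n≡m (<-trans b<a a<p)))))

  p∤difference : ∀ {a b} → a < p → b < a → ¬ (p ∣ a ∸ b)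
  p∤difference a<p b<a d = ∼-distinct a<p b<a (sym (∣⇒∼ (<⇒≤ b<a) d))

  -- Lagrange's bound. Dividing out the head root r leaves a polynomial that vanishes at every other
  -- root s, since r - s is invertible modulo p. The decreasing order makes the roots distinct and
  -- the differences r - s genuine natural numbers.
  roots-≤ : ∀ cs rs → AllPairs (λ a b → b < a) rs → All (_< p) rs →
            All (λ r → monic cs r ∼ 0) rs → length rs ≤ length cs
  roots-≤ cs       []       _          _          _          = z≤n
  roots-≤ []       (r ∷ rs) _          _          (e ∷ _)    = ⊥-elim (1≢0 (trans (sym 1%p) (trans e (0%p))))
    where
    1≢0 : 1 ≢ 0
    1≢0 ()
    0%p : 0 % p ≡ 0
    0%p = n∣m⇒m%n≡0 0 p (p ∣0)
  roots-≤ (c ∷ cs) (r ∷ rs) (lt ∷ srt) (r<p ∷ bd) (e ∷ es)   =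
    s≤s (subst (length rs ≤_) (length-quot r c cs)
      (roots-≤ (quot r c cs) rs srt bd (All.zipWith root (lt , es))))
    where
    root : ∀ {s} → (s < r) × (monic (c ∷ cs) s ∼ 0) → monic (quot r c cs) s ∼ 0
    root {s} (s<r , e′) = cancelˡ (r ∸ s) (p∤difference r<p s<r) (sym (trans (cong (_% p) (*-zeroʳ (r ∸ s))) (sym diff)))
      where
      q = monic (quot r c cs) s
      rq∼sq : r * q ∼ s * q
      rq∼sq = trans (sym (+-∼ {monic (c ∷ cs) s} {0} {r * q} {r * q} e′ refl))
             (trans (cong (_% p) (quot-correct r s c cs))
                    (+-∼ {monic (c ∷ cs) r} {0} {s * q} {s * q} e refl))
      diff : (r ∸ s) * q ∼ 0
      diff = subst (_∼ 0) (sym (*-distribʳ-∸ q r s))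
        (∣⇒∼0 (∼⇒∣ (*-monoˡ-≤ q (<⇒≤ s<r)) (sym rq∼sq)))

  count-roots-≤ : ∀ cs {P : ℕ → Set} (P? : ∀ x → Dec (P x)) →
                  (∀ x → P x → monic cs x ∼ 0) → ∑ p (𝟙 ∘ P?) ≤ length cs
  count-roots-≤ cs P? root = subst (_≤ length cs) (length-selectBelow P? p)
    (roots-≤ cs (selectBelow P? p) (selectBelow-sorted P? p) (selectBelow-< P? p)
      (All.map (λ {x} → root x) (selectBelow-P P? p)))

  Ker : ℕ → ℕ → Set
  Ker m x = x ^ m ∼ 1

  Ker? : ∀ m x → Dec (Ker m x)
  Ker? m x = (x ^ m) % p ≟ 1 % p

  zeros : ℕ → List ℕ → List ℕ
  zeros zero    cs = cs
  zeros (suc n) cs = 0 ∷ zeros n cs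

  length-zeros : ∀ n cs → length (zeros n cs) ≡ n + length cs
  length-zeros zero    cs = refl
  length-zeros (suc n) cs = cong suc (length-zeros n cs)

  monic-zeros : ∀ n cs x → monic (zeros n cs) x ≡ x ^ n * monic cs x
  monic-zeros zero    cs x = sym (+-identityʳ _)
  monic-zeros (suc n) cs x = trans (cong (x *_) (monic-zeros n cs x)) (sym (*-assoc x (x ^ n) _))

  -- The polynomial x^(m + 1) - 1, with p - 1 standing for -1.
  power∸1 : ℕ → List ℕ
  power∸1 m = (p ∸ 1) ∷ zeros m []

  -- 1 + xᵐ + x²ᵐ + … + xᵗᵐ, with m = suc m′
  geometric : ℕ → ℕ → List ℕ
  geometric m′ zero    = []
  geometric m′ (suc t) = 1 ∷ zeros m′ (geometric m′ t)

  length-geometric : ∀ m′ t → length (geometric m′ t) ≡ t * suc m′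
  length-geometric m′ zero    = refl
  length-geometric m′ (suc t) = cong suc (trans (length-zeros m′ _) (cong (m′ +_) (length-geometric m′ t)))

  monic-geometric : ∀ m′ t x → x ^ suc m′ * monic (geometric m′ t) x + 1
                             ≡ monic (geometric m′ t) x + x ^ (suc m′ * suc t)
  monic-geometric m′ zero    x = trans (cong (_+ 1) (*-identityʳ _))
    (trans (+-comm _ 1) (cong (λ k → 1 + x ^ k) (sym (*-identityʳ (suc m′)))))
  monic-geometric m′ (suc t) x = begin
    X * g′ + 1                 ≡⟨ cong (λ z → X * z + 1) g′≡ ⟩
    X * (1 + X * g) + 1        ≡⟨ ring₁ X g ⟩
    X * (X * g + 1) + 1        ≡⟨ cong (λ z → X * z + 1) (monic-geometric m′ t x) ⟩
    X * (g + Y) + 1            ≡⟨ ring₂ X g Y ⟩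
    (1 + X * g) + X * Y        ≡⟨ cong₂ _+_ (sym g′≡) XY ⟩
    g′ + x ^ (suc m′ * suc (suc t)) ∎
    where
    open ≡-Reasoning
    X = x ^ suc m′
    Y = x ^ (suc m′ * suc t)
    g = monic (geometric m′ t) x
    g′ = monic (geometric m′ (suc t)) x
    g′≡ : g′ ≡ 1 + X * g
    g′≡ = cong suc (trans (cong (x *_) (monic-zeros m′ (geometric m′ t) x)) (sym (*-assoc x (x ^ m′) g)))
    XY : X * Y ≡ x ^ (suc m′ * suc (suc t))
    XY = trans (sym (^-distribˡ-+-* x (suc m′) (suc m′ * suc t))) (cong (x ^_) (sym (*-suc (suc m′) (suc t))))
    ring₁ : ∀ X g → X * (1 + X * g) + 1 ≡ X * (X * g + 1) + 1
    ring₁ = solve-∀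
    ring₂ : ∀ X g Y → X * (g + Y) + 1 ≡ (1 + X * g) + X * Y
    ring₂ = solve-∀

  Ker-count-≤ : ∀ m → ∑ p (𝟙 ∘ Ker? (suc m)) ≤ suc m
  Ker-count-≤ m = subst (∑ p (𝟙 ∘ Ker? (suc m)) ≤_) (cong suc (trans (length-zeros m []) (+-identityʳ m)))
    (count-roots-≤ (power∸1 m) (Ker? (suc m)) root)
    where
    root : ∀ x → Ker (suc m) x → monic (power∸1 m) x ∼ 0
    root x k = begin
      (p ∸ 1 + x * monic (zeros m []) x) % p ≡⟨ cong (λ z → (p ∸ 1 + x * z) % p) (trans (monic-zeros m [] x) (*-identityʳ _)) ⟩
      (p ∸ 1 + x ^ suc m) % p                ≡⟨ +-∼ {p ∸ 1} {p ∸ 1} {x ^ suc m} {1} refl k ⟩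
      (p ∸ 1 + 1) % p                        ≡⟨ cong (_% p) (m∸n+n≡m (<⇒≤ 1<p)) ⟩
      p % p                                  ≡⟨ ∣⇒∼0 ∣-refl ⟩
      0 % p                                  ∎
      where open ≡-Reasoning

  -- All p - 1 nonzero residues are roots of x^(m t) - 1, the product of x^m - 1 and a geometric sum
  -- of degree p - 1 - m. Neither factor has more roots than its degree, so neither can have fewer.
  Ker-count : ∀ m t → m * t ≡ p ∸ 1 → ∑ p (𝟙 ∘ Ker? m) ≡ m
  Ker-count zero     t       e = ⊥-elim (<⇒≢ (m<n⇒0<n∸m 1<p) e)
  Ker-count (suc m′) zero    e = ⊥-elim (<⇒≢ (m<n⇒0<n∸m 1<p) (trans (sym (*-zeroʳ m′)) e))
  Ker-count m@(suc m′) (suc t) e = ≤-antisym (Ker-count-≤ m′) (+-cancelʳ-≤ (t * m) _ _ (begin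
    m + t * m                                    ≡⟨ trans (*-comm (suc t) m) e ⟩
    p ∸ 1                                        ≤⟨ cover ⟩
    ∑ p (𝟙 ∘ Ker? m) + ∑ p (𝟙 ∘ cof?)            ≤⟨ +-monoʳ-≤ _ cof≤ ⟩
    ∑ p (𝟙 ∘ Ker? m) + t * m                     ∎))
    where
    open ≤-Reasoning
    g = geometric m′ t
    cof? : ∀ x → Dec (monic g x ∼ 0)
    cof? x = monic g x % p ≟ 0 % p
    cof≤ : ∑ p (𝟙 ∘ cof?) ≤ t * m
    cof≤ = subst (∑ p (𝟙 ∘ cof?) ≤_) (length-geometric m′ t) (count-roots-≤ g cof? (λ _ z → z))
    -- By `fermat` the product (x^m - 1) G vanishes modulo p, hence one of its factors does.
    either : ∀ x → ¬ (p ∣ x) → 1 ≤ 𝟙 (Ker? m x) + 𝟙 (cof? x)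
    either x p∤x with Ker? m x
    ... | yes _ = s≤s z≤n
    ... | no ¬k = ≤-reflexive (sym (𝟙-yes (cof? x) g∼0))
      where
      X = x ^ m
      G = monic g x
      XG∼G : X * G ∼ G
      XG∼G = cancel-1 (trans (cong (_% p) (monic-geometric m′ t x))
               (+-∼ {G} {G} {x ^ (m * suc t)} {1} refl (trans (cong (λ k → (x ^ k) % p) e) (fermat x p∤x))))
        where
        cancel-1 : X * G + 1 ∼ G + 1 → X * G ∼ G
        cancel-1 eq = trans (sym (unshift (X * G))) (trans (+-∼ {X * G + 1} {G + 1} {p ∸ 1} {p ∸ 1} eq refl) (unshift G))
          where
          unshift : ∀ z → z + 1 + (p ∸ 1) ∼ z
          unshift z = trans (cong (_% p) (trans (+-assoc z 1 (p ∸ 1)) (cong (z +_) (m+[n∸m]≡n (<⇒≤ 1<p))))) ([m+n]%n≡m%n z p)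
      g∼0 : G ∼ 0
      g∼0 with 1 ≤? X
      -- The case x^m = 0, where X - 1 would be truncated: G is congruent to X G = 0 at once.
      ... | no X<1 = trans (sym XG∼G) (cong (λ z → (z * G) % p) (n<1⇒n≡0 (≰⇒> X<1)))
      ... | yes 1≤X = [ (λ d → ⊥-elim (¬k (sym (∣⇒∼ 1≤X d)))) , ∣⇒∼0 ]′
          (euclidsLemma (X ∸ 1) G pp (subst (p ∣_) (trans (cong (X * G ∸_) (sym (*-identityˡ G))) (sym (*-distribʳ-∸ G X 1)))
            (∼⇒∣ (subst (_≤ X * G) (*-identityˡ G) (*-monoˡ-≤ G 1≤X)) (sym XG∼G))))
    cover : p ∸ 1 ≤ ∑ p (𝟙 ∘ Ker? m) + ∑ p (𝟙 ∘ cof?)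
    cover = subst (p ∸ 1 ≤_) (∑ℕ.∑-distrib-+ p _ _)
      (subst (λ n → n ∸ 1 ≤ ∑ n F) (m+[n∸m]≡n (<⇒≤ 1<p))
        (subst (p ∸ 1 ≤_) (∑ℕ.∑-head (p ∸ 1) F) (≤-trans (subst (_≤ ∑ (p ∸ 1) (F ∘ suc)) (trans (∑-const (p ∸ 1) 1) (*-identityʳ (p ∸ 1)))
          (∑-mono (p ∸ 1) λ i i< → either (suc i) (λ d → <⇒≱ (≤-trans (s≤s i<) (≤-reflexive (m+[n∸m]≡n (<⇒≤ 1<p)))) (∣⇒≤ d))))
          (m≤n+m _ (F 0)))))
      where
      F = λ x → 𝟙 (Ker? m x) + 𝟙 (cof? x)

-- Residues free of a set of primes

-- Euler's function of `product E` when E lists distinct primes.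
φ : List ℕ → ℕ
φ []      = 1
φ (r ∷ E) = (r ∸ 1) * φ E

*-swapˡ : ∀ a b c → a * (b * c) ≡ b * (a * c)
*-swapˡ = solve-∀

^-distribʳ-* : ∀ n a b → (a * b) ^ n ≡ a ^ n * b ^ n
^-distribʳ-* zero    a b = refl
^-distribʳ-* (suc n) a b = trans (cong (a * b *_) (^-distribʳ-* n a b)) (ring a b (a ^ n) (b ^ n))
  where
  ring : ∀ a b c d → a * b * (c * d) ≡ a * c * (b * d)
  ring = solve-∀

module FreeParts (p : ℕ) (pp : Prime p) where
  open PowerKernels p pp public

  Ker-cong : ∀ {m} x y → x ∼ y → Ker m x → Ker m y
  Ker-cong {m} x y e k = trans (sym (^-∼ {x} {y} m e)) k

  Ker-* : ∀ a {m x} → Ker m x → Ker (a * m) x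
  Ker-* a {m} {x} k = subst (λ n → Ker n x) (*-comm m a)
    (trans (cong (_% p) (sym (^-*-assoc x m a))) (1^∼ {x ^ m} a k))

  Ker-∙ : ∀ {m} y x → Ker m y → Ker m x → Ker m (y * x)
  Ker-∙ {m} y x k l = trans (cong (_% p) (^-distribʳ-* m y x)) (*-∼ {y ^ m} {1} {x ^ m} {1} k l)

  Ker-∙⁻ : ∀ {m} y x → Ker m y → Ker m (y * x) → Ker m x
  Ker-∙⁻ {m} y x k l = trans (sym (trans (*-∼ {y ^ m} {1} {x ^ m} {x ^ m} k refl) (cong (_% p) (*-identityˡ (x ^ m)))))
    (trans (cong (_% p) (sym (^-distribʳ-* m y x))) l)

  -- Bézout in the exponent: M is an integer combination of aM and bM, and its negative part is
  -- moved to the other side.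
  Ker-meet : ∀ {a b} M x → Coprime a b → Ker (a * M) x → Ker (b * M) x → Ker M x
  Ker-meet {a} {b} M x cop ka kb = cases (Cop.coprime-Bézout cop)
    where
    extract : ∀ t b s a → 1 + t * b ≡ s * a → Ker (b * M) x → Ker (a * M) x → Ker M x
    extract t b s a eq kb ka = begin
      x ^ M % p                          ≡⟨ cong (_% p) (*-identityʳ (x ^ M)) ⟨
      (x ^ M * 1) % p                    ≡⟨ *-∼ {x ^ M} {x ^ M} {1} {x ^ (t * (b * M))} refl (sym (Ker-* t {b * M} {x} kb)) ⟩
      (x ^ M * x ^ (t * (b * M))) % p    ≡⟨ cong (_% p) (^-distribˡ-+-* x M _) ⟨
      (x ^ (M + t * (b * M))) % p        ≡⟨ cong (λ k → (x ^ k) % p) (trans (ring M t b) (trans (cong (_* M) eq) (*-assoc s a M))) ⟩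
      (x ^ (s * (a * M))) % p            ≡⟨ Ker-* s {a * M} {x} ka ⟩
      1 % p                              ∎
      where
      open ≡-Reasoning
      ring : ∀ M t b → M + t * (b * M) ≡ (1 + t * b) * M
      ring = solve-∀
    cases : Bézout.Identity 1 a b → Ker M x
    cases (Bézout.+- s t eq) = extract t b s a eq kb ka
    cases (Bézout.-+ s t eq) = extract s a t b eq ka kb

  -- For M · ∏E ∣ p − 1: x is a ((p − 1)/(M · ∏E))-th power and, for each prime r in E, not
  -- a ((p − 1)/(M · ∏E/r))-th power.  The recursion is the inclusion–exclusion over E.
  Free : List ℕ → ℕ → ℕ → Set
  Free []      M x = Ker M x
  Free (r ∷ E) M x = Free E (r * M) x × ¬ Free E M x

  Free? : ∀ E M x → Dec (Free E M x)
  Free? []      M x = Ker? M x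
  Free? (r ∷ E) M x = Free? E (r * M) x ×-dec ¬? (Free? E M x)

  Free-cong : ∀ E {M x y} → x ∼ y → Free E M x → Free E M y
  Free-cong []      {M} {x} {y} e f = Ker-cong {M} x y e f
  Free-cong (r ∷ E) e (f , ¬g) = Free-cong E e f , ¬g ∘ Free-cong E (sym e)

  -- Invariance under M-th roots of unity, on which the averaging over dilations rests. The two
  -- directions are mutual because `Free` contains negations.
  Free-∙  : ∀ E {M y x} → Ker M y → Free E M x → Free E M (y * x)
  Free-∙⁻ : ∀ E {M y x} → Ker M y → Free E M (y * x) → Free E M x
  Free-∙  []      {M} {y} {x} k f = Ker-∙ {M} y x k f
  Free-∙  (r ∷ E) {M} {y} k (f , ¬g) = Free-∙ E (Ker-* r {M} {y} k) f , ¬g ∘ Free-∙⁻ E k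
  Free-∙⁻ []      {M} {y} {x} k f = Ker-∙⁻ {M} y x k f
  Free-∙⁻ (r ∷ E) {M} {y} k (f , ¬g) = Free-∙⁻ E (Ker-* r {M} {y} k) f , ¬g ∘ Free-∙ E k

  -- Monotonicity in M. The negative half of `Free (q ∷ E)` obstructs a plain induction: freeness at
  -- level rM must be excluded, and with freeness at level qM it would descend to level M by
  -- `Free-meet`.
  Free-* : ∀ E {r M x} → AllPairs Coprime E → All (Coprime r) E → Free E M x → Free E (r * M) x
  Free-meet : ∀ E {a b M x} → AllPairs Coprime E → All (Coprime a) E → Coprime a b →
              Free E (a * M) x → Free E (b * M) x → Free E M x
  Free-* []      {r} {M} {x} _ _ f = Ker-* r {M} {x} f
  Free-* (q ∷ E) {r} {M} {x} (cq ∷ cE) (c ∷ cs) (f , ¬g) =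
    subst (λ m → Free E m x) (*-swapˡ r q M) (Free-* E cE cs f) ,
    λ h → ¬g (Free-meet E cE cs c h f)
  Free-meet []      {a} {b} {M} {x} _ _ cab f g = Ker-meet {a} {b} M x cab f g
  Free-meet (s ∷ E) {a} {b} {M} {x} (cs ∷ cE) (ca ∷ cas) cab (f , ¬f′) (g , _) =
    Free-meet E cE cas cab (subst (λ m → Free E m x) (*-swapˡ s a M) f) (subst (λ m → Free E m x) (*-swapˡ s b M) g) ,
    ¬f′ ∘ Free-* E cE cas

  -- A partial converse of `Free-*`. The kernel condition is the positive content of freeness at
  -- level M, and the negative conditions descend from level rM by `Free-*`.
  Free-*⁻ : ∀ E {r M x} → AllPairs Coprime E → All (Coprime r) E →
            Free E (r * M) x → Ker (product E * M) x → Free E M x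
  Free-*⁻ []      {r} {M} {x} _ _ f k = subst (λ m → Ker m x) (+-identityʳ M) k
  Free-*⁻ (q ∷ E) {r} {M} {x} (cq ∷ cE) (c ∷ cs) (f , ¬g) k =
    Free-*⁻ E cE cs (subst (λ m → Free E m x) (*-swapˡ q r M) f)
      (subst (λ m → Ker m x) (trans (*-assoc q (product E) M) (*-swapˡ q (product E) M)) k) ,
    ¬g ∘ Free-* E cE cs

  -- The order test at a prime q of E. If x^m were 1, `Free-*⁻` would carry the positive half of the
  -- q-step down to the level which its negative half excludes.
  Free⇒¬Ker : ∀ E {M x q m} → AllPairs Coprime E → q ∈ E → q * m ≡ product E * M → q ≢ 0 →
              Free E M x → ¬ Ker m x
  Free⇒¬Ker (r ∷ E) {M} {x} {q} {m} (c ∷ cE) (here refl) e q≢0 (f , ¬g) k =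
    ¬g (Free-*⁻ E cE c f (subst (λ n → Ker n x) m≡ k))
    where
    m≡ : m ≡ product E * M
    m≡ = *-cancelˡ-≡ m (product E * M) q {{Data.Nat.Base.≢-nonZero q≢0}} (trans e (*-assoc q (product E) M))
  Free⇒¬Ker (r ∷ E) {M} {x} {q} {m} (c ∷ cE) (there q∈E) e q≢0 (f , _) =
    Free⇒¬Ker E cE q∈E (trans e (trans (*-assoc r (product E) M) (*-swapˡ r (product E) M))) q≢0 f

  ind : List ℕ → ℕ → ℕ → ℕ
  ind E M x = 𝟙 (Free? E M x)

  ind-% : ∀ E M x → ind E M (x % p) ≡ ind E M x
  ind-% E M x = 𝟙-cong (Free? E M (x % p)) (Free? E M x) (Free-cong E (%-∼ x)) (Free-cong E (sym (%-∼ x)))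

  ind-∙ : ∀ E M {y} x → Ker M y → ind E M (y * x) ≡ ind E M x
  ind-∙ E M {y} x k = 𝟙-cong (Free? E M (y * x)) (Free? E M x) (Free-∙⁻ E k) (Free-∙ E k)

  ind-split : ∀ r E M x → AllPairs Coprime E → All (Coprime r) E →
              ind (r ∷ E) M x + ind E M x ≡ ind E (r * M) x
  ind-split r E M x cE c with Free? E (r * M) x | Free? E M x
  ... | yes _ | yes _ = refl
  ... | yes _ | no _  = refl
  ... | no ¬f | yes g = ⊥-elim (¬f (Free-* E cE c g))
  ... | no _  | no _  = refl

  -- The index t is arbitrary because the r-th powers among the free residues are a set of the same
  -- kind, with M / r for M and index r.
  ∑-ind : ∀ E M t → AllPairs Coprime E → All NonZero E → t * (product E * M) ≡ p ∸ 1 →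
          ∑ p (ind E M) ≡ φ E * M
  ∑-ind []      M t _        _          e =
    trans (Ker-count M t (trans (*-comm M t) (trans (cong (t *_) (sym (+-identityʳ M))) e))) (sym (+-identityʳ M))
  ∑-ind (r ∷ E) M t (c ∷ cE) (r≢0 ∷ nz) e = +-cancelʳ-≡ (φ E * M) _ _ (begin
    ∑ p (ind (r ∷ E) M) + φ E * M         ≡⟨ cong (∑ p (ind (r ∷ E) M) +_) (∑-ind E M (t * r) cE nz (trans (ring₁ t r (product E) M) e)) ⟨
    ∑ p (ind (r ∷ E) M) + ∑ p (ind E M)   ≡⟨ ∑ℕ.∑-distrib-+ p _ _ ⟨
    ∑ p (λ x → ind (r ∷ E) M x + ind E M x) ≡⟨ ∑ℕ.∑-ext p (λ x → ind-split r E M x cE c) ⟩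
    ∑ p (ind E (r * M))                   ≡⟨ ∑-ind E (r * M) t cE nz (trans (ring₂ t r (product E) M) e) ⟩
    φ E * (r * M)                         ≡⟨ cong (λ z → φ E * (z * M)) (m∸n+n≡m {r} {1} (>-nonZero⁻¹ r {{r≢0}})) ⟨
    φ E * ((r ∸ 1 + 1) * M)               ≡⟨ ring₃ (r ∸ 1) (φ E) M ⟩
    (r ∸ 1) * φ E * M + φ E * M           ∎)
    where
    open ≡-Reasoning
    open Data.Nat.Base using (>-nonZero⁻¹)
    ring₁ : ∀ t r P M → t * r * (P * M) ≡ t * (r * P * M)
    ring₁ = solve-∀
    ring₂ : ∀ t r P M → t * (P * (r * M)) ≡ t * (r * P * M)
    ring₂ = solve-∀
    ring₃ : ∀ r f M → f * ((r + 1) * M) ≡ r * f * M + f * M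
    ring₃ = solve-∀

-- Second moments over dilations

module MomentMethod where
  open import Data.Integer.Base as ℤ using (ℤ; +_; 0ℤ; 1ℤ)
  import Data.Integer.Properties as ℤₚ
  import Data.Integer.Tactic.RingSolver as ℤRing

  module ∑ℤ = Sum ℤₚ.+-*-commutativeSemiring
  open ∑ℤ using () renaming (∑ to ∑ᶻ)

  infix 7.5 _²
  _² : ℤ → ℤ
  a ² = a ℤ.* a

  0≤a² : ∀ a → 0ℤ ℤ.≤ a ²
  0≤a² (+ n)        = subst (0ℤ ℤ.≤_) (ℤₚ.pos-* n n) (ℤ.+≤+ z≤n)
  0≤a² (ℤ.-[1+ n ]) = ℤ.+≤+ z≤n

  ∑ᶻ-mono : ∀ n {f g} → (∀ i → i < n → f i ℤ.≤ g i) → ∑ᶻ n f ℤ.≤ ∑ᶻ n g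
  ∑ᶻ-mono zero    le = ℤₚ.≤-refl
  ∑ᶻ-mono (suc n) le = ℤₚ.+-mono-≤ (∑ᶻ-mono n λ i i<n → le i (m<n⇒m<1+n i<n)) (le n ≤-refl)

  ∑ᶻ-nonneg : ∀ n {f} → (∀ i → 0ℤ ℤ.≤ f i) → 0ℤ ℤ.≤ ∑ᶻ n f
  ∑ᶻ-nonneg n {f} le = subst (ℤ._≤ ∑ᶻ n f) (∑ℤ.∑-zero n) (∑ᶻ-mono n λ i _ → le i)

  ∑ᶻ-const : ∀ n c → ∑ᶻ n (λ _ → c) ≡ + n ℤ.* c
  ∑ᶻ-const zero    c = sym (ℤₚ.*-zeroˡ c)
  ∑ᶻ-const (suc n) c = trans (cong (ℤ._+ c) (∑ᶻ-const n c)) (trans (ring (+ n) c) (cong (ℤ._* c) (sym (ℤₚ.pos-+ 1 n))))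
    where
    ring : ∀ n c → n ℤ.* c ℤ.+ c ≡ (1ℤ ℤ.+ n) ℤ.* c
    ring = ℤRing.solve-∀

  ∑ᶻ-prefix : ∀ {m n} f → (∀ i → 0ℤ ℤ.≤ f i) → m ≤ n → ∑ᶻ m f ℤ.≤ ∑ᶻ n f
  ∑ᶻ-prefix {m} {zero}  f f≥0 z≤n = ℤₚ.≤-refl
  ∑ᶻ-prefix {m} {suc n} f f≥0 m≤1+n with m≤n⇒m<n∨m≡n m≤1+n
  ... | inj₂ refl      = ℤₚ.≤-refl
  ... | inj₁ (s≤s m≤n) = ℤₚ.≤-trans (∑ᶻ-prefix f f≥0 m≤n)
    (subst (ℤ._≤ ∑ᶻ (suc n) f) (ℤₚ.+-identityʳ _) (ℤₚ.+-monoʳ-≤ (∑ᶻ n f) (f≥0 n)))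

  ∑ᶻ-diagonal : ∀ K (c : ℕ → ℕ → ℤ) w → (∀ i → i < K → c i i ≡ w) →
                (∀ i j → i < K → j < K → i ≢ j → c i j ≡ 0ℤ) →
                ∑ᶻ K (λ i → ∑ᶻ K (c i)) ≡ + K ℤ.* w
  ∑ᶻ-diagonal zero    c w dg off = sym (ℤₚ.*-zeroˡ w)
  ∑ᶻ-diagonal (suc K) c w dg off = begin
    ∑ᶻ K (λ i → ∑ᶻ K (c i) ℤ.+ c i K) ℤ.+ (∑ᶻ K (c K) ℤ.+ c K K)
      ≡⟨ cong₂ ℤ._+_ (∑ℤ.∑-cong K λ i i<K → trans (cong (λ z → ∑ᶻ K (c i) ℤ.+ z) (off i K (m<n⇒m<1+n i<K) ≤-refl (<⇒≢ i<K))) (ℤₚ.+-identityʳ _))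
                     (cong₂ ℤ._+_ (trans (∑ℤ.∑-cong K λ j j<K → off K j ≤-refl (m<n⇒m<1+n j<K) (≢-sym (<⇒≢ j<K))) (∑ℤ.∑-zero K)) (dg K ≤-refl)) ⟩
    ∑ᶻ K (λ i → ∑ᶻ K (c i)) ℤ.+ (0ℤ ℤ.+ w)
      ≡⟨ cong₂ ℤ._+_ (∑ᶻ-diagonal K c w (λ i i<K → dg i (m<n⇒m<1+n i<K)) (λ i j i<K j<K → off i j (m<n⇒m<1+n i<K) (m<n⇒m<1+n j<K))) (ℤₚ.+-identityˡ w) ⟩
    + K ℤ.* w ℤ.+ w
      ≡⟨ ring (+ K) w ⟩
    (1ℤ ℤ.+ + K) ℤ.* w
      ≡⟨ cong (ℤ._* w) (ℤₚ.pos-+ 1 K) ⟨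
    + suc K ℤ.* w ∎
    where
    open ≡-Reasoning
    ring : ∀ k w → k ℤ.* w ℤ.+ w ≡ (1ℤ ℤ.+ k) ℤ.* w
    ring = ℤRing.solve-∀

  -- Twice the difference of the two sides is the double sum of (f i - f j)².
  cauchy-schwarz : ∀ K f → ∑ᶻ K f ² ℤ.≤ + K ℤ.* ∑ᶻ K (λ i → f i ²)
  cauchy-schwarz K f = half (subst (0ℤ ℤ.≤_) expand (∑ᶻ-nonneg K λ i → ∑ᶻ-nonneg K λ j → 0≤a² (f i ℤ.- f j)))
    where
    open ≡-Reasoning
    S = ∑ᶻ K f
    Q = ∑ᶻ K (λ i → f i ²)
    sq : ∀ a b → (a ℤ.- b) ² ≡ (a ² ℤ.+ b ²) ℤ.+ ((ℤ.- + 2) ℤ.* a) ℤ.* b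
    sq a b = ring a b
      where
      ring : ∀ a b → (a ℤ.- b) ℤ.* (a ℤ.- b) ≡ (a ℤ.* a ℤ.+ b ℤ.* b) ℤ.+ ((ℤ.- + 2) ℤ.* a) ℤ.* b
      ring = ℤRing.solve-∀
    inner : ∀ i → ∑ᶻ K (λ j → (f i ℤ.- f j) ²) ≡ (+ K ℤ.* f i ² ℤ.+ Q) ℤ.+ ((ℤ.- + 2) ℤ.* f i) ℤ.* S
    inner i = begin
      ∑ᶻ K (λ j → (f i ℤ.- f j) ²)
        ≡⟨ ∑ℤ.∑-ext K (λ j → sq (f i) (f j)) ⟩
      ∑ᶻ K (λ j → (f i ² ℤ.+ f j ²) ℤ.+ ((ℤ.- + 2) ℤ.* f i) ℤ.* f j)
        ≡⟨ ∑ℤ.∑-distrib-+ K _ _ ⟩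
      ∑ᶻ K (λ j → f i ² ℤ.+ f j ²) ℤ.+ ∑ᶻ K (λ j → ((ℤ.- + 2) ℤ.* f i) ℤ.* f j)
        ≡⟨ cong₂ ℤ._+_ (trans (∑ℤ.∑-distrib-+ K _ _) (cong (ℤ._+ Q) (∑ᶻ-const K (f i ²)))) (sym (∑ℤ.∑-distribˡ-* K ((ℤ.- + 2) ℤ.* f i) f)) ⟩
      (+ K ℤ.* f i ² ℤ.+ Q) ℤ.+ ((ℤ.- + 2) ℤ.* f i) ℤ.* S ∎
    expand : ∑ᶻ K (λ i → ∑ᶻ K (λ j → (f i ℤ.- f j) ²)) ≡ + 2 ℤ.* (+ K ℤ.* Q ℤ.- S ²)
    expand = begin
      ∑ᶻ K (λ i → ∑ᶻ K (λ j → (f i ℤ.- f j) ²))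
        ≡⟨ ∑ℤ.∑-ext K inner ⟩
      ∑ᶻ K (λ i → (+ K ℤ.* f i ² ℤ.+ Q) ℤ.+ ((ℤ.- + 2) ℤ.* f i) ℤ.* S)
        ≡⟨ trans (∑ℤ.∑-distrib-+ K _ _) (cong₂ ℤ._+_ (∑ℤ.∑-distrib-+ K _ _) refl) ⟩
      (∑ᶻ K (λ i → + K ℤ.* f i ²) ℤ.+ ∑ᶻ K (λ _ → Q)) ℤ.+ ∑ᶻ K (λ i → ((ℤ.- + 2) ℤ.* f i) ℤ.* S)
        ≡⟨ cong₂ ℤ._+_ (cong₂ ℤ._+_ (sym (∑ℤ.∑-distribˡ-* K (+ K) _)) (∑ᶻ-const K Q))
             (trans (sym (∑ℤ.∑-distribʳ-* K S _)) (cong (ℤ._* S) (sym (∑ℤ.∑-distribˡ-* K (ℤ.- + 2) f)))) ⟩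
      (+ K ℤ.* Q ℤ.+ + K ℤ.* Q) ℤ.+ ((ℤ.- + 2) ℤ.* S) ℤ.* S
        ≡⟨ ring (+ K) Q S ⟩
      + 2 ℤ.* (+ K ℤ.* Q ℤ.- S ²) ∎
      where
      ring : ∀ k Q S → (k ℤ.* Q ℤ.+ k ℤ.* Q) ℤ.+ ((ℤ.- + 2) ℤ.* S) ℤ.* S ≡ + 2 ℤ.* (k ℤ.* Q ℤ.- S ℤ.* S)
      ring = ℤRing.solve-∀
    half : 0ℤ ℤ.≤ + 2 ℤ.* (+ K ℤ.* Q ℤ.- S ²) → S ² ℤ.≤ + K ℤ.* Q
    half le = ℤₚ.0≤i-j⇒j≤i (ℤₚ.*-cancelˡ-≤-pos 0ℤ (+ K ℤ.* Q ℤ.- S ²) (+ 2) le)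

  module SecondMoment (p : ℕ) (pp : Prime p) where
    open PowerKernels p pp public

    Periodic : (ℕ → ℤ) → Set
    Periodic g = ∀ x y → x ∼ y → g x ≡ g y

    +p-∼ : ∀ x → x + p ∼ x
    +p-∼ x = [m+n]%n≡m%n x p

    ∑-translate : ∀ g → Periodic g → ∀ k → ∑ᶻ p (λ x → g (x + k)) ≡ ∑ᶻ p g
    ∑-translate g per k = ∑ℤ.∑-shift p g (λ x → per (x + p) x (+p-∼ x)) k

    ∑-scale : ∀ g → Periodic g → ∀ c → ¬ (p ∣ c) → ∑ᶻ p (λ x → g (c * x)) ≡ ∑ᶻ p g
    ∑-scale g per c p∤c = trans (∑ℤ.∑-ext p λ x → per (c * x) ((c * x) % p) (sym (%-∼ (c * x))))
      (Dilate.∑-dilate ℤₚ.+-0-commutativeMonoid c p∤c g)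

    ∑-affine : ∀ g → Periodic g → ∀ u c → ¬ (p ∣ c) → ∑ᶻ p (λ x → g (u + c * x)) ≡ ∑ᶻ p g
    ∑-affine g per u c p∤c = trans (∑-scale (λ y → g (u + y)) (λ x y e → per _ _ (+-∼ {u} {u} {x} {y} refl e)) c p∤c)
      (trans (∑ℤ.∑-ext p λ x → cong g (+-comm u x)) (∑-translate g per u))

    -- U is the indicator of a set of dilations that leave f unchanged. In use f is p F - N and U
    -- belongs to the group of M-th roots of unity.
    module _ (f : ℕ → ℤ) (per : Periodic f) (mean0 : ∑ᶻ p f ≡ 0ℤ)
             (U : ℕ → ℤ)
             (U-inv : ∀ c → c < p → (U c ≡ 0ℤ) ⊎ ((U c ≡ 1ℤ) × ¬ (p ∣ c) × (∀ x → f (c * x) ≡ f x)))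
             (v : ℕ) (p∤v : ¬ (p ∣ v)) (K : ℕ) (K≤p : K ≤ p) where

      private
        Q = ∑ᶻ p (λ x → f x ²)
        G : ℕ → ℕ → ℤ
        G c x = ∑ᶻ K (λ i → f (c * (v * i) + x))
        Y : ℕ → ℤ
        Y c = ∑ᶻ p (λ x → G c x ²)

        G-per : ∀ c → Periodic (G c)
        G-per c x y e = ∑ℤ.∑-ext K λ i → per _ _ (+-∼ {c * (v * i)} {c * (v * i)} {x} {y} refl e)

        G²-per : ∀ c → Periodic (λ x → G c x ²)
        G²-per c x y e = cong _² (G-per c x y e)

        -- Substituting c x for x makes c a common factor of all arguments of f, and invariance
        -- removes it.
        Y-orbit : ∀ c → ¬ (p ∣ c) → (∀ x → f (c * x) ≡ f x) → Y c ≡ Y 1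
        Y-orbit c p∤c inv = trans (sym (∑-scale (λ x → G c x ²) (G²-per c) c p∤c))
          (∑ℤ.∑-ext p λ x → cong _² (∑ℤ.∑-ext K λ i →
            trans (cong f (ring c (v * i) x)) (inv _)))
          where
          ring : ∀ c w x → c * w + c * x ≡ c * (1 * w + x)
          ring = solve-∀

        Y≥0 : ∀ c → 0ℤ ℤ.≤ Y c
        Y≥0 c = ∑ᶻ-nonneg p λ x → 0≤a² (G c x)

        orbit-≤ : ∑ᶻ p U ℤ.* Y 1 ℤ.≤ ∑ᶻ p Y
        orbit-≤ = subst (ℤ._≤ ∑ᶻ p Y) (sym (∑ℤ.∑-distribʳ-* p (Y 1) U)) (∑ᶻ-mono p step)
          where
          step : ∀ c → c < p → U c ℤ.* Y 1 ℤ.≤ Y c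
          step c c<p with U-inv c c<p
          ... | inj₁ e = subst (ℤ._≤ Y c) (sym (trans (cong (ℤ._* Y 1) e) (ℤₚ.*-zeroˡ (Y 1)))) (Y≥0 c)
          ... | inj₂ (e , p∤c , inv) = ℤₚ.≤-reflexive (trans (cong (ℤ._* Y 1) e) (trans (ℤₚ.*-identityˡ (Y 1)) (sym (Y-orbit c p∤c inv))))

        C : ℕ → ℕ → ℤ
        C i j = ∑ᶻ p (λ c → ∑ᶻ p (λ x → f (c * (v * i) + x) ℤ.* f (c * (v * j) + x)))

        C-diag : ∀ i → C i i ≡ + p ℤ.* Q
        C-diag i = trans (∑ℤ.∑-ext p λ c →
            trans (∑ℤ.∑-ext p λ x → cong (λ z → f z ²) (+-comm (c * (v * i)) x))
                  (∑-translate (λ x → f x ²) (λ x y e → cong _² (per x y e)) (c * (v * i))))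
          (∑ᶻ-const p Q)

        C-sym : ∀ i j → C i j ≡ C j i
        C-sym i j = ∑ℤ.∑-ext p λ c → ∑ℤ.∑-ext p λ x → ℤₚ.*-comm (f (c * (v * i) + x)) _

        -- Since 0 < j - i < K ≤ p, the number w = v (j - i) is prime to p. For fixed y the argument
        -- y + w c then runs through all residues as c does, and f has mean zero.
        C-< : ∀ i j → i < j → j < K → C i j ≡ 0ℤ
        C-< i j i<j j<K = begin
          C i j
            ≡⟨ ∑ℤ.∑-ext p (λ c → trans (∑ℤ.∑-ext p λ x → cong₂ (λ a b → f a ℤ.* f b) (+-comm (c * (v * i)) x) (eq c x))
                 (∑-translate (λ y → f y ℤ.* f (y + w * c)) (λ x y e → cong₂ ℤ._*_ (per x y e) (per _ _ (+-∼ {x} {y} {w * c} {w * c} e refl))) (c * (v * i)))) ⟩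
          ∑ᶻ p (λ c → ∑ᶻ p (λ y → f y ℤ.* f (y + w * c)))
            ≡⟨ ∑ℤ.∑-swap p p _ ⟩
          ∑ᶻ p (λ y → ∑ᶻ p (λ c → f y ℤ.* f (y + w * c)))
            ≡⟨ ∑ℤ.∑-ext p (λ y → trans (sym (∑ℤ.∑-distribˡ-* p (f y) _))
                 (trans (cong (f y ℤ.*_) (trans (∑-affine f per y w p∤w) mean0)) (ℤₚ.*-zeroʳ (f y)))) ⟩
          ∑ᶻ p (λ _ → 0ℤ)
            ≡⟨ ∑ℤ.∑-zero p ⟩
          0ℤ ∎
          where
          open ≡-Reasoning
          w = v * (j ∸ i)
          p∤w : ¬ (p ∣ w)
          p∤w d = [ p∤v , p∤difference (<-≤-trans j<K K≤p) i<j ]′ (euclidsLemma v (j ∸ i) pp d)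
          ring : ∀ c v i d x → c * (v * (i + d)) + x ≡ x + c * (v * i) + v * d * c
          ring = solve-∀
          eq : ∀ c x → c * (v * j) + x ≡ x + c * (v * i) + w * c
          eq c x = trans (cong (λ z → c * (v * z) + x) (sym (m+[n∸m]≡n (<⇒≤ i<j)))) (ring c v i (j ∸ i) x)

        C-off : ∀ i j → i < K → j < K → i ≢ j → C i j ≡ 0ℤ
        C-off i j i<K j<K i≢j with <-cmp i j
        ... | tri< i<j _ _ = C-< i j i<j j<K
        ... | tri≈ _ e _   = ⊥-elim (i≢j e)
        ... | tri> _ _ j<i = trans (C-sym i j) (C-< j i j<i i<K)

        total : ∑ᶻ p Y ≡ + K ℤ.* (+ p ℤ.* Q)
        total = begin
          ∑ᶻ p (λ c → ∑ᶻ p (λ x → G c x ²))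
            ≡⟨ ∑ℤ.∑-ext p (λ c → trans (∑ℤ.∑-ext p λ x → ∑ℤ.∑-*-∑ K K _ _)
                 (trans (∑ℤ.∑-swap p K _) (∑ℤ.∑-ext K λ i → ∑ℤ.∑-swap p K _))) ⟩
          ∑ᶻ p (λ c → ∑ᶻ K (λ i → ∑ᶻ K (λ j → ∑ᶻ p (λ x → f (c * (v * i) + x) ℤ.* f (c * (v * j) + x)))))
            ≡⟨ trans (∑ℤ.∑-swap p K _) (∑ℤ.∑-ext K λ i → ∑ℤ.∑-swap p K _) ⟩
          ∑ᶻ K (λ i → ∑ᶻ K (C i))
            ≡⟨ ∑ᶻ-diagonal K C (+ p ℤ.* Q) (λ i _ → C-diag i) C-off ⟩
          + K ℤ.* (+ p ℤ.* Q) ∎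
          where open ≡-Reasoning

      -- The sum over the invariance group is at most the sum over all dilations c, in which the
      -- off-diagonal correlations of f vanish; this replaces bounds for character sums.
      second-moment : ∀ u → let T = ∑ᶻ K (λ j → ∑ᶻ K (λ i → f (u + v * (i + j)))) in
                      0ℤ ℤ.≤ ∑ᶻ p U →
                      ∑ᶻ p U ℤ.* T ² ℤ.≤ + K ℤ.* (+ K ℤ.* (+ p ℤ.* Q))
      second-moment u U≥0 = begin
        ∑ᶻ p U ℤ.* T ²                                      ≡⟨ cong (λ t → ∑ᶻ p U ℤ.* t ²) T≡ ⟩
        ∑ᶻ p U ℤ.* ∑ᶻ K (λ j → G 1 (u + v * j)) ²            ≤⟨ ℤₚ.*-monoˡ-≤-nonNeg (∑ᶻ p U) {{ℤ.nonNegative U≥0}} (cauchy-schwarz K _) ⟩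
        ∑ᶻ p U ℤ.* (+ K ℤ.* ∑ᶻ K (λ j → G 1 (u + v * j) ²))  ≤⟨ ℤₚ.*-monoˡ-≤-nonNeg (∑ᶻ p U) {{ℤ.nonNegative U≥0}} (ℤₚ.*-monoˡ-≤-nonNeg (+ K) sub) ⟩
        ∑ᶻ p U ℤ.* (+ K ℤ.* Y 1)                             ≡⟨ swap (∑ᶻ p U) (+ K) (Y 1) ⟩
        + K ℤ.* (∑ᶻ p U ℤ.* Y 1)                             ≤⟨ ℤₚ.*-monoˡ-≤-nonNeg (+ K) orbit-≤ ⟩
        + K ℤ.* ∑ᶻ p Y                                       ≡⟨ cong (+ K ℤ.*_) total ⟩
        + K ℤ.* (+ K ℤ.* (+ p ℤ.* Q))                        ∎
        where
        open ℤₚ.≤-Reasoning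
        T = ∑ᶻ K (λ j → ∑ᶻ K (λ i → f (u + v * (i + j))))
        ring : ∀ u v i j → u + v * (i + j) ≡ 1 * (v * i) + (u + v * j)
        ring = solve-∀
        swap : ∀ a b c → a ℤ.* (b ℤ.* c) ≡ b ℤ.* (a ℤ.* c)
        swap = ℤRing.solve-∀
        T≡ : T ≡ ∑ᶻ K (λ j → G 1 (u + v * j))
        T≡ = ∑ℤ.∑-ext K λ j → ∑ℤ.∑-ext K λ i → cong f (ring u v i j)
        -- Letting j run up to p makes u + v j hit every residue exactly once; the added terms are
        -- squares.
        sub : ∑ᶻ K (λ j → G 1 (u + v * j) ²) ℤ.≤ Y 1
        sub = ℤₚ.≤-trans (∑ᶻ-prefix _ (λ j → 0≤a² (G 1 (u + v * j))) K≤p)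
          (ℤₚ.≤-reflexive (∑-affine (λ x → G 1 x ²) (G²-per 1) u v p∤v))

  +-∑ : ∀ n f → + ∑ n f ≡ ∑ᶻ n (λ i → + f i)
  +-∑ zero    f = refl
  +-∑ (suc n) f = trans (ℤₚ.pos-+ (∑ n f) (f n)) (cong (ℤ._+ + f n) (+-∑ n f))

  square-≤⇒≤ : ∀ {m n} → m * m ≤ n * n → m ≤ n
  square-≤⇒≤ {m} {n} le with m ≤? n
  ... | yes m≤n = m≤n
  ... | no m≰n = ⊥-elim (<⇒≱ (*-mono-< (≰⇒> m≰n) (≰⇒> m≰n)) le)

  ∣a∣² : ∀ a → a ² ≡ + (ℤ.∣ a ∣ * ℤ.∣ a ∣)
  ∣a∣² (+ n)        = sym (ℤₚ.pos-* n n)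
  ∣a∣² (ℤ.-[1+ n ]) = refl

  square-bound : ∀ a n → a ² ℤ.≤ + n ² → (a ℤ.≤ + n) × (ℤ.- a ℤ.≤ + n)
  square-bound a n le = ℤₚ.≤-trans (i≤∣i∣ a) (ℤ.+≤+ ∣a∣≤n) , ℤₚ.≤-trans (i≤∣i∣ (ℤ.- a)) (ℤ.+≤+ (subst (_≤ n) (sym (ℤₚ.∣-i∣≡∣i∣ a)) ∣a∣≤n))
    where
    ∣a∣≤n : ℤ.∣ a ∣ ≤ n
    ∣a∣≤n = square-≤⇒≤ (ℤₚ.drop‿+≤+ (subst₂ ℤ._≤_ (∣a∣² a) (sym (ℤₚ.pos-* n n)) le))
    i≤∣i∣ : ∀ i → i ℤ.≤ + ℤ.∣ i ∣
    i≤∣i∣ (+ n)        = ℤₚ.≤-refl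
    i≤∣i∣ (ℤ.-[1+ n ]) = ℤ.-≤+

  module Discrepancy (p : ℕ) (pp : Prime p) where
    open FreeParts p pp using (Free; Free?; ind; ind-%; ind-∙; ∑-ind)
    open SecondMoment p pp hiding (module Dilate)

    weight : List ℕ → ℕ → ℕ → ℕ → ℕ → ℕ
    weight E M u v K = ∑ K (λ j → ∑ K (λ i → ind E M (u + v * (i + j))))

    module _ (E : List ℕ) (M t : ℕ) (coprime : AllPairs Coprime E) (nonzero : All NonZero E)
             (index : t * (product E * M) ≡ p ∸ 1) where
      private
        N = φ E * M
        F = ind E M

        M≢0 : M ≢ 0
        M≢0 refl = <⇒≢ (m<n⇒0<n∸m 1<p) (trans (sym (trans (cong (t *_) (*-zeroʳ (product E))) (*-zeroʳ t))) index)

        -- The indicator minus its mean, multiplied by p to stay integral.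
        f : ℕ → ℤ
        f x = + p ℤ.* + F x ℤ.- + N

        per : Periodic f
        per x y e = cong (λ z → + p ℤ.* + z ℤ.- + N) (trans (sym (ind-% E M x)) (trans (cong F e) (ind-% E M y)))

        ∑F : ∑ᶻ p (λ x → + F x) ≡ + N
        ∑F = trans (sym (+-∑ p F)) (cong +_ (∑-ind E M t coprime nonzero index))

        mean0 : ∑ᶻ p f ≡ 0ℤ
        mean0 = begin
          ∑ᶻ p f                                              ≡⟨ ∑ℤ.∑-distrib-+ p _ _ ⟩
          ∑ᶻ p (λ x → + p ℤ.* + F x) ℤ.+ ∑ᶻ p (λ _ → ℤ.- + N) ≡⟨ cong₂ ℤ._+_ (trans (sym (∑ℤ.∑-distribˡ-* p (+ p) _)) (cong (+ p ℤ.*_) ∑F)) (∑ᶻ-const p (ℤ.- + N)) ⟩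
          + p ℤ.* + N ℤ.+ + p ℤ.* (ℤ.- + N)                   ≡⟨ ring (+ p) (+ N) ⟩
          0ℤ                                                  ∎
          where
          open ≡-Reasoning
          ring : ∀ p N → p ℤ.* N ℤ.+ p ℤ.* (ℤ.- N) ≡ 0ℤ
          ring = ℤRing.solve-∀

        F²≡F : ∀ x → + F x ² ≡ + F x
        F²≡F x with Free? E M x
        ... | yes _ = refl
        ... | no _  = refl

        energy : ∑ᶻ p (λ x → f x ²) ≡ + p ℤ.* (+ N ℤ.* (+ p ℤ.- + N))
        energy = begin
          ∑ᶻ p (λ x → f x ²)
            ≡⟨ ∑ℤ.∑-ext p (λ x → trans (ring₁ (+ p) (+ F x) (+ N)) (cong (λ z → (+ p ² ℤ.* z ℤ.+ (ℤ.- + 2 ℤ.* + p ℤ.* + N) ℤ.* + F x) ℤ.+ + N ²) (F²≡F x))) ⟩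
          ∑ᶻ p (λ x → (+ p ² ℤ.* + F x ℤ.+ (ℤ.- + 2 ℤ.* + p ℤ.* + N) ℤ.* + F x) ℤ.+ + N ²)
            ≡⟨ trans (∑ℤ.∑-distrib-+ p _ _) (cong₂ ℤ._+_ (∑ℤ.∑-distrib-+ p _ _) (∑ᶻ-const p (+ N ²))) ⟩
          (∑ᶻ p (λ x → + p ² ℤ.* + F x) ℤ.+ ∑ᶻ p (λ x → (ℤ.- + 2 ℤ.* + p ℤ.* + N) ℤ.* + F x)) ℤ.+ + p ℤ.* + N ²
            ≡⟨ cong (ℤ._+ + p ℤ.* + N ²) (cong₂ ℤ._+_ (pull (+ p ²)) (pull (ℤ.- + 2 ℤ.* + p ℤ.* + N))) ⟩
          (+ p ² ℤ.* + N ℤ.+ (ℤ.- + 2 ℤ.* + p ℤ.* + N) ℤ.* + N) ℤ.+ + p ℤ.* + N ²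
            ≡⟨ ring₂ (+ p) (+ N) ⟩
          + p ℤ.* (+ N ℤ.* (+ p ℤ.- + N)) ∎
          where
          open ≡-Reasoning
          pull : ∀ a → ∑ᶻ p (λ x → a ℤ.* + F x) ≡ a ℤ.* + N
          pull a = trans (sym (∑ℤ.∑-distribˡ-* p a _)) (cong (a ℤ.*_) ∑F)
          ring₁ : ∀ p F N → (p ℤ.* F ℤ.- N) ℤ.* (p ℤ.* F ℤ.- N) ≡ (p ℤ.* p ℤ.* (F ℤ.* F) ℤ.+ (ℤ.- + 2 ℤ.* p ℤ.* N) ℤ.* F) ℤ.+ N ℤ.* N
          ring₁ = ℤRing.solve-∀
          ring₂ : ∀ p N → (p ℤ.* p ℤ.* N ℤ.+ (ℤ.- + 2 ℤ.* p ℤ.* N) ℤ.* N) ℤ.+ p ℤ.* (N ℤ.* N) ≡ p ℤ.* (N ℤ.* (p ℤ.- N))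
          ring₂ = ℤRing.solve-∀

        U : ℕ → ℤ
        U c = + 𝟙 (Ker? M c)

        U-inv : ∀ c → c < p → (U c ≡ 0ℤ) ⊎ ((U c ≡ 1ℤ) × ¬ (p ∣ c) × (∀ x → f (c * x) ≡ f x))
        U-inv c _ with Ker? M c
        ... | no _  = inj₁ refl
        ... | yes k = inj₂ (refl , p∤c , λ x → cong (λ z → + p ℤ.* + z ℤ.- + N) (ind-∙ E M x k))
          where
          p∤c : ¬ (p ∣ c)
          p∤c d = 0≢1 (trans (sym (trans (cong (_% p) (0^ M M≢0)) (n∣m⇒m%n≡0 0 p (p ∣0)))) (trans (sym (^-∼ {c} {0} M (∣⇒∼0 d))) (trans k 1%p)))
            where
            0≢1 : 0 ≢ 1
            0≢1 ()
            0^ : ∀ n → n ≢ 0 → 0 ^ n ≡ 0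
            0^ zero    ne = ⊥-elim (ne refl)
            0^ (suc n) _  = refl

        ∑U : ∑ᶻ p U ≡ + M
        ∑U = trans (sym (+-∑ p _)) (cong +_ (Ker-count M (t * product E) (trans (ring M t (product E)) index)))
          where
          ring : ∀ M t P → M * (t * P) ≡ t * (P * M)
          ring = solve-∀

        ∑∑f : ∀ u v K → ∑ᶻ K (λ j → ∑ᶻ K (λ i → f (u + v * (i + j)))) ≡ + p ℤ.* + weight E M u v K ℤ.- + K ² ℤ.* + N
        ∑∑f u v K = begin
          ∑ᶻ K (λ j → ∑ᶻ K (λ i → f (u + v * (i + j))))
            ≡⟨ ∑ℤ.∑-ext K (λ j → trans (∑ℤ.∑-distrib-+ K _ _) (cong₂ ℤ._+_ (trans (sym (∑ℤ.∑-distribˡ-* K (+ p) _)) (cong (+ p ℤ.*_) (sym (+-∑ K _)))) (∑ᶻ-const K (ℤ.- + N)))) ⟩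
          ∑ᶻ K (λ j → + p ℤ.* + ∑ K (λ i → F (u + v * (i + j))) ℤ.+ + K ℤ.* (ℤ.- + N))
            ≡⟨ trans (∑ℤ.∑-distrib-+ K _ _) (cong₂ ℤ._+_ (trans (sym (∑ℤ.∑-distribˡ-* K (+ p) _)) (cong (+ p ℤ.*_) (sym (+-∑ K _)))) (∑ᶻ-const K _)) ⟩
          + p ℤ.* + weight E M u v K ℤ.+ + K ℤ.* (+ K ℤ.* (ℤ.- + N))
            ≡⟨ ring (+ p ℤ.* + weight E M u v K) (+ K) (+ N) ⟩
          + p ℤ.* + weight E M u v K ℤ.- + K ² ℤ.* + N ∎
          where
          open ≡-Reasoning
          ring : ∀ a K N → a ℤ.+ K ℤ.* (K ℤ.* (ℤ.- N)) ≡ a ℤ.- K ℤ.* K ℤ.* N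
          ring = ℤRing.solve-∀

      -- The second moment gives M D² ≤ K² p² N (p - N); since N = φ M, the factor M cancels and D²
      -- ≤ (K p)² φ (p - φ M) remains. σ is any integer bound for the square root of φ (p - φ M),
      -- expressed without subtraction.
      weight-discrepancy : ∀ u v K σ → ¬ (p ∣ v) → K ≤ p → φ E * p ≤ σ * σ + φ E * (φ E * M) →
                     (p * weight E M u v K ≤ K * K * (φ E * M) + K * p * σ) ×
                     (K * K * (φ E * M) ≤ p * weight E M u v K + K * p * σ)
      weight-discrepancy u v K σ p∤v K≤p bound = upper , lower
        where
        W = weight E M u v K
        D = + p ℤ.* + W ℤ.- + K ² ℤ.* + N
        B = K * p * σ

        moment : + M ℤ.* D ² ℤ.≤ + K ℤ.* (+ K ℤ.* (+ p ℤ.* (+ p ℤ.* (+ N ℤ.* (+ p ℤ.- + N)))))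
        moment = subst₂ ℤ._≤_ (cong₂ (λ a b → a ℤ.* b ²) ∑U (∑∑f u v K)) (cong (λ q → + K ℤ.* (+ K ℤ.* (+ p ℤ.* q))) energy)
          (second-moment f per mean0 U U-inv v p∤v K K≤p u (subst (0ℤ ℤ.≤_) (sym ∑U) (ℤ.+≤+ z≤n)))

        bound′ : + φ E ℤ.* (+ p ℤ.- + N) ℤ.≤ + σ ²
        bound′ = subst (ℤ._≤ + σ ²) eq (ℤₚ.≤-trans (ℤₚ.+-monoˡ-≤ (ℤ.- + (φ E * N)) (ℤ.+≤+ bound)) (ℤₚ.≤-reflexive eq′))
          where
          ring : ∀ f p N → f ℤ.* p ℤ.- f ℤ.* N ≡ f ℤ.* (p ℤ.- N)
          ring = ℤRing.solve-∀
          ring′ : ∀ s n → s ℤ.+ n ℤ.- n ≡ s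
          ring′ = ℤRing.solve-∀
          eq : + (φ E * p) ℤ.- + (φ E * N) ≡ + φ E ℤ.* (+ p ℤ.- + N)
          eq = trans (cong₂ ℤ._-_ (ℤₚ.pos-* (φ E) p) (ℤₚ.pos-* (φ E) N)) (ring (+ φ E) (+ p) (+ N))
          eq′ : + (σ * σ + φ E * N) ℤ.- + (φ E * N) ≡ + σ ²
          eq′ = trans (cong (ℤ._- + (φ E * N)) (ℤₚ.pos-+ (σ * σ) (φ E * N))) (trans (ring′ (+ (σ * σ)) (+ (φ E * N))) (ℤₚ.pos-* σ σ))

        D²≤ : D ² ℤ.≤ + B ²
        D²≤ = ℤₚ.*-cancelˡ-≤-pos (D ²) (+ B ²) (+ M) {{ℤ.positive (ℤ.+<+ (n≢0⇒n>0 M≢0))}} (begin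
          + M ℤ.* D ²                                                         ≤⟨ moment ⟩
          + K ℤ.* (+ K ℤ.* (+ p ℤ.* (+ p ℤ.* (+ N ℤ.* (+ p ℤ.- + N)))))       ≡⟨ cong (λ n → + K ℤ.* (+ K ℤ.* (+ p ℤ.* (+ p ℤ.* (n ℤ.* (+ p ℤ.- + N)))))) (ℤₚ.pos-* (φ E) M) ⟩
          + K ℤ.* (+ K ℤ.* (+ p ℤ.* (+ p ℤ.* (+ φ E ℤ.* + M ℤ.* (+ p ℤ.- + N))))) ≡⟨ ring (+ K) (+ p) (+ φ E) (+ M) (+ p ℤ.- + N) ⟩
          (+ M ℤ.* (+ K ℤ.* + p) ²) ℤ.* (+ φ E ℤ.* (+ p ℤ.- + N))              ≤⟨ ℤₚ.*-monoˡ-≤-nonNeg (+ M ℤ.* (+ K ℤ.* + p) ²) {{ℤ.nonNegative scale≥0}} bound′ ⟩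
          (+ M ℤ.* (+ K ℤ.* + p) ²) ℤ.* + σ ²                                 ≡⟨ ring′ (+ M) (+ K ℤ.* + p) (+ σ) ⟩
          + M ℤ.* (+ K ℤ.* + p ℤ.* + σ) ²                                     ≡⟨ cong (λ z → + M ℤ.* z ²) (trans (cong (ℤ._* + σ) (sym (ℤₚ.pos-* K p))) (sym (ℤₚ.pos-* (K * p) σ))) ⟩
          + M ℤ.* + B ²                                                       ∎)
          where
          open ℤₚ.≤-Reasoning
          ring : ∀ K p f M d → K ℤ.* (K ℤ.* (p ℤ.* (p ℤ.* (f ℤ.* M ℤ.* d)))) ≡ (M ℤ.* ((K ℤ.* p) ℤ.* (K ℤ.* p))) ℤ.* (f ℤ.* d)
          ring = ℤRing.solve-∀
          ring′ : ∀ M a s → (M ℤ.* (a ℤ.* a)) ℤ.* (s ℤ.* s) ≡ M ℤ.* ((a ℤ.* s) ℤ.* (a ℤ.* s))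
          ring′ = ℤRing.solve-∀
          scale≥0 : 0ℤ ℤ.≤ + M ℤ.* (+ K ℤ.* + p) ²
          scale≥0 = subst (0ℤ ℤ.≤_) (trans (ℤₚ.pos-* M _) (cong (+ M ℤ.*_) (trans (ℤₚ.pos-* (K * p) (K * p)) (cong _² (ℤₚ.pos-* K p))))) (ℤ.+≤+ z≤n)

        shift : ∀ x y z → (+ x ℤ.- + y) ℤ.≤ + z → x ≤ y + z
        shift x y z le = ℤₚ.drop‿+≤+ (subst₂ ℤ._≤_ (ring (+ x) (+ y)) (sym (ℤₚ.pos-+ y z)) (ℤₚ.+-monoʳ-≤ (+ y) le))
          where
          ring : ∀ x y → y ℤ.+ (x ℤ.- y) ≡ x
          ring = ℤRing.solve-∀

        D≡ : D ≡ + (p * W) ℤ.- + (K * K * N)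
        D≡ = cong₂ ℤ._-_ (sym (ℤₚ.pos-* p W)) (sym (trans (ℤₚ.pos-* (K * K) N) (cong (ℤ._* + N) (ℤₚ.pos-* K K))))

        upper : p * W ≤ K * K * N + B
        upper = shift (p * W) (K * K * N) B (subst (ℤ._≤ + B) D≡ (proj₁ (square-bound D B D²≤)))

        lower : K * K * N ≤ p * W + B
        lower = shift (K * K * N) (p * W) B (subst (ℤ._≤ + B) (trans (cong ℤ.-_ D≡) (ring (+ (p * W)) (+ (K * K * N)))) (proj₂ (square-bound D B D²≤)))
          where
          ring : ∀ a b → ℤ.- (a ℤ.- b) ≡ b ℤ.- a
          ring = ℤRing.solve-∀

open MomentMethod using (module Discrepancy)

-- The sieve

infixl 7 _/₀_
-- Division made total, so that it applies to list entries without `NonZero` evidence.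
_/₀_ : ℕ → ℕ → ℕ
n /₀ zero    = 0
n /₀ (suc d) = n / suc d

*-/₀ : ∀ {r n} → r ∣ n → n ≢ 0 → r * (n /₀ r) ≡ n
*-/₀ {zero}  r∣n n≢0 = ⊥-elim (n≢0 (0∣⇒≡0 r∣n))
*-/₀ {suc r} r∣n n≢0 = m*[n/m]≡n r∣n

∑ₗ : List ℕ → (ℕ → ℕ) → ℕ
∑ₗ []       f = 0
∑ₗ (x ∷ xs) f = f x + ∑ₗ xs f

∑ₗ-mono : ∀ xs {f g} → All (λ x → f x ≤ g x) xs → ∑ₗ xs f ≤ ∑ₗ xs g
∑ₗ-mono []       []         = z≤n
∑ₗ-mono (x ∷ xs) (le ∷ les) = +-mono-≤ le (∑ₗ-mono xs les)

∑-∑ₗ : ∀ n xs (g : ℕ → ℕ → ℕ) → ∑ n (λ i → ∑ₗ xs (g i)) ≡ ∑ₗ xs (λ x → ∑ n (λ i → g i x))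
∑-∑ₗ n []       g = ∑ℕ.∑-zero n
∑-∑ₗ n (x ∷ xs) g = trans (∑ℕ.∑-distrib-+ n _ _) (cong (∑ n (λ i → g i x) +_) (∑-∑ₗ n xs g))

*-∑ₗ : ∀ a xs f → a * ∑ₗ xs f ≡ ∑ₗ xs (λ x → a * f x)
*-∑ₗ a []       f = *-zeroʳ a
*-∑ₗ a (x ∷ xs) f = trans (*-distribˡ-+ a (f x) _) (cong (a * f x +_) (*-∑ₗ a xs f))

∑ₗ-Any : ∀ {xs} {P : ℕ → Set} {f} → (∀ {x} → P x → 1 ≤ f x) → Any P xs → 1 ≤ ∑ₗ xs f
∑ₗ-Any le (here px)  = m≤n⇒m≤n+o _ (le px)
∑ₗ-Any {x ∷ xs} {f = f} le (there any) = m≤n⇒m≤o+n (f x) (∑ₗ-Any le any)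

∑-prefix : ∀ {m n} f → m ≤ n → ∑ m f ≤ ∑ n f
∑-prefix {m} {zero}  f z≤n = ≤-refl
∑-prefix {m} {suc n} f m≤1+n with m≤n⇒m<n∨m≡n m≤1+n
... | inj₂ refl      = ≤-refl
... | inj₁ (s≤s m≤n) = ≤-trans (∑-prefix f m≤n) (m≤m+n _ (f n))

∑-blocks : ∀ d k f → ∑ (d * k) f ≡ ∑ k (λ b → ∑ d (λ c → f (c + d * b)))
∑-blocks d zero    f = cong (λ n → ∑ n f) (*-zeroʳ d)
∑-blocks d (suc k) f = begin
  ∑ (d * suc k) f                                            ≡⟨ cong (λ n → ∑ n f) (trans (*-suc d k) (+-comm d (d * k))) ⟩
  ∑ (d * k + d) f                                            ≡⟨ append (d * k) d ⟩
  ∑ (d * k) f + ∑ d (λ c → f (d * k + c))                    ≡⟨ cong₂ _+_ (∑-blocks d k f) (∑ℕ.∑-ext d λ c → cong f (+-comm (d * k) c)) ⟩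
  ∑ (suc k) (λ b → ∑ d (λ c → f (c + d * b)))                ∎
  where
  open ≡-Reasoning
  append : ∀ m n → ∑ (m + n) f ≡ ∑ m f + ∑ n (λ c → f (m + c))
  append m zero    = trans (cong (λ n → ∑ n f) (+-identityʳ m)) (sym (+-identityʳ _))
  append m (suc n) = trans (cong (λ n → ∑ n f) (+-suc m n))
    (trans (cong (_+ f (m + n)) (append m n)) (+-assoc (∑ m f) _ _))

∑-𝟙-unique : ∀ n {P : ℕ → Set} (P? : ∀ i → Dec (P i)) →
             (∀ {i j} → i < j → j < n → P i → P j → ⊥) → ∑ n (𝟙 ∘ P?) ≤ 1
∑-𝟙-unique zero    P? uniq = z≤n
∑-𝟙-unique (suc n) P? uniq with P? n
... | no _  = subst (_≤ 1) (sym (+-identityʳ _)) (∑-𝟙-unique n P? λ i<j j<n → uniq i<j (m<n⇒m<1+n j<n))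
... | yes Pn = ≤-reflexive (trans (cong (_+ 1) none) refl)
  where
  none : ∑ n (𝟙 ∘ P?) ≡ 0
  none = trans (∑ℕ.∑-cong n λ i i<n → 𝟙-no (P? i) (λ Pi → uniq i<n ≤-refl Pi Pn)) (∑ℕ.∑-zero n)
    where
    𝟙-no : ∀ {A : Set} (A? : Dec A) → ¬ A → 𝟙 A? ≡ 0
    𝟙-no (yes a) ¬a = ⊥-elim (¬a a)
    𝟙-no (no _)  ¬a = refl

hit? : ∀ d c i → Dec (d ∣ 1 + 2 * (c + i))
hit? d c i = d ∣? (1 + 2 * (c + i))

-- Two multiples of d among d consecutive odd numbers would make the odd d divide 2 (j - i), where 0
-- < j - i < d.
window-≤1 : ∀ d → Coprime d 2 → ∀ c → ∑ d (𝟙 ∘ hit? d c) ≤ 1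
window-≤1 d cop c = ∑-𝟙-unique d (hit? d c) λ {i} {j} i<j j<d hi hj →
  <⇒≱ (≤-<-trans (m∸n≤m j i) j<d)
      (∣⇒≤ {{>-nonZero (m<n⇒0<n∸m i<j)}} (Cop.coprime-divisor cop (subst (d ∣_) (difference i j (<⇒≤ i<j)) (∣m∣n⇒∣m∸n hj hi))))
  where
  ∣m∣n⇒∣m∸n : ∀ {d m n} → d ∣ m → d ∣ n → d ∣ m ∸ n
  ∣m∣n⇒∣m∸n {d} (divides-refl a) (divides-refl b) = divides (a ∸ b) (sym (*-distribʳ-∸ d a b))
  difference : ∀ i j → i ≤ j → (1 + 2 * (c + j)) ∸ (1 + 2 * (c + i)) ≡ 2 * (j ∸ i)
  difference i j i≤j = trans (sym (*-distribˡ-∸ 2 (c + j) (c + i))) (cong (2 *_) ([m+n]∸[m+o]≡n∸o c j i))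

hits-≤ : ∀ d k → Coprime d 2 → ∀ c → ∑ (d * k) (𝟙 ∘ hit? d c) ≤ k
hits-≤ d k cop c = begin
  ∑ (d * k) (𝟙 ∘ hit? d c)                        ≡⟨ ∑-blocks d k _ ⟩
  ∑ k (λ b → ∑ d (λ i → 𝟙 (hit? d c (i + d * b)))) ≤⟨ ∑-mono k (λ b _ → subst (_≤ 1) (∑ℕ.∑-ext d λ i → cong (λ z → 𝟙 (d ∣? (1 + 2 * z))) (ring c d b i)) (window-≤1 d cop (c + d * b))) ⟩
  ∑ k (λ _ → 1)                                   ≡⟨ trans (∑-const k 1) (*-identityʳ k) ⟩
  k                                               ∎
  where
  open ≤-Reasoning
  ring : ∀ c d b i → c + d * b + i ≡ c + (i + d * b)
  ring = solve-∀

-- An upper bound for ⌈K / d⌉ that is uniform in whether d divides K.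
blocks : ℕ → ℕ → ℕ
blocks K d = suc (K /₀ d)

K≤d*blocks : ∀ K d → .{{NonZero d}} → K ≤ d * blocks K d
K≤d*blocks K d@(suc _) = begin
  K                     ≡⟨ m≡m%n+[m/n]*n K d ⟩
  K % d + K / d * d     ≤⟨ +-monoˡ-≤ _ (<⇒≤ (m%n<n K d)) ⟩
  d + K / d * d         ≡⟨ *-comm (suc (K / d)) d ⟩
  d * suc (K / d)       ∎
  where open ≤-Reasoning

module Sieve (p : ℕ) (pp : Prime p) where
  open Discrepancy p pp
  open FreeParts p pp using (Free; Free?; ind)
  open PowerKernels p pp using (1<p)

  module _ (E : List ℕ) (M : ℕ) (coprime : AllPairs Coprime E) (nonzero : All NonZero E)
           (index : product E * M ≡ p ∸ 1) (K : ℕ) (K≤p : K ≤ p)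
           (σ : ℕ) (σ-bound : φ E * p ≤ σ * σ + φ E * (φ E * M)) where

    private
      F = ind E M

    -- A residue class c of j modulo d determines that of i when d ∣ 1 + 2 (i + j).
    progression-≤ : ∀ d → .{{NonZero d}} → Coprime d 2 → ¬ (p ∣ d) → ¬ (p ∣ 2) → blocks K d ≤ p →
      p * ∑ K (λ j → ∑ K (λ i → 𝟙 (hit? d j i) * F (1 + 2 * (i + j))))
        ≤ d * (blocks K d * blocks K d * (φ E * M) + blocks K d * p * σ)
    progression-≤ d cop p∤d p∤2 k≤p = begin
      p * ∑ K (λ j → ∑ K (λ i → h j i))
        -- Both ranges are extended to d k, so that each class modulo d has exactly k members.
        ≤⟨ *-monoʳ-≤ p (≤-trans (∑-prefix _ K≤dk) (∑-mono (d * k) λ j _ → ∑-prefix (h j) K≤dk)) ⟩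
      p * ∑ (d * k) (λ j → ∑ (d * k) (λ i → h j i))
        ≡⟨ cong (p *_) (trans (∑-blocks d k _) (∑ℕ.∑-ext k λ b → ∑ℕ.∑-ext d λ c → ∑-blocks d k (h (c + d * b)))) ⟩
      p * ∑ k (λ b → ∑ d (λ c → ∑ k (λ b′ → ∑ d (λ c′ → h (c + d * b) (c′ + d * b′)))))
        ≡⟨ cong (p *_) (trans (∑ℕ.∑-swap k d _) (∑ℕ.∑-ext d λ c → trans (∑ℕ.∑-ext k λ b → ∑ℕ.∑-swap k d _) (∑ℕ.∑-swap k d _))) ⟩
      p * ∑ d (λ c → ∑ d (λ c′ → ∑ k (λ b → ∑ k (λ b′ → h (c + d * b) (c′ + d * b′)))))
        ≡⟨ cong (p *_) (∑ℕ.∑-ext d λ c → ∑ℕ.∑-ext d λ c′ → inner c c′) ⟩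
      p * ∑ d (λ c → ∑ d (λ c′ → 𝟙 (hit? d c c′) * w c c′))
        ≡⟨ trans (∑ℕ.∑-distribˡ-* d p _) (∑ℕ.∑-ext d λ c → trans (∑ℕ.∑-distribˡ-* d p _) (∑ℕ.∑-ext d λ c′ → swap p (𝟙 (hit? d c c′)) (w c c′))) ⟩
      ∑ d (λ c → ∑ d (λ c′ → 𝟙 (hit? d c c′) * (p * w c c′)))
        ≤⟨ ∑-mono d (λ c _ → ∑-mono d λ c′ _ → *-monoʳ-≤ (𝟙 (hit? d c c′)) (w≤ c c′)) ⟩
      ∑ d (λ c → ∑ d (λ c′ → 𝟙 (hit? d c c′) * B))
        ≡⟨ ∑ℕ.∑-ext d (λ c → sym (∑ℕ.∑-distribʳ-* d B _)) ⟩
      ∑ d (λ c → ∑ d (λ c′ → 𝟙 (hit? d c c′)) * B)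
        -- For each c at most one c′ is compatible with the divisibility, so the d² pairs of classes
        -- contribute only d times.
        ≤⟨ ∑-mono d (λ c _ → ≤-trans (*-monoˡ-≤ B (window-≤1 d cop c)) (≤-reflexive (*-identityˡ B))) ⟩
      ∑ d (λ _ → B)
        ≡⟨ ∑-const d B ⟩
      d * B ∎
      where
      open ≤-Reasoning
      k = blocks K d
      K≤dk = K≤d*blocks K d
      B = k * k * (φ E * M) + k * p * σ
      h : ℕ → ℕ → ℕ
      h j i = 𝟙 (hit? d j i) * F (1 + 2 * (i + j))
      w : ℕ → ℕ → ℕ
      w c c′ = weight E M (1 + 2 * (c + c′)) (2 * d) k
      w≤ : ∀ c c′ → p * w c c′ ≤ B
      w≤ c c′ = proj₁ (weight-discrepancy E M 1 coprime nonzero (trans (*-identityˡ _) index) (1 + 2 * (c + c′)) (2 * d) k σ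
        (λ div → [ p∤2 , p∤d ]′ (euclidsLemma 2 d pp div)) k≤p σ-bound)
      swap : ∀ a b c → a * (b * c) ≡ b * (a * c)
      swap = solve-∀
      ring : ∀ d c c′ b b′ → 1 + 2 * (c + d * b + (c′ + d * b′)) ≡ 1 + 2 * (c + c′) + 2 * (b + b′) * d
      ring = solve-∀
      ring′ : ∀ d c c′ b b′ → 1 + 2 * (c′ + d * b′ + (c + d * b)) ≡ 1 + 2 * (c + c′) + 2 * d * (b′ + b)
      ring′ = solve-∀
      same : ∀ c c′ b b′ → 𝟙 (hit? d (c + d * b) (c′ + d * b′)) ≡ 𝟙 (hit? d c c′)
      same c c′ b b′ = 𝟙-cong (hit? d (c + d * b) (c′ + d * b′)) (hit? d c c′)
        (λ x → ∣m+n∣m⇒∣n (subst (d ∣_) (trans (ring d c c′ b b′) (+-comm (1 + 2 * (c + c′)) _)) x) (n∣m*n (2 * (b + b′))))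
        (λ x → subst (d ∣_) (sym (ring d c c′ b b′)) (∣m∣n⇒∣m+n x (n∣m*n (2 * (b + b′)))))
      inner : ∀ c c′ → ∑ k (λ b → ∑ k (λ b′ → h (c + d * b) (c′ + d * b′))) ≡ 𝟙 (hit? d c c′) * w c c′
      inner c c′ = trans
        (∑ℕ.∑-ext k λ b → trans (∑ℕ.∑-ext k λ b′ → cong₂ _*_ (same c c′ b b′) (cong F (ring′ d c c′ b b′))) (sym (∑ℕ.∑-distribˡ-* k (𝟙 (hit? d c c′)) _)))
        (sym (∑ℕ.∑-distribˡ-* k (𝟙 (hit? d c c′)) _))

    -- R holds the primes of p - 1 outside E; the squares of the q in QL are removed with the
    -- estimate, those of the q in QT with the trivial count. One ρ serves all r in R, because φ (p
    -- - φ M / r) ≤ φ p.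
    module _ (R QL QT : List ℕ) (ρ : ℕ) where

      Good : ℕ → Set
      Good n = Free E M n × All (λ r → ¬ Free E (M /₀ r) n) R
             × All (λ q → ¬ (q * q ∣ n)) QL × All (λ q → ¬ (q * q ∣ n)) QT

      Good? : ∀ n → Dec (Good n)
      Good? n = Free? E M n ×-dec All.all? (λ r → ¬? (Free? E (M /₀ r) n)) R
        ×-dec All.all? (λ q → ¬? (q * q ∣? n)) QL ×-dec All.all? (λ q → ¬? (q * q ∣? n)) QT

      -- A free n that is not good violates one of the sieve conditions, and the right side counts
      -- the violations.
      sieve-pointwise : ∀ n → ¬ Good n →
        F n ≤ ∑ₗ R (λ r → ind E (M /₀ r) n) + (∑ₗ QL (λ q → 𝟙 (q * q ∣? n) * F n) + ∑ₗ QT (λ q → 𝟙 (q * q ∣? n)))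
      sieve-pointwise n ¬good with Free? E M n
      ... | no _ = z≤n
      ... | yes f with All.all? (λ r → ¬? (Free? E (M /₀ r) n)) R
      ... | no ¬all = m≤n⇒m≤n+o _ (∑ₗ-Any {f = λ r → ind E (M /₀ r) n}
              (λ {r} ¬¬fr → ≤-reflexive (sym (𝟙-yes (Free? E (M /₀ r) n) (decidable-stable (Free? E (M /₀ r) n) ¬¬fr))))
              (¬All⇒Any¬ (λ r → ¬? (Free? E (M /₀ r) n)) R ¬all))
      ... | yes aR with All.all? (λ q → ¬? (q * q ∣? n)) QL
      ... | no ¬all = m≤n⇒m≤o+n (∑ₗ R _) (m≤n⇒m≤n+o _ (∑ₗ-Any {f = λ q → 𝟙 (q * q ∣? n) * 1}
              (λ {q} ¬¬d → ≤-reflexive (sym (trans (*-identityʳ _) (𝟙-yes (q * q ∣? n) (decidable-stable (q * q ∣? n) ¬¬d)))))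
              (¬All⇒Any¬ (λ q → ¬? (q * q ∣? n)) QL ¬all)))
      ... | yes aL with All.all? (λ q → ¬? (q * q ∣? n)) QT
      ... | no ¬all = m≤n⇒m≤o+n (∑ₗ R _) (m≤n⇒m≤o+n (∑ₗ QL _) (∑ₗ-Any {f = λ q → 𝟙 (q * q ∣? n)}
              (λ {q} ¬¬d → ≤-reflexive (sym (𝟙-yes (q * q ∣? n) (decidable-stable (q * q ∣? n) ¬¬d))))
              (¬All⇒Any¬ (λ q → ¬? (q * q ∣? n)) QT ¬all)))
      ... | yes aT = ⊥-elim (¬good (f , aR , aL , aT))

      -- Everything is multiplied by p, as in `weight-discrepancy`; the last summand is the error of
      -- the main count itself.
      errorTerm : ℕ
      errorTerm = ∑ₗ R (λ r → K * K * (φ E * (M /₀ r)) + K * p * ρ)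
                + (∑ₗ QL (λ q → q * q * (blocks K (q * q) * blocks K (q * q) * (φ E * M) + blocks K (q * q) * p * σ))
                  + p * ∑ₗ QT (λ q → K * blocks K (q * q)))
                + K * p * σ

      module _ (ρ-bound : φ E * p ≤ ρ * ρ) (R∣M : All (_∣ M) R) (p∤2 : ¬ (p ∣ 2))
               (QL-ok : All (λ q → NonZero (q * q) × Coprime (q * q) 2 × ¬ (p ∣ q * q) × blocks K (q * q) ≤ p) QL)
               (QT-ok : All (λ q → NonZero (q * q) × Coprime (q * q) 2) QT) where

        sieve-failure : (∀ i j → i < K → j < K → ¬ Good (1 + 2 * (i + j))) → K * K * (φ E * M) ≤ errorTerm
        sieve-failure none = begin
          K * K * (φ E * M)
            ≤⟨ proj₂ (disc M 1 (trans (*-identityˡ _) index) σ σ-bound) ⟩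
          p * weight E M 1 2 K + K * p * σ
            ≤⟨ +-monoˡ-≤ (K * p * σ) (≤-trans (*-monoʳ-≤ p split) (≤-trans (≤-reflexive (trans (*-distribˡ-+ p SR _) (cong (p * SR +_) (*-distribˡ-+ p SL ST)))) (+-mono-≤ boundR (+-mono-≤ boundL (*-monoʳ-≤ p boundT))))) ⟩
          errorTerm ∎
          where
          open ≤-Reasoning
          disc = λ m t idx s → weight-discrepancy E m t coprime nonzero idx 1 2 K s p∤2 K≤p
          n : ℕ → ℕ → ℕ
          n j i = 1 + 2 * (i + j)
          SR = ∑ₗ R (λ r → weight E (M /₀ r) 1 2 K)
          SL = ∑ₗ QL (λ q → ∑ K (λ j → ∑ K (λ i → 𝟙 (q * q ∣? n j i) * F (n j i))))
          ST = ∑ₗ QT (λ q → ∑ K (λ j → ∑ K (λ i → 𝟙 (q * q ∣? n j i))))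
          push : ∀ xs (g : ℕ → ℕ → ℕ → ℕ) → ∑ K (λ j → ∑ K (λ i → ∑ₗ xs (g j i))) ≡ ∑ₗ xs (λ x → ∑ K (λ j → ∑ K (λ i → g j i x)))
          push xs g = trans (∑ℕ.∑-ext K λ j → ∑-∑ₗ K xs (g j)) (∑-∑ₗ K xs _)
          dist : ∀ (f g : ℕ → ℕ → ℕ) → ∑ K (λ j → ∑ K (λ i → f j i + g j i)) ≡ ∑ K (λ j → ∑ K (f j)) + ∑ K (λ j → ∑ K (g j))
          dist f g = trans (∑ℕ.∑-ext K λ j → ∑ℕ.∑-distrib-+ K (f j) (g j)) (∑ℕ.∑-distrib-+ K _ _)
          split : weight E M 1 2 K ≤ SR + (SL + ST)
          split = ≤-trans (∑-mono K λ j j<K → ∑-mono K λ i i<K → sieve-pointwise (n j i) (none i j i<K j<K))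
            (≤-reflexive (trans (dist _ _) (cong₂ _+_ (push R _) (trans (dist _ _) (cong₂ _+_ (push QL _) (push QT _))))))
          boundR : p * SR ≤ ∑ₗ R (λ r → K * K * (φ E * (M /₀ r)) + K * p * ρ)
          boundR = ≤-trans (≤-reflexive (*-∑ₗ p R _)) (∑ₗ-mono R (All.map (λ {r} → oneR r) R∣M))
            where
            M≢0 : M ≢ 0
            M≢0 refl = <⇒≢ (m<n⇒0<n∸m 1<p) (trans (sym (*-zeroʳ (product E))) index)
            rearr : ∀ r P m → r * (P * m) ≡ P * (r * m)
            rearr = solve-∀
            oneR : ∀ r → r ∣ M → p * weight E (M /₀ r) 1 2 K ≤ K * K * (φ E * (M /₀ r)) + K * p * ρ
            oneR r r∣M = proj₁ (disc (M /₀ r) r (trans (rearr r (product E) (M /₀ r)) (trans (cong (product E *_) (*-/₀ r∣M M≢0)) index))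
              ρ (≤-trans ρ-bound (m≤m+n (ρ * ρ) _)))
          boundL : p * SL ≤ ∑ₗ QL (λ q → q * q * (blocks K (q * q) * blocks K (q * q) * (φ E * M) + blocks K (q * q) * p * σ))
          boundL = ≤-trans (≤-reflexive (*-∑ₗ p QL _)) (∑ₗ-mono QL (All.map (λ {q} → oneL q) QL-ok))
            where
            oneL : ∀ q → NonZero (q * q) × Coprime (q * q) 2 × ¬ (p ∣ q * q) × blocks K (q * q) ≤ p →
              p * ∑ K (λ j → ∑ K (λ i → 𝟙 (q * q ∣? n j i) * F (n j i)))
                ≤ q * q * (blocks K (q * q) * blocks K (q * q) * (φ E * M) + blocks K (q * q) * p * σ)
            oneL q (nz , cop , p∤q² , k≤p) = ≤-trans
              (≤-reflexive (cong (p *_) (∑ℕ.∑-ext K λ j → ∑ℕ.∑-ext K λ i → cong (λ z → 𝟙 (q * q ∣? (1 + 2 * z)) * F (n j i)) (+-comm i j))))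
              (progression-≤ (q * q) {{nz}} cop p∤q² p∤2 k≤p)
          boundT : ST ≤ ∑ₗ QT (λ q → K * blocks K (q * q))
          boundT = ∑ₗ-mono QT (All.map (λ {q} → oneT q) QT-ok)
            where
            oneT : ∀ q → NonZero (q * q) × Coprime (q * q) 2 →
              ∑ K (λ j → ∑ K (λ i → 𝟙 (q * q ∣? n j i))) ≤ K * blocks K (q * q)
            oneT q (nz , cop) = ≤-trans
              (∑-mono K λ j _ → ≤-trans
                (≤-reflexive (∑ℕ.∑-ext K λ i → cong (λ z → 𝟙 (q * q ∣? (1 + 2 * z))) (+-comm i j)))
                (≤-trans (∑-prefix _ (K≤d*blocks K (q * q) {{nz}})) (hits-≤ (q * q) _ cop j)))
              (≤-reflexive (∑-const K _))

        sieve-success : errorTerm < K * K * (φ E * M) → ∃[ m ] (m < 2 * K ∸ 1 × Good (1 + 2 * m))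
        sieve-success lt with anyUpTo? (λ m → Good? (1 + 2 * m)) (2 * K ∸ 1)
        ... | yes found = found
        ... | no ¬found = ⊥-elim (<⇒≱ lt (sieve-failure λ i j i<K j<K good → ¬found (i + j , range i<K j<K , good)))
          where
          -- The largest value of i + j is 2 K - 2, so n never exceeds 4 K - 3.
          range : ∀ {i j} → i < K → j < K → i + j < 2 * K ∸ 1
          range {i} {j} i<K j<K = ≤-trans (≤-reflexive (sym (cong (_∸ 1) (+-suc (suc i) j))))
            (∸-monoˡ-≤ 1 (≤-trans (+-mono-≤ i<K j<K) (≤-reflexive (cong (K +_) (sym (+-identityʳ K))))))

-- Criteria for primitive roots and the passage to the least one

primeDivisor : ∀ n → 1 < n → ∃[ q ] (Prime q × q ∣ n)
primeDivisor n@(suc _) 1<n with factorise n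
... | record { factors = [] ; isFactorisation = e } = ⊥-elim (<⇒≢ 1<n (sym e))
... | record { factors = q ∷ qs ; isFactorisation = e ; factorsPrime = qp ∷ _ } =
  q , qp , subst (q ∣_) (sym e) (m∣m*n (product qs))

prime-coprime : ∀ {q r} → Prime q → Prime r → q ≢ r → Coprime q r
prime-coprime qp rp q≢r {d} (d∣q , d∣r) with prime⇒irreducible qp d∣q | prime⇒irreducible rp d∣r
... | inj₁ d≡1 | _         = d≡1
... | inj₂ _   | inj₁ d≡1  = d≡1
... | inj₂ e   | inj₂ e′   = ⊥-elim (q≢r (trans (sym e) e′))

module PrimitiveRoots (p : ℕ) (pp : Prime p) where
  open FreeParts p pp

  ∼⇒≡[mod] : ∀ {a b} → a ∼ b → a ≡ b [mod p ]
  ∼⇒≡[mod] {a} {b} e with ≤-total a b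
  ... | inj₁ a≤b = subst (p ∣_) (sym (m≤n⇒m∸n≡0 a≤b)) (p ∣0) , ∼⇒∣ a≤b e
  ... | inj₂ b≤a = ∼⇒∣ b≤a (sym e) , subst (p ∣_) (sym (m≤n⇒m∸n≡0 b≤a)) (p ∣0)

  ≡[mod]⇒∼ : ∀ {a b} → a ≡ b [mod p ] → a ∼ b
  ≡[mod]⇒∼ {a} {b} (d , d′) with ≤-total a b
  ... | inj₁ a≤b = ∣⇒∼ a≤b d′
  ... | inj₂ b≤a = sym (∣⇒∼ b≤a d)

  Ker⇒¬∣ : ∀ {m x} → m ≢ 0 → Ker m x → ¬ (p ∣ x)
  Ker⇒¬∣ {zero}  {x} m≢0 _ _ = m≢0 refl
  Ker⇒¬∣ {suc m} {x} _   k d = <⇒≱ 1<p (∣⇒≤ (m%n≡0⇒n∣m 1 p (trans (sym k) (n∣m⇒m%n≡0 _ p (∣m⇒∣m*n (x ^ m) d)))))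

  p∸1≢0 : p ∸ 1 ≢ 0
  p∸1≢0 = ≢-sym (<⇒≢ (m<n⇒0<n∸m 1<p))

  -- If g^j were 1 with 0 < j < p - 1, then g^h would be 1 for h = gcd(j, p - 1) by `Ker-meet`. As
  -- (p - 1) / h exceeds 1, it has a prime divisor q, and the test at q would fail.
  primitiveRoot : ∀ g → Ker (p ∸ 1) g →
    (∀ q m → Prime q → q * m ≡ p ∸ 1 → ¬ Ker m g) → IsPrimitiveRoot p g
  primitiveRoot g k test = coprime-g , m<n⇒0<n∸m 1<p , ∼⇒≡[mod] k , order
    where
    coprime-g : Coprime g p
    coprime-g {d} (d∣g , d∣p) with prime⇒irreducible pp d∣p
    ... | inj₁ e    = e
    ... | inj₂ refl = ⊥-elim (Ker⇒¬∣ p∸1≢0 k d∣g)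
    order : ∀ j → 0 < j → j < p ∸ 1 → ¬ (g ^ j) ≡ 1 [mod p ]
    order j 0<j j<p∸1 e = test q (b′ * h) qp eq (Ker-* b′ {h} {g} kh)
      where
      h = gcd j (p ∸ 1)
      instance
        h≢0 : NonZero h
        h≢0 = ≢-nonZero λ h≡0 → <⇒≢ 0<j (sym (gcd[m,n]≡0⇒m≡0 h≡0))
      a = j / h
      b = (p ∸ 1) / h
      ah≡j : a * h ≡ j
      ah≡j = m/n*n≡m (gcd[m,n]∣m j (p ∸ 1))
      bh≡ : b * h ≡ p ∸ 1
      bh≡ = m/n*n≡m (gcd[m,n]∣n j (p ∸ 1))
      kh : Ker h g
      kh = Ker-meet {a} {b} h g (Cop.coprime-/gcd j (p ∸ 1))
        (subst (λ m → Ker m g) (sym ah≡j) (≡[mod]⇒∼ e)) (subst (λ m → Ker m g) (sym bh≡) k)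
      1<b : 1 < b
      1<b = *-cancelʳ-< h 1 b (begin-strict
        1 * h   ≡⟨ *-identityˡ h ⟩
        h       ≤⟨ ∣⇒≤ {{>-nonZero 0<j}} (gcd[m,n]∣m j (p ∸ 1)) ⟩
        j       <⟨ j<p∸1 ⟩
        p ∸ 1   ≡⟨ bh≡ ⟨
        b * h   ∎)
        where open ≤-Reasoning
      q = proj₁ (primeDivisor b 1<b)
      qp = proj₁ (proj₂ (primeDivisor b 1<b))
      q∣b = proj₂ (proj₂ (primeDivisor b 1<b))
      b′ = quotient q∣b
      eq : q * (b′ * h) ≡ p ∸ 1
      eq = trans (sym (*-assoc q b′ h)) (trans (cong (_* h) (sym (m∣n⇒n≡m*quotient q∣b))) bh≡)

  Free⇒Ker : ∀ E {M x} → Free E M x → Ker (product E * M) x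
  Free⇒Ker []      {M} {x} f = subst (λ m → Ker m x) (sym (+-identityʳ M)) f
  Free⇒Ker (r ∷ E) {M} {x} (f , _) = subst (λ m → Ker m x) (ring r (product E) M) (Free⇒Ker E f)
    where
    ring : ∀ r P M → P * (r * M) ≡ r * P * M
    ring = solve-∀

  -- For r in R, being free at level M but not at level M / r is exactly freeness for `r ∷ E` at
  -- level M / r. Thus `Free⇒¬Ker` yields the order test for the primes of both lists.
  free-primitiveRoot : ∀ E M R g → AllPairs Coprime E → product E * M ≡ p ∸ 1 →
    All (λ r → (r ∣ M) × (r ≢ 0) × All (Coprime r) E) R →
    (∀ q → Prime q → q ∣ p ∸ 1 → q ∈ E ⊎ q ∈ R) →
    Free E M g → All (λ r → ¬ Free E (M /₀ r) g) R → IsPrimitiveRoot p g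
  free-primitiveRoot E M R g cE index R-ok complete f ¬fs =
    primitiveRoot g (subst (λ m → Ker m g) index (Free⇒Ker E f)) test
    where
    test : ∀ q m → Prime q → q * m ≡ p ∸ 1 → ¬ Ker m g
    test q m qp e with complete q qp (subst (q ∣_) e (m∣m*n m))
    ... | inj₁ q∈E = Free⇒¬Ker E cE q∈E (trans e (sym index)) (≢-nonZero⁻¹ q {{prime⇒nonZero qp}}) f
    ... | inj₂ q∈R = Free⇒¬Ker (q ∷ E) (cq ∷ cE) (here refl)
          (trans e (trans (sym index) (trans (cong (product E *_) (sym qm)) (ring (product E) q (M /₀ q)))))
          q≢0 (subst (λ z → Free E z g) (sym qm) f , All.lookup ¬fs q∈R)
      where
      ok = All.lookup R-ok q∈R
      q≢0 = proj₁ (proj₂ ok)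
      cq = proj₂ (proj₂ ok)
      M≢0 : M ≢ 0
      M≢0 refl = p∸1≢0 (trans (sym index) (*-zeroʳ (product E)))
      qm : q * (M /₀ q) ≡ M
      qm = *-/₀ (proj₁ ok) M≢0
      ring : ∀ P q m → P * (q * m) ≡ q * P * m
      ring = solve-∀

Candidate : ℕ → ℕ → Set
Candidate p g = 0 < g × SquareFree g × IsPrimitiveRoot p g

SquareFree? : ∀ n → .{{NonZero n}} → Dec (SquareFree n)
SquareFree? n = map′
  (λ all q qp d → all {q} (s≤s (≤-trans (m≤m*n q q {{prime⇒nonZero qp}}) (∣⇒≤ d))) qp d)
  (λ sf {q} _ → sf q)
  (allUpTo? (λ q → prime? q →-dec ¬? (q * q ∣? n)) (suc n))

IsPrimitiveRoot? : ∀ p g → Dec (IsPrimitiveRoot p g)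
IsPrimitiveRoot? p g = Cop.coprime? g p ×-dec (1 ≤? p ∸ 1) ×-dec ≡?[mod] (p ∸ 1) ×-dec
  map′ (λ all j 0<j j< → all j< 0<j) (λ f {j} j< 0<j → f j 0<j j<)
    (allUpTo? (λ j → (1 ≤? j) →-dec ¬? (≡?[mod] j)) (p ∸ 1))
  where
  ≡?[mod] : ∀ j → Dec ((g ^ j) ≡ 1 [mod p ])
  ≡?[mod] j = (p ∣? (g ^ j ∸ 1)) ×-dec (p ∣? (1 ∸ g ^ j))

Candidate? : ∀ p g → Dec (Candidate p g)
Candidate? p zero      = no λ ()
Candidate? p g@(suc _) = (1 ≤? g) ×-dec SquareFree? g ×-dec IsPrimitiveRoot? p g

least-candidate : ∀ p g → Candidate p g → ∃[ h ] (h ≤ g × IsLeastSqFreePrimRoot p h)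
least-candidate p g c = go g ≤-refl (g , ≤-refl , c)
  where
  go : ∀ n → n ≤ g → ∃[ h ] (h ≤ n × Candidate p h) → ∃[ h ] (h ≤ g × IsLeastSqFreePrimRoot p h)
  go zero    _   (zero , _ , () , _)
  go (suc n) n<g (h , h≤ , c) with anyUpTo? (Candidate? p) (suc n)
  ... | yes (h′ , s≤s h′≤n , c′) = go n (<⇒≤ n<g) (h′ , h′≤n , c′)
  ... | no none with m≤n⇒m<n∨m≡n h≤
  ...   | inj₁ h<  = ⊥-elim (none (h , h< , c))
  ...   | inj₂ h≡ = h , ≤-trans h≤ n<g , proj₁ c , proj₁ (proj₂ c) , proj₂ (proj₂ c) ,
          λ h′ 0<h′ sf pr → subst (_≤ h′) (sym h≡) (≮⇒≥ λ h′< → none (h′ , h′< , 0<h′ , sf , pr))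

-- A record rather than a synonym, since the powers would be unfolded whenever two such types are compared.
record Below (g p : ℕ) : Set where
  constructor below
  field
    power-< : g ^ 25 < p ^ 22

≤-Below : ∀ {g h p} → g ≤ h → Below h p → Below g p
≤-Below {g} {h} {p} g≤h (below lt) = below (mono 25 22 lt)
  where
  mono : ∀ e f → h ^ e < p ^ f → g ^ e < p ^ f
  mono e f = ≤-<-trans (^-monoˡ-≤ e g≤h)

SmallRoot : ℕ → Set
SmallRoot p = ∃[ g ] (Candidate p g × Below g p)

module SieveConclusion (p : ℕ) (pp : Prime p) where
  open PrimitiveRoots p pp using (free-primitiveRoot)
  open Sieve p pp

  module _ (E : List ℕ) (M : ℕ) (coprime : AllPairs Coprime E) (nonzero : All NonZero E)
           (index : product E * M ≡ p ∸ 1) (R : List ℕ)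
           (R-ok : All (λ r → (r ∣ M) × (r ≢ 0) × All (Coprime r) E) R)
           (complete : ∀ q → Prime q → q ∣ p ∸ 1 → q ∈ E ⊎ q ∈ R)
           (K : ℕ) (K≤p : K ≤ p)
           (σ : ℕ) (σ-bound : φ E * p ≤ σ * σ + φ E * (φ E * M))
           (QL QT : List ℕ) (ρ : ℕ) (ρ-bound : φ E * p ≤ ρ * ρ) (p∤2 : ¬ (p ∣ 2))
           (QL-ok : All (λ q → NonZero (q * q) × Coprime (q * q) 2 × ¬ (p ∣ q * q) × blocks K (q * q) ≤ p) QL)
           (QT-ok : All (λ q → NonZero (q * q) × Coprime (q * q) 2) QT)
           (cover : ∀ q → Prime q → q ≢ 2 → q * q ≤ 4 * K → q ∈ QL ⊎ q ∈ QT) where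

    smallRoot : errorTerm E M coprime nonzero index K K≤p σ σ-bound R QL QT ρ < K * K * (φ E * M) →
                Below (4 * K ∸ 3) p → SmallRoot p
    smallRoot lt size with sieve-success E M coprime nonzero index K K≤p σ σ-bound R QL QT ρ ρ-bound (All.map proj₁ R-ok) p∤2 QL-ok QT-ok lt
    ... | m , m< , free , ¬R , ¬L , ¬T =
      n , (s≤s z≤n , squarefree , free-primitiveRoot E M R n coprime index R-ok complete free ¬R) , ≤-Below n≤ size
      where
      n = 1 + 2 * m
      n≤ : n ≤ 4 * K ∸ 3
      n≤ = begin
        1 + 2 * m              ≡⟨ ring m ⟩
        (2 * suc m) ∸ 1        ≤⟨ ∸-monoˡ-≤ 1 (*-monoʳ-≤ 2 m<) ⟩
        2 * (2 * K ∸ 1) ∸ 1    ≡⟨ cong (_∸ 1) (*-distribˡ-∸ 2 (2 * K) 1) ⟩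
        2 * (2 * K) ∸ 2 ∸ 1    ≡⟨ ∸-+-assoc (2 * (2 * K)) 2 1 ⟩
        2 * (2 * K) ∸ 3        ≡⟨ cong (_∸ 3) (*-assoc 2 2 K) ⟨
        4 * K ∸ 3              ∎
        where
        open ≤-Reasoning
        ring : ∀ m → 1 + 2 * m ≡ 2 * suc m ∸ 1
        ring m = cong (_∸ 1) (sym (*-suc 2 m))
      squarefree : SquareFree n
      squarefree q qp d with q ≟ 2
      ... | yes refl = <⇒≱ (s≤s (s≤s z≤n)) (∣⇒≤ (∣m+n∣m⇒∣n (subst (2 ∣_) (+-comm 1 (2 * m)) (∣-trans (m∣m*n 2) d)) (m∣m*n m)))
      ... | no q≢2 with cover q qp q≢2 (≤-trans (∣⇒≤ d) (≤-trans n≤ (m∸n≤m (4 * K) 3)))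
      ...   | inj₁ q∈ = All.lookup ¬L q∈ d
      ...   | inj₂ q∈ = All.lookup ¬T q∈ d

-- Computation for p < 2²⁰⁰

square : ℕ → ℕ
square x = x * x

-- Exponentiation by octal digits: three squarings and one small power between reductions. The fuel
-- suffices as soon as it is at least the exponent.
powMod : ℕ → (n : ℕ) → .{{NonZero n}} → ℕ → ℕ → ℕ
powMod zero    n b e         = 1
powMod (suc f) n b zero      = 1
powMod (suc f) n b e@(suc _) = (square (square (square (powMod f n b (e / 8)))) * b ^ (e % 8)) % n

isOne : ℕ → Bool
isOne 1 = true
isOne _ = false

-- The odd primes below 1103, which is the next prime and the later bound L.
oddPrimes : List ℕ
oddPrimes =
  3 ∷ 5 ∷ 7 ∷ 11 ∷ 13 ∷ 17 ∷ 19 ∷ 23 ∷ 29 ∷ 31 ∷ 37 ∷ 41 ∷ 43 ∷ 47 ∷ 53 ∷ 59 ∷ 61 ∷ 67 ∷ 71 ∷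
  73 ∷ 79 ∷ 83 ∷ 89 ∷ 97 ∷ 101 ∷ 103 ∷ 107 ∷ 109 ∷ 113 ∷ 127 ∷ 131 ∷ 137 ∷ 139 ∷ 149 ∷ 151 ∷
  157 ∷ 163 ∷ 167 ∷ 173 ∷ 179 ∷ 181 ∷ 191 ∷ 193 ∷ 197 ∷ 199 ∷ 211 ∷ 223 ∷ 227 ∷ 229 ∷ 233 ∷
  239 ∷ 241 ∷ 251 ∷ 257 ∷ 263 ∷ 269 ∷ 271 ∷ 277 ∷ 281 ∷ 283 ∷ 293 ∷ 307 ∷ 311 ∷ 313 ∷ 317 ∷
  331 ∷ 337 ∷ 347 ∷ 349 ∷ 353 ∷ 359 ∷ 367 ∷ 373 ∷ 379 ∷ 383 ∷ 389 ∷ 397 ∷ 401 ∷ 409 ∷ 419 ∷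
  421 ∷ 431 ∷ 433 ∷ 439 ∷ 443 ∷ 449 ∷ 457 ∷ 461 ∷ 463 ∷ 467 ∷ 479 ∷ 487 ∷ 491 ∷ 499 ∷ 503 ∷
  509 ∷ 521 ∷ 523 ∷ 541 ∷ 547 ∷ 557 ∷ 563 ∷ 569 ∷ 571 ∷ 577 ∷ 587 ∷ 593 ∷ 599 ∷ 601 ∷ 607 ∷
  613 ∷ 617 ∷ 619 ∷ 631 ∷ 641 ∷ 643 ∷ 647 ∷ 653 ∷ 659 ∷ 661 ∷ 673 ∷ 677 ∷ 683 ∷ 691 ∷ 701 ∷
  709 ∷ 719 ∷ 727 ∷ 733 ∷ 739 ∷ 743 ∷ 751 ∷ 757 ∷ 761 ∷ 769 ∷ 773 ∷ 787 ∷ 797 ∷ 809 ∷ 811 ∷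
  821 ∷ 823 ∷ 827 ∷ 829 ∷ 839 ∷ 853 ∷ 857 ∷ 859 ∷ 863 ∷ 877 ∷ 881 ∷ 883 ∷ 887 ∷ 907 ∷ 911 ∷
  919 ∷ 929 ∷ 937 ∷ 941 ∷ 947 ∷ 953 ∷ 967 ∷ 971 ∷ 977 ∷ 983 ∷ 991 ∷ 997 ∷ 1009 ∷ 1013 ∷ 1019 ∷
  1021 ∷ 1031 ∷ 1033 ∷ 1039 ∷ 1049 ∷ 1051 ∷ 1061 ∷ 1063 ∷ 1069 ∷ 1087 ∷ 1091 ∷ 1093 ∷ 1097 ∷ []

strip : ℕ → ℕ → ℕ → ℕ
strip zero    q m = m
strip (suc f) q m = if m /₀ q * q ≡ᵇ m then strip f q (m /₀ q) else m

divisible : ℕ → ℕ → Bool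
divisible q m = m /₀ q * q ≡ᵇ m

isBelow : ℕ → ℕ → Bool
isBelow g n = g ^ 25 <ᵇ n ^ 22

module Check (n : ℕ) .{{_ : NonZero n}} where

  isKer : ℕ → ℕ → Bool
  isKer g m = isOne (powMod m n g m)

  -- A 0 in the output stands for a failure: its exponent (n ∸ 1) /₀ 0 is 0, and g ^ 0 = 1 fails every test.
  factors : List ℕ → ℕ → List ℕ
  factors-stripped : ℕ → List ℕ → ℕ → List ℕ
  factors []       m = 0 ∷ []
  factors (q ∷ qs) m =
    if m <ᵇ q * q then (if m ≡ᵇ 1 then [] else m ∷ [])
    else if divisible q m then q ∷ factors-stripped q qs (strip m q m)
    else factors qs m
  factors-stripped q qs m = if divisible q m then 0 ∷ [] else factors qs m

  noneOne : ℕ → List ℕ → Bool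
  noneOne g []       = true
  noneOne g (q ∷ qs) = not (isKer g ((n ∸ 1) /₀ q)) ∧ noneOne g qs

  -- Quadratic reciprocity: a cheap filter for quadratic non-residues, on which no proof depends.
  hint : ℕ → Bool
  hint 2 = let r = n % 8 in (r ≡ᵇ 3) ∨ (r ≡ᵇ 5)
  hint zero = false
  hint g@(suc _) = if (n % 4 ≡ᵇ 1) ∨ (g % 4 ≡ᵇ 1) then not l else l
    where l = isOne (powMod g g (n % g) (g / 2))

  root : List ℕ → ℕ → Bool
  root qs g = hint g ∧ (noneOne g qs ∧ (not (isKer g ((n ∸ 1) /₀ 2)) ∧ isBelow g n))

  anyRoot : List ℕ → List ℕ → Bool
  anyRoot qs []       = false
  anyRoot qs (g ∷ gs) = root qs g ∨ anyRoot qs gs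

  search : List ℕ → List ℕ → Bool
  search table = anyRoot (factors-stripped 2 table (strip (n ∸ 1) 2 (n ∸ 1)))

witnesses : List ℕ
witnesses =
  2 ∷ 3 ∷ 5 ∷ 7 ∷ 11 ∷ 13 ∷ 17 ∷ 19 ∷ 23 ∷ 29 ∷ 31 ∷ 37 ∷ 41 ∷ 43 ∷ 47 ∷ 53 ∷ 59 ∷ 61 ∷ 67 ∷ 71 ∷ 73 ∷ 79 ∷ 83 ∷
  89 ∷ 97 ∷ 101 ∷ 103 ∷ 107 ∷ 109 ∷ 113 ∷ 127 ∷ 131 ∷ 137 ∷ 139 ∷ 149 ∷ 151 ∷ 157 ∷ 163 ∷ 167 ∷ 173 ∷ 179 ∷ 181 ∷ 191 ∷ 193 ∷ 197 ∷ 199 ∷ []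

dividesAny : List ℕ → ℕ → Bool
dividesAny []       m = false
dividesAny (d ∷ ds) m = divisible d m ∨ dividesAny ds m

hasDivisor : List ℕ → ℕ → Bool
hasDivisor []       m = false
hasDivisor (d ∷ ds) m = (divisible d m ∧ (d <ᵇ m)) ∨ hasDivisor ds m

trialDivisors : List ℕ
trialDivisors = 3 ∷ 5 ∷ 7 ∷ 11 ∷ 13 ∷ 17 ∷ 19 ∷ 23 ∷ 29 ∷ 31 ∷ []

-- 3511 is a Wieferich prime: its square passes the Fermat test to base 2 (1093 lies in the table).
checkWith : List ℕ → List ℕ → List ℕ → List ℕ → ℕ → Bool
checkWith table trial gs X zero      = true
checkWith table trial gs X m@(suc _) =
  dividesAny X m ∨ (hasDivisor trial (suc m) ∨ (not (isKer 2 m) ∨ (search table gs ∨ hasDivisor (3511 ∷ table) (suc m))))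
  where open Check (suc m)

check : List ℕ → ℕ → Bool
check = checkWith oddPrimes trialDivisors witnesses

scan : List ℕ → ℕ → ℕ → ℕ → Bool
scan X e zero    m = true
scan X e (suc c) m = check X m ∧ scan X e c (e + m)

elem : ℕ → List ℕ → Bool
elem x []       = false
elem x (y ∷ ys) = (x ≡ᵇ y) ∨ elem x ys

-- Pointwise lower bounds for the increasing list of prime divisors of p − 1 outside E and X, whose
-- product is at most b; nothing if the table is too short.
worst : List ℕ → List ℕ → ℕ → List ℕ → Maybe (List ℕ)
worst E X b []       = nothing
worst E X b (q ∷ qs) =
  if elem q E ∨ elem q X then worst E X b qs
  else if b <ᵇ q then just [] else mapMaybe (q ∷_) (worst E X (b /₀ q) qs)

-- Greedy choice of binary digits from the top, which finds the largest argument below 2^f passing a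
-- downward closed test. Its results need no proof: each value of K, z, σ and ρ derived from it is
-- checked afterwards.
climb : ℕ → (ℕ → Bool) → ℕ → ℕ
climb zero    t acc = acc
climb (suc f) t acc = if t (acc + 2 ^ f) then climb f t (acc + 2 ^ f) else climb f t acc

ceilSqrt : ℕ → ℕ → ℕ
ceilSqrt f n = suc (climb f (λ x → x * x <ᵇ n) 0)

-- For P₁ ≤ p < P₂.  Here 2K is about p^0.88 / 2, and tail bounds the number of i < K for which
-- 1 + 2 (i + j) is divisible by q² for some odd prime q (any fixed j).
module Range (table : List ℕ) (bits P₁ P₂ K tail : ℕ) where

  -- e = ∏E, f = φ(e); σ and ρ bound the two square roots; s and t are the number of remaining primes r
  -- and Σ ⌈K/r⌉; A and S collect the contributions of the q treated by the estimate, T that of the others.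
  accept : ℕ → ℕ → ℕ → ℕ → ℕ → ℕ → ℕ → ℕ → ℕ → Bool
  accept e f σ ρ t s A S T =
    e * (K * (s * ρ) + S * σ + K * T + K * σ) * P₁ + f * (P₁ ∸ 1) * (K * t + A) <ᵇ f * (P₁ ∸ 1) * (K * K)

  -- Moves the q of the table one at a time, at most ten of them, from the trivial bound to the
  -- estimate and stops at the first split that is accepted. The estimate is sharper for small q but
  -- adds an error term for each.
  walk : ℕ → List ℕ → ℕ → ℕ → ℕ → ℕ → ℕ → ℕ → ℕ → ℕ → ℕ → Bool
  walk-step : ℕ → List ℕ → ℕ → ℕ → ℕ → ℕ → ℕ → ℕ → ℕ → ℕ → ℕ → ℕ → ℕ → Bool
  walk zero    qs       e f σ ρ t s A S T = false
  walk (suc c) []       e f σ ρ t s A S T = accept e f σ ρ t s A S T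
  walk (suc c) (q ∷ qs) e f σ ρ t s A S T =
    accept e f σ ρ t s A S T ∨ walk-step c qs e f σ ρ t s A S T (q * q) (blocks K (q * q))
  walk-step c qs e f σ ρ t s A S T d k = walk c qs e f σ ρ t s (A + d * (k * k)) (S + d * k) (T ∸ k)

  crit-with : ℕ → ℕ → ℕ → ℕ → Maybe (List ℕ) → Bool
  crit-with e f σ ρ nothing  = false
  crit-with e f σ ρ (just R) =
    -- With M = (p - 1) / e, the quantity φ (p - φ M) equals (f (e - f) p + f²) / e, which increases
    -- with p.
    (f * (e ∸ f) * P₂ + f * f ≤ᵇ e * (σ * σ)) ∧ ((f * P₂ ≤ᵇ ρ * ρ) ∧
    walk 11 table e f σ ρ (∑ₗ R (blocks K)) (length R) 0 0 tail)

  crit-at : ℕ → ℕ → List ℕ → List ℕ → Bool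
  crit-at e f E X =
    crit-with e f (ceilSqrt bits (suc ((f * (e ∸ f) * P₂ + f * f) /₀ e))) (ceilSqrt bits (f * P₂))
      (worst E X (P₂ /₀ e) (2 ∷ table))

  crit : List ℕ → List ℕ → Bool
  crit E X = crit-at (product E) (φ E) E X

  -- Every tail of E with at most four primes is tried as the set defining e. A known divisor of p -
  -- 1 need not enter e, since it also enlarges φ(e) and with it the errors.
  passes : List ℕ → List ℕ → Bool
  passes []      X = false
  passes (l ∷ E) X = passes E X ∨ ((length E ≤ᵇ 3) ∧ crit (l ∷ E) X)

  scanClass : List ℕ → ℕ → Bool
  scanClass X e = scan X e (suc (P₂ /₀ e ∸ (P₁ ∸ 1) /₀ e)) (e * ((P₁ ∸ 1) /₀ e))

  -- Returns the number of candidates to be searched along with the verdict.  Branching on l ∣ p − 1 is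
  -- attempted only if excluding all the remaining l would suffice.
  solve : List ℕ → List ℕ → List ℕ → ℕ → ℕ × Bool
  branch : List ℕ → List ℕ → List ℕ → ℕ → Bool → ℕ × Bool
  choose : ℕ × Bool → ℕ × Bool → ℕ × Bool → ℕ × Bool
  solve ls E X e = if passes E X then (0 , true) else branch ls E X e (passes E (ls ++ X))
  branch (l ∷ ls) E X e true = choose (solve ls (l ∷ E) X (l * e)) (solve ls E (l ∷ X) e) (30 + (P₂ ∸ P₁) /₀ e , scanClass X e)
  branch _        E X e _    = 30 + (P₂ ∸ P₁) /₀ e , scanClass X e
  choose (a , u) (b , v) (c , w) = if a + b <ᵇ c then (a + b , u ∧ v) else (c , w)

module Interval (L a₀ end : ℕ) (table ls : List ℕ) where
  open Range

  -- K is determined by P₁ and the errors by P₂, so a shorter interval loses less. For small p,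
  -- where there is less room, the ratio is about 1.1.
  next : ℕ → ℕ
  next P = if P <ᵇ 1000000000 then P + P / 10 else 2 * P

  -- The entries of the table one by one, then all odd numbers from L = 2 a₀ + 1 on: K / (4 a₀)
  -- bounds their sum of K / q² by telescoping, and z accounts for the roundings up.
  tailSize : ℕ → ℕ → ℕ
  tailSize K z = ∑ₗ table (λ q → blocks K (q * q)) + (K /₀ (4 * a₀) + z)

  interval-tail : ℕ → ℕ → ℕ → ℕ → ℕ → ℕ → Bool
  interval-tail b P₁ P₂ K z T =
    (L <ᵇ P₁) ∧ ((K <ᵇ P₁) ∧ (isBelow (4 * K ∸ 3) P₁ ∧ ((4 * K <ᵇ (L + 2 * z) * (L + 2 * z)) ∧
    proj₂ (solve table (b / 2 + 8) P₁ P₂ K T ls (2 ∷ []) [] 2))))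

  interval-z : ℕ → ℕ → ℕ → ℕ → ℕ → Bool
  interval-z b P₁ P₂ K z = interval-tail b P₁ P₂ K z (tailSize K z)

  interval-K : ℕ → ℕ → ℕ → ℕ → Bool
  interval-K b P₁ P₂ K = interval-z b P₁ P₂ K (ceilSqrt (b / 2 + 1) (4 * K + 4) / 2 ∸ a₀)

  interval : ℕ → ℕ → ℕ → Bool
  interval b P₁ P₂ = interval-K b P₁ P₂ (climb b (λ K → isBelow (4 * K ∸ 3) P₁) 0)

  bitLength : ℕ → ℕ → ℕ
  bitLength zero    n = 0
  bitLength (suc f) zero = 0
  bitLength (suc f) n@(suc _) = suc (bitLength f (n / 2))

  run : ℕ → ℕ → Bool
  run-to : ℕ → ℕ → ℕ → Bool
  run zero    P = end ≤ᵇ P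
  run (suc c) P = run-to c P (next P)
  run-to c P P′ = interval (bitLength P P′) P P′ ∧ run c P′

branchPrimes : List ℕ
branchPrimes = 3 ∷ 5 ∷ 7 ∷ 11 ∷ 13 ∷ 17 ∷ 19 ∷ 23 ∷ 29 ∷ []

-- Soundness of the search for prime primitive roots

∧-true : ∀ {a b} → a ∧ b ≡ true → a ≡ true × b ≡ true
∧-true {true} e = refl , e

∨-true : ∀ {a b} → a ∨ b ≡ true → a ≡ true ⊎ b ≡ true
∨-true {true}  _ = inj₁ refl
∨-true {false} e = inj₂ e

not-true : ∀ {a} → not a ≡ true → a ≡ false
not-true {false} _ = refl

≡true⇒T : ∀ {b} → b ≡ true → Bool.T b
≡true⇒T refl = tt

<ᵇ-true : ∀ m n → (m <ᵇ n) ≡ true → m < n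
<ᵇ-true m n e = <ᵇ⇒< m n (≡true⇒T e)

≤ᵇ-true : ∀ m n → (m ≤ᵇ n) ≡ true → m ≤ n
≤ᵇ-true m n e = ≤ᵇ⇒≤ m n (≡true⇒T e)

≡ᵇ-true : ∀ m n → (m ≡ᵇ n) ≡ true → m ≡ n
≡ᵇ-true m n e = ≡ᵇ⇒≡ m n (≡true⇒T e)

isBelow-true : ∀ g n → isBelow g n ≡ true → Below g n
isBelow-true g n e = below (<ᵇ-true (g ^ 25) (n ^ 22) e)

Below⇒< : ∀ {g n} → NonZero g → Below g n → g < n
Below⇒< {g} {n} g≢0 (below lt) = ≰⇒> λ n≤g → <⇒≱ lt (power 25 22 n≤g (≤ᵇ⇒≤ 22 25 tt))
  where
  power : ∀ a b → n ≤ g → b ≤ a → n ^ b ≤ g ^ a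
  power a b n≤g b≤a = ≤-trans (^-monoˡ-≤ b n≤g) (^-monoʳ-≤ g {{g≢0}} b≤a)

divisible-true : ∀ q m → divisible q m ≡ true → q ∣ m
divisible-true q m e = divides (m /₀ q) (sym (≡ᵇ-true (m /₀ q * q) m e))

divisible-false : ∀ q m → m ≢ 0 → divisible q m ≡ false → ¬ q ∣ m
divisible-false q m m≢0 e q∣m = subst Bool.T (trans (sym eq) e) (≡⇒≡ᵇ (m /₀ q * q) m (trans (*-comm (m /₀ q) q) (*-/₀ q∣m m≢0)))
  where
  eq : divisible q m ≡ (m /₀ q * q ≡ᵇ m)
  eq = refl

elem-true : ∀ x ys → elem x ys ≡ true → x ∈ ys
elem-true x (y ∷ ys) e with ∨-true {x ≡ᵇ y} e
... | inj₁ x≡y = here (≡ᵇ-true x y x≡y)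
... | inj₂ x∈  = there (elem-true x ys x∈)

hasDivisor-sound : ∀ ds m → All (1 <_) ds → hasDivisor ds m ≡ true → ¬ Prime m
hasDivisor-sound (d ∷ ds) m (1<d ∷ 1<ds) e mp with ∨-true {divisible d m ∧ (d <ᵇ m)} e
... | inj₂ e′ = hasDivisor-sound ds m 1<ds e′ mp
... | inj₁ e′ with prime⇒irreducible mp (divisible-true d m (proj₁ (∧-true e′)))
...   | inj₁ d≡1  = <⇒≢ 1<d (sym d≡1)
...   | inj₂ refl = <-irrefl refl (<ᵇ-true d m (proj₂ (∧-true {divisible d m} e′)))

dividesAny-sound : ∀ ds m → dividesAny ds m ≡ true → ¬ All (λ d → ¬ d ∣ m) ds
dividesAny-sound (d ∷ ds) m e (¬d ∷ ¬ds) with ∨-true {divisible d m} e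
... | inj₁ e′ = ¬d (divisible-true d m e′)
... | inj₂ e′ = dividesAny-sound ds m e′ ¬ds

-- A composite number below 1103 < 37² has a prime factor at most 31, so the trial divisors expose
-- every number missing from the table.
complete-below : ℕ → Bool
complete-below zero    = true
complete-below (suc n) = ((n <ᵇ 2) ∨ (elem n (2 ∷ oddPrimes) ∨ hasDivisor (2 ∷ trialDivisors) n)) ∧ complete-below n

1<trialDivisors : All (1 <_) (2 ∷ trialDivisors)
1<trialDivisors = from-yes (All.all? (1 <?_) (2 ∷ trialDivisors))

complete-sound : ∀ n → complete-below n ≡ true → ∀ q → q < n → Prime q → q ∈ 2 ∷ oddPrimes
complete-sound (suc n) e q q<1+n qp with m<1+n⇒m<n∨m≡n q<1+n
... | inj₁ q<n  = complete-sound n (proj₂ (∧-true {(n <ᵇ 2) ∨ _} e)) q q<n qp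
... | inj₂ refl with ∨-true {q <ᵇ 2} (proj₁ (∧-true e))
...   | inj₁ q<2 = ⊥-elim (<⇒≱ (<ᵇ-true q 2 q<2) (nonTrivial⇒n>1 q {{prime⇒nonTrivial qp}}))
...   | inj₂ e′ with ∨-true {elem q (2 ∷ oddPrimes)} e′
...     | inj₁ q∈ = elem-true q (2 ∷ oddPrimes) q∈
...     | inj₂ d  = ⊥-elim (hasDivisor-sound (2 ∷ trialDivisors) q 1<trialDivisors d qp)

oddPrimes-complete : ∀ q → Prime q → q ∈ 2 ∷ oddPrimes ⊎ 1103 ≤ q
oddPrimes-complete q qp with q <? 1103
... | yes q< = inj₁ (complete-sound 1103 refl q q< qp)
... | no q≮  = inj₂ (≮⇒≥ q≮)

sorted : List ℕ → Bool
sorted []           = true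
sorted (x ∷ [])     = true
sorted (x ∷ y ∷ ys) = (x <ᵇ y) ∧ sorted (y ∷ ys)

sorted-sound : ∀ xs → sorted xs ≡ true → AllPairs _<_ xs
sorted-sound []           e = []
sorted-sound (x ∷ [])     e = [] ∷ []
sorted-sound (x ∷ y ∷ ys) e with sorted-sound (y ∷ ys) (proj₂ (∧-true {x <ᵇ y} e))
... | y< ∷ ps = (x<y ∷ All.map (<-trans x<y) y<) ∷ y< ∷ ps
  where
  x<y : x < y
  x<y = <ᵇ-true x y (proj₁ (∧-true e))

oddPrimes-sorted : AllPairs _<_ (2 ∷ oddPrimes)
oddPrimes-sorted = sorted-sound (2 ∷ oddPrimes) refl

inRange : List ℕ → Bool
inRange []       = true
inRange (q ∷ qs) = ((2 <ᵇ q) ∧ (q <ᵇ 1103) ∧ (q % 2 ≡ᵇ 1)) ∧ inRange qs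

inRange-sound : ∀ qs → inRange qs ≡ true → All (λ q → 2 < q × q < 1103 × ¬ 2 ∣ q) qs
inRange-sound []       e = []
inRange-sound (q ∷ qs) e with ∧-true {(2 <ᵇ q) ∧ (q <ᵇ 1103) ∧ (q % 2 ≡ᵇ 1)} e
... | e₁ , e₂ with ∧-true {2 <ᵇ q} e₁
... | a , e₃ with ∧-true {q <ᵇ 1103} e₃
... | b , c = (<ᵇ-true 2 q a , <ᵇ-true q 1103 b , λ d → 0≢1 (trans (sym (n∣m⇒m%n≡0 q 2 d)) (≡ᵇ-true (q % 2) 1 c))) ∷ inRange-sound qs e₂
  where
  0≢1 : 0 ≢ 1
  0≢1 ()

oddPrimes-range : All (λ q → 2 < q × q < 1103 × ¬ 2 ∣ q) oddPrimes
oddPrimes-range = inRange-sound oddPrimes refl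

∈-tail : ∀ {r q : ℕ} {qs} → r ∈ q ∷ qs → r ≢ q → r ∈ qs
∈-tail (here e)  ne = ⊥-elim (ne e)
∈-tail (there i) ne = i

∈⊎-tail : ∀ {r q : ℕ} {qs} {A : Set} → r ∈ q ∷ qs ⊎ A → r ≢ q → r ∈ qs ⊎ A
∈⊎-tail (inj₁ i) ne = inj₁ (∈-tail i ne)
∈⊎-tail (inj₂ a) ne = inj₂ a

head-≤ : ∀ {r q L : ℕ} {qs} → All (q <_) qs → q < L → r ∈ q ∷ qs ⊎ L ≤ r → q ≤ r
head-≤ q< _   (inj₁ (here refl)) = ≤-refl
head-≤ q< _   (inj₁ (there i))   = <⇒≤ (All.lookup q< i)
head-≤ _  q<b (inj₂ b≤r)         = <⇒≤ (<-≤-trans q<b b≤r)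

strip-∣ : ∀ f q m → strip f q m ∣ m
strip-∣ zero    q m = ∣-refl
strip-∣ (suc f) q m with divisible q m in e
... | false = ∣-refl
... | true  = ∣-trans (strip-∣ f q (m /₀ q)) (subst (m /₀ q ∣_) (≡ᵇ-true (m /₀ q * q) m e) (m∣m*n q))

strip-prime : ∀ f q m r → Prime r → r ∣ m → r ∣ q ⊎ r ∣ strip f q m
strip-prime zero    q m r rp r∣m = inj₂ r∣m
strip-prime (suc f) q m r rp r∣m with divisible q m in e
... | false = inj₂ r∣m
... | true with euclidsLemma (m /₀ q) q rp (subst (r ∣_) (sym (≡ᵇ-true (m /₀ q * q) m e)) r∣m)
...   | inj₁ d = strip-prime f q (m /₀ q) r rp d
...   | inj₂ d = inj₁ d

witnesses-prime : All Prime witnesses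
witnesses-prime = from-yes (All.all? prime? witnesses)

module CheckSound (n : ℕ) (pp : Prime n) where
  open PrimitiveRoots n pp
  open FreeParts n pp
  open Check n

  square-∼ : ∀ {a b} → a ∼ b → square a ∼ square b
  square-∼ {a} {b} e = *-∼ {a} {b} {a} {b} e e

  powMod-∼ : ∀ f b e → e ≤ f → powMod f n b e ∼ b ^ e
  powMod-∼ zero    b zero    _   = refl
  powMod-∼ (suc f) b zero    _   = refl
  powMod-∼ (suc f) b e@(suc e′) e≤f = begin
    ((square (square (square h)) * b ^ (e % 8)) % n) % n     ≡⟨ %-∼ (square (square (square h)) * b ^ (e % 8)) ⟩
    (square (square (square h)) * b ^ (e % 8)) % n           ≡⟨ *-∼ {square (square (square h))} {square (square (square c))} {b ^ (e % 8)} {b ^ (e % 8)}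
                                                                  (square-∼ {square (square h)} {square (square c)} (square-∼ {square h} {square c} (square-∼ {h} {c} ih))) refl ⟩
    (square (square (square c)) * b ^ (e % 8)) % n           ≡⟨ cong (_% n) eq ⟩
    b ^ e % n                                                ∎
    where
    open ≡-Reasoning
    h = powMod f n b (e / 8)
    c = b ^ (e / 8)
    ih : h ∼ c
    ih = powMod-∼ f b (e / 8) (≤-pred (≤-trans (m/n<m e 8 (s≤s (s≤s z≤n))) e≤f))
    eighth : ∀ x → x * x * (x * x) * (x * x * (x * x)) ≡ x * (x * (x * (x * (x * (x * (x * (x * 1)))))))
    eighth = solve-∀
    eq : square (square (square c)) * b ^ (e % 8) ≡ b ^ e
    eq = trans (cong (_* b ^ (e % 8)) (trans (eighth c) (^-*-assoc b (e / 8) 8)))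
      (trans (sym (^-distribˡ-+-* b (e / 8 * 8) (e % 8))) (cong (b ^_) (trans (+-comm (e / 8 * 8) (e % 8)) (sym (m≡m%n+[m/n]*n e 8)))))

  powMod-% : ∀ f b e → powMod f n b e % n ≡ powMod f n b e
  powMod-% zero    b e       = 1%p
  powMod-% (suc f) b zero    = 1%p
  powMod-% (suc f) b e@(suc _) = %-∼ (square (square (square (powMod f n b (e / 8)))) * b ^ (e % 8))

  isKer-complete : ∀ g m → Ker m g → isKer g m ≡ true
  isKer-complete g m k = cong isOne (trans (sym (powMod-% m g m)) (trans (powMod-∼ m g m ≤-refl) (trans k 1%p)))

  ¬isKer⇒¬Ker : ∀ g m → not (isKer g m) ≡ true → ¬ Ker m g
  ¬isKer⇒¬Ker g m e k with trans (sym (isKer-complete g m k)) (not-true e)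
  ... | ()

  Ok : ℕ → ℕ → Set
  Ok g q = ¬ Ker ((n ∸ 1) /₀ q) g

  noneOne-sound : ∀ g qs → noneOne g qs ≡ true → All (Ok g) qs
  noneOne-sound g []       e = []
  noneOne-sound g (q ∷ qs) e with ∧-true {not (isKer g ((n ∸ 1) /₀ q))} e
  ... | a , b = ¬isKer⇒¬Ker g ((n ∸ 1) /₀ q) a ∷ noneOne-sound g qs b

  -- The invariant is that no prime factor of m precedes the head q. Hence for m < q² a prime factor
  -- r with a cofactor above 1 is impossible: a prime s of the cofactor would give q² ≤ s r ≤ m.
  factors-sound : ∀ g qs m → AllPairs _<_ qs → All (_< 1103) qs → m ≢ 0 →
    (∀ r → Prime r → r ∣ m → r ∈ qs ⊎ 1103 ≤ r) →
    All (Ok g) (factors qs m) → ∀ r → Prime r → r ∣ m → Ok g r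
  -- Divisibility is tested again after stripping, which replaces a proof that the fuel of `strip`
  -- suffices: a surviving factor q yields the failure mark 0.
  factors-stripped-sound : ∀ g q qs m → AllPairs _<_ (q ∷ qs) → All (_< 1103) (q ∷ qs) → m ≢ 0 →
    (∀ r → Prime r → r ∣ m → r ∈ q ∷ qs ⊎ 1103 ≤ r) →
    All (Ok g) (factors-stripped q qs m) → ∀ r → Prime r → r ∣ m → Ok g r
  factors-sound g []       m _ _ _ _ (ok ∷ []) = ⊥-elim (ok refl)
  factors-sound g (q ∷ qs) m (q< ∷ ps) (q<b ∷ qs<b) m≢0 inv ok r rp r∣m with m <ᵇ q * q in m<q²
  ... | true with m ≡ᵇ 1 in m≡1
  ...   | true = ⊥-elim (<⇒≢ (nonTrivial⇒n>1 r {{prime⇒nonTrivial rp}}) (sym (∣1⇒≡1 (subst (r ∣_) (≡ᵇ-true m 1 m≡1) r∣m))))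
  ...   | false with ok
  ...     | okm ∷ [] = subst (Ok g) m≡r okm
    where
    m≡r : m ≡ r
    m≡r with quotient r∣m in eq
    ... | zero = ⊥-elim (m≢0 (trans (m∣n⇒n≡quotient*m r∣m) (cong (_* r) eq)))
    ... | suc zero = trans (m∣n⇒n≡quotient*m r∣m) (trans (cong (_* r) eq) (*-identityˡ r))
    ... | c@(suc (suc _)) with primeDivisor c (s≤s (s≤s z≤n))
    ...   | s , sp , s∣c = ⊥-elim (<⇒≱ (<ᵇ-true m (q * q) m<q²) (begin
        q * q    ≤⟨ *-mono-≤ (head-≤ q< q<b (inv s sp (∣-trans (subst (s ∣_) (sym eq) s∣c) (quotient-∣ r∣m)))) (head-≤ q< q<b (inv r rp r∣m)) ⟩
        s * r    ≤⟨ *-monoˡ-≤ r (∣⇒≤ s∣c) ⟩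
        c * r    ≡⟨ cong (_* r) eq ⟨
        quotient r∣m * r ≡⟨ m∣n⇒n≡quotient*m r∣m ⟨
        m        ∎))
        where open ≤-Reasoning
  factors-sound g (q ∷ qs) m (q< ∷ ps) (q<b ∷ qs<b) m≢0 inv ok r rp r∣m | false with divisible q m in q∣m
  ... | false = factors-sound g qs m ps qs<b m≢0
      (λ s sp s∣m → ∈⊎-tail (inv s sp s∣m) λ s≡q → divisible-false q m m≢0 q∣m (subst (_∣ m) s≡q s∣m)) ok r rp r∣m
  ... | true with ok
  ...   | okq ∷ oks with strip-prime m q m r rp r∣m
  ...     | inj₁ r∣q = subst (Ok g) (≤-antisym (head-≤ q< q<b (inv r rp r∣m)) (∣⇒≤ {{>-nonZero q>0}} r∣q)) okq
    where
    q>0 : 0 < q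
    q>0 = n≢0⇒n>0 λ q≡0 → m≢0 (0∣⇒≡0 (subst (_∣ m) q≡0 (divisible-true q m q∣m)))
  ...     | inj₂ r∣m′ = factors-stripped-sound g q qs (strip m q m) (q< ∷ ps) (q<b ∷ qs<b)
      (λ z → m≢0 (0∣⇒≡0 (subst (_∣ m) z (strip-∣ m q m))))
      (λ r rp d → inv r rp (∣-trans d (strip-∣ m q m))) oks r rp r∣m′
  factors-stripped-sound g q qs m (q< ∷ ps) (q<b ∷ qs<b) m≢0 inv ok r rp r∣m with divisible q m in q∣m
  ... | true with ok
  ...   | ok0 ∷ [] = ⊥-elim (ok0 refl)
  factors-stripped-sound g q qs m (q< ∷ ps) (q<b ∷ qs<b) m≢0 inv ok r rp r∣m | false =
    factors-sound g qs m ps qs<b m≢0 (λ s sp s∣m → ∈⊎-tail (inv s sp s∣m) λ s≡q → divisible-false q m m≢0 q∣m (subst (_∣ m) s≡q s∣m)) ok r rp r∣m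

  -- All that is required of a factor list. A list containing the failure mark 0 satisfies it
  -- vacuously, since `Ok g 0` is false.
  Covers : List ℕ → Set
  Covers qs = ∀ g → Ok g 2 → All (Ok g) qs → ∀ q → Prime q → q ∣ n ∸ 1 → Ok g q

  factors-cover : ∀ table f → AllPairs _<_ (2 ∷ table) → All (_< 1103) (2 ∷ table) →
    (∀ r → Prime r → r ∈ 2 ∷ table ⊎ 1103 ≤ r) → Covers (factors-stripped 2 table (strip f 2 (n ∸ 1)))
  factors-cover table f sorted bounded complete g ok2 oks q qp q∣m = [ at-2 , at-odd ]′ (strip-prime f 2 (n ∸ 1) q qp q∣m)
    where
    odd-part = strip f 2 (n ∸ 1)
    m≢0 : odd-part ≢ 0
    m≢0 z = p∸1≢0 (0∣⇒≡0 (subst (_∣ n ∸ 1) z (strip-∣ f 2 (n ∸ 1))))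
    at-2 : q ∣ 2 → Ok g q
    at-2 q∣2 = [ (λ q≡1 → ⊥-elim (<⇒≢ (nonTrivial⇒n>1 q {{prime⇒nonTrivial qp}}) (sym q≡1))) ,
                 (λ q≡2 → subst (Ok g) (sym q≡2) ok2) ]′ (prime⇒irreducible prime[2] q∣2)
    at-odd : q ∣ odd-part → Ok g q
    at-odd = factors-stripped-sound g 2 table odd-part sorted bounded m≢0 (λ r rp _ → complete r rp) oks q qp

  root-sound : ∀ qs → Covers qs → ∀ g → Prime g → root qs g ≡ true → SmallRoot n
  root-sound qs cover g gp e = g , (>-nonZero⁻¹ g {{prime⇒nonZero gp}} , squarefree , primitiveRoot g (fermat g n∤g) test) , g-below
    where
    e₁ = proj₂ (∧-true {hint g} e)
    e₂ = proj₂ (∧-true {noneOne g qs} e₁)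
    ok2 : Ok g 2
    ok2 = ¬isKer⇒¬Ker g ((n ∸ 1) /₀ 2) (proj₁ (∧-true {not (isKer g ((n ∸ 1) /₀ 2))} e₂))
    g-below : Below g n
    g-below = isBelow-true g n (proj₂ (∧-true {not (isKer g ((n ∸ 1) /₀ 2))} e₂))
    test : ∀ q k → Prime q → q * k ≡ n ∸ 1 → ¬ Ker k g
    test q k qp eq kk = cover g ok2 (noneOne-sound g qs (proj₁ (∧-true {noneOne g qs} e₁))) q qp q∣
      (subst (λ z → Ker z g) (sym cofactor) kk)
      where
      q∣ : q ∣ n ∸ 1
      q∣ = subst (q ∣_) eq (m∣m*n k)
      cofactor : (n ∸ 1) /₀ q ≡ k
      cofactor = *-cancelˡ-≡ _ _ q {{prime⇒nonZero qp}} (trans (*-/₀ {q} {n ∸ 1} q∣ p∸1≢0) (sym eq))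
    n∤g : ¬ n ∣ g
    n∤g d = <⇒≱ (Below⇒< (prime⇒nonZero gp) g-below) (∣⇒≤ {{prime⇒nonZero gp}} d)
    squarefree : SquareFree g
    squarefree q qp d with prime⇒irreducible gp (∣-trans (m∣m*n q) d)
    ... | inj₁ q≡1  = <⇒≢ (nonTrivial⇒n>1 q {{prime⇒nonTrivial qp}}) (sym q≡1)
    ... | inj₂ refl = <⇒≱ (m<m*n q q {{prime⇒nonZero qp}} (nonTrivial⇒n>1 q {{prime⇒nonTrivial qp}})) (∣⇒≤ {{prime⇒nonZero qp}} d)

  anyRoot-sound : ∀ qs → Covers qs → ∀ gs → All Prime gs → anyRoot qs gs ≡ true → SmallRoot n
  anyRoot-sound qs cover (g ∷ gs) (gp ∷ gps) e =
    [ root-sound qs cover g gp , anyRoot-sound qs cover gs gps ]′ (∨-true {root qs g} e)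

  search-sound : ∀ table gs → AllPairs _<_ (2 ∷ table) → All (_< 1103) (2 ∷ table) →
    (∀ r → Prime r → r ∈ 2 ∷ table ⊎ 1103 ≤ r) → All Prime gs → search table gs ≡ true → SmallRoot n
  search-sound table gs sorted bounded complete =
    anyRoot-sound (factors-stripped 2 table (strip (n ∸ 1) 2 (n ∸ 1))) (factors-cover table (n ∸ 1) sorted bounded complete) gs

module _ (table trial gs : List ℕ) (sorted : AllPairs _<_ (2 ∷ table)) (bounded : All (_< 1103) (2 ∷ table))
         (complete : ∀ r → Prime r → r ∈ 2 ∷ table ⊎ 1103 ≤ r) (1<table : All (1 <_) table)
         (1<trial : All (1 <_) trial) (gs-prime : All Prime gs) where

  -- Each disjunct either produces a root or contradicts a hypothesis: a divisor excluded by X,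
  -- primality by trial division, or Fermat's theorem to base 2, which applies because p > 2.
  checkWith-sound : ∀ X m → Prime (suc m) → 2 < suc m → All (λ x → ¬ x ∣ m) X →
                    checkWith table trial gs X m ≡ true → SmallRoot (suc m)
  checkWith-sound X zero      pp (s≤s ())
  checkWith-sound X m@(suc _) pp 2<n ¬X e =
    [ (λ e₁ → ⊥-elim (dividesAny-sound X m e₁ ¬X)) , (λ e₁ →
    [ (λ e₂ → ⊥-elim (hasDivisor-sound trial (suc m) 1<trial e₂ pp)) , (λ e₂ →
    [ (λ e₃ → ⊥-elim (¬isKer⇒¬Ker 2 m e₃ (fermat 2 (λ d → <⇒≱ 2<n (∣⇒≤ d))))) , (λ e₃ →
    [ search-sound table gs sorted bounded complete gs-prime ,
      (λ e₄ → ⊥-elim (hasDivisor-sound (3511 ∷ table) (suc m) (≤ᵇ⇒≤ 2 3511 tt ∷ 1<table) e₄ pp)) ]′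
      (∨-true {search table gs} e₃)) ]′
      (∨-true {not (isKer 2 m)} e₂)) ]′
      (∨-true {hasDivisor trial (suc m)} e₁)) ]′
      (∨-true {dividesAny X m} e)
    where
    open CheckSound (suc m) pp
    open PrimitiveRoots (suc m) pp
    open Check (suc m)
    open ModPrime (suc m) pp using (fermat)

check-sound : ∀ X m → Prime (suc m) → 2 < suc m → All (λ x → ¬ x ∣ m) X → check X m ≡ true → SmallRoot (suc m)
check-sound = checkWith-sound oddPrimes trialDivisors witnesses oddPrimes-sorted
  (≤ᵇ⇒≤ 3 1103 tt ∷ All.map (proj₁ ∘ proj₂) oddPrimes-range) oddPrimes-complete
  (All.map (<⇒≤ ∘ proj₁) oddPrimes-range) (All.tail 1<trialDivisors) witnesses-prime

-- Numerical form of the sieve criterion and soundness of the interval checks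

infix 4 _≼_
-- The order for which the loss from the remaining primes is monotone: each prime r costs about K /
-- r and one error term, so the loss grows when entries are lowered or appended.
data _≼_ : List ℕ → List ℕ → Set where
  []  : ∀ {W} → [] ≼ W
  _∷_ : ∀ {r c R W} → c ≤ r → R ≼ W → r ∷ R ≼ c ∷ W

/₀-greatest : ∀ {q x b} → 0 < q → q * x ≤ b → x ≤ b /₀ q
/₀-greatest {q@(suc _)} {x} {b} _ le = begin
  x           ≡⟨ m*n/n≡m x q ⟨
  x * q / q   ≤⟨ /-monoˡ-≤ q (≤-trans (≤-reflexive (*-comm x q)) le) ⟩
  b / q       ∎
  where open ≤-Reasoning

/₀-*-≤ : ∀ m d → m /₀ d * d ≤ m
/₀-*-≤ m zero    = ≤-trans (≤-reflexive (*-zeroʳ (m /₀ zero))) z≤n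
/₀-*-≤ m (suc d) = m/n*n≤m m (suc d)

≤d*blocks : ∀ K d → 0 < d → K ≤ d * blocks K d
≤d*blocks K d d>0 = K≤d*blocks K d {{>-nonZero d>0}}

-- In increasing order each remaining prime is at least the corresponding admissible table entry q,
-- so dividing the budget b by q still bounds the product of the others. Once b < q no further prime
-- fits.
worst-dominates : ∀ {L} E X b qs W R → worst E X b qs ≡ just W → AllPairs _<_ qs → All (_< L) qs → All (0 <_) qs →
  AllPairs _<_ R → All Prime R → All (λ r → ¬ r ∈ E × ¬ r ∈ X × (r ∈ qs ⊎ L ≤ r)) R → product R ≤ b → R ≼ W
worst-dominates {L} E X b (q ∷ qs) W R e (q< ∷ ps) (q<b ∷ bd) (q>0 ∷ pos) srt pr mem Πle with elem q E ∨ elem q X in q∈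
... | true  = worst-dominates E X b qs W R e ps bd pos srt pr (All.map (λ {r} → skip r) mem) Πle
  where
  skip : ∀ r → ¬ r ∈ E × ¬ r ∈ X × (r ∈ q ∷ qs ⊎ L ≤ r) → ¬ r ∈ E × ¬ r ∈ X × (r ∈ qs ⊎ L ≤ r)
  skip r (r∉E , r∉X , i) = r∉E , r∉X , ∈⊎-tail i λ r≡q →
    [ (λ z → r∉E (subst (_∈ E) (sym r≡q) (elem-true q E z))) , (λ z → r∉X (subst (_∈ X) (sym r≡q) (elem-true q X z))) ]′ (∨-true {elem q E} q∈)
... | false with b <ᵇ q in b<q
worst-dominates E X b (q ∷ qs) W [] e (q< ∷ ps) (q<b ∷ bd) (q>0 ∷ pos) srt pr mem Πle | false | true = []
worst-dominates E X b (q ∷ qs) W (r ∷ R) e (q< ∷ ps) (q<b ∷ bd) (q>0 ∷ pos) srt (rp ∷ pr) ((_ , _ , i) ∷ mem) Πle | false | true =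
  ⊥-elim (<⇒≱ (<ᵇ-true b q b<q) (≤-trans (head-≤ q< q<b i) (≤-trans (m≤m*n r (product R) {{>-nonZero (productOfPrimes≥1 pr)}}) Πle)))
... | false with worst E X (b /₀ q) qs in eW
worst-dominates E X b (q ∷ qs) W [] e (q< ∷ ps) (q<b ∷ bd) (q>0 ∷ pos) srt pr mem Πle | false | false | just W′ = []
worst-dominates {L} E X b (q ∷ qs) W (r ∷ R) refl (q< ∷ ps) (q<b ∷ bd) (q>0 ∷ pos) (r< ∷ srt) (rp ∷ pr) ((_ , _ , i) ∷ mem) Πle | false | false | just W′ =
  q≤r ∷ worst-dominates E X (b /₀ q) qs W′ R eW ps bd pos srt pr (All.zipWith (λ {s} → step s) (r< , mem))
    (/₀-greatest q>0 (≤-trans (*-monoˡ-≤ (product R) q≤r) Πle))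
  where
  q≤r : q ≤ r
  q≤r = head-≤ q< q<b i
  step : ∀ s → (r < s) × (¬ s ∈ E × ¬ s ∈ X × (s ∈ q ∷ qs ⊎ L ≤ s)) → ¬ s ∈ E × ¬ s ∈ X × (s ∈ qs ⊎ L ≤ s)
  step s (r<s , s∉E , s∉X , j) = s∉E , s∉X , ∈⊎-tail j (λ s≡q → <⇒≱ r<s (subst (_≤ r) (sym s≡q) q≤r))

product-coprime : ∀ {x xs} → All (Coprime x) xs → Coprime x (product xs)
product-coprime []       (_ , d∣1) = ∣1⇒≡1 d∣1
product-coprime {x} {y ∷ ys} (c ∷ cs) {d} (d∣x , d∣yΠ) = product-coprime cs (d∣x ,
  Cop.coprime-divisor (λ { (e∣d , e∣y) → c (∣-trans e∣d d∣x , e∣y) }) d∣yΠ)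

product-∣ : ∀ {xs n} → AllPairs Coprime xs → All (_∣ n) xs → product xs ∣ n
product-∣ {n = n} []       []         = 1∣ n
product-∣ {x ∷ xs} (c ∷ cs) (divides-refl k ∷ ds) =
  subst (x * product xs ∣_) (*-comm x k) (*-monoʳ-∣ x (Cop.coprime-divisor (Cop.sym (product-coprime c))
    (subst (product xs ∣_) (*-comm k x) (product-∣ cs ds))))

sorted-primes-coprime : ∀ xs → All Prime xs → AllPairs _<_ xs → AllPairs Coprime xs
sorted-primes-coprime []       _          _         = []
sorted-primes-coprime (x ∷ xs) (xp ∷ xsp) (x< ∷ ps) = All.zipWith {R = Coprime x} one (x< , xsp) ∷ sorted-primes-coprime xs xsp ps
  where
  one : ∀ {y} → (x < y) × Prime y → Coprime x y
  one (x<y , yp) = prime-coprime xp yp (<⇒≢ x<y)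

selectFrom : ∀ {ℓ} {P : ℕ → Set ℓ} → (∀ x → Dec (P x)) → ℕ → ℕ → List ℕ
selectFrom P? s zero    = []
selectFrom P? s (suc n) with P? s
... | yes _ = s ∷ selectFrom P? (suc s) n
... | no _  = selectFrom P? (suc s) n

module _ {ℓ} {P : ℕ → Set ℓ} (P? : ∀ x → Dec (P x)) where
  selectFrom-≥ : ∀ s n → All (s ≤_) (selectFrom P? s n)
  selectFrom-≥ s zero    = []
  selectFrom-≥ s (suc n) with P? s
  ... | yes _ = ≤-refl ∷ All.map <⇒≤ (selectFrom-≥ (suc s) n)
  ... | no _  = All.map <⇒≤ (selectFrom-≥ (suc s) n)

  selectFrom-sorted : ∀ s n → AllPairs _<_ (selectFrom P? s n)
  selectFrom-sorted s zero    = []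
  selectFrom-sorted s (suc n) with P? s
  ... | yes _ = selectFrom-≥ (suc s) n ∷ selectFrom-sorted (suc s) n
  ... | no _  = selectFrom-sorted (suc s) n

  selectFrom-P : ∀ s n → All P (selectFrom P? s n)
  selectFrom-P s zero    = []
  selectFrom-P s (suc n) with P? s
  ... | yes Ps = Ps ∷ selectFrom-P (suc s) n
  ... | no _   = selectFrom-P (suc s) n

  selectFrom-complete : ∀ s n x → s ≤ x → x < s + n → P x → x ∈ selectFrom P? s n
  selectFrom-complete s zero    x s≤x x<s Px = ⊥-elim (<⇒≱ x<s (subst (_≤ x) (sym (+-identityʳ s)) s≤x))
  selectFrom-complete s (suc n) x s≤x x<  Px with P? s | m≤n⇒m<n∨m≡n s≤x
  ... | yes _  | inj₂ e   = here (sym e)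
  ... | yes _  | inj₁ s<x = there (selectFrom-complete (suc s) n x s<x (subst (x <_) (+-suc s n) x<) Px)
  ... | no ¬Ps | inj₂ e   = ⊥-elim (¬Ps (subst P (sym e) Px))
  ... | no _   | inj₁ s<x = selectFrom-complete (suc s) n x s<x (subst (x <_) (+-suc s n) x<) Px

odds : ℕ → ℕ → List ℕ
odds a zero    = []
odds a (suc z) = suc (2 * a) ∷ odds (suc a) z

odds-complete : ∀ a z b → a ≤ b → b < a + z → suc (2 * b) ∈ odds a z
odds-complete a zero    b a≤b b< = ⊥-elim (<⇒≱ b< (subst (_≤ b) (sym (+-identityʳ a)) a≤b))
odds-complete a (suc z) b a≤b b< with m≤n⇒m<n∨m≡n a≤b
... | inj₂ refl = here refl
... | inj₁ a<b  = there (odds-complete (suc a) z b a<b (subst (b <_) (+-suc a z) b<))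

odds-odd : ∀ a z → All (λ q → ¬ 2 ∣ q) (odds a z)
odds-odd a zero    = []
odds-odd a (suc z) = (λ d → <⇒≱ (s≤s (s≤s z≤n)) (∣⇒≤ (∣m+n∣m⇒∣n (subst (2 ∣_) (+-comm 1 (2 * a)) d) (m∣m*n a)))) ∷ odds-odd (suc a) z

-- 4a(a + 1) < (2a + 1)² makes K/(4a) − K/(4(a + 1)) an upper bound for K/(2a + 1)².
odds-reciprocals : ∀ K a z → ∑ₗ (odds a z) (λ q → K /₀ (q * q)) * (4 * a) ≤ K
odds-reciprocals K a zero    = z≤n
odds-reciprocals K a (suc z) = *-cancelʳ-≤ _ _ (suc a) (begin
  (x + y) * (4 * a) * suc a              ≡⟨ ring₁ x y a ⟩
  x * (4 * a * suc a) + a * (y * (4 * suc a)) ≤⟨ +-mono-≤ (*-monoʳ-≤ x (≤-trans (m≤m+n _ 1) (≤-reflexive (ring₂ a)))) (*-monoʳ-≤ a (odds-reciprocals K (suc a) z)) ⟩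
  x * (L * L) + a * K                    ≤⟨ +-monoˡ-≤ (a * K) (/₀-*-≤ K (L * L)) ⟩
  K + a * K                              ≡⟨ ring₃ K a ⟩
  K * suc a                              ∎)
  where
  open ≤-Reasoning
  L = suc (2 * a)
  x = K /₀ (L * L)
  y = ∑ₗ (odds (suc a) z) (λ q → K /₀ (q * q))
  ring₁ : ∀ x y a → (x + y) * (4 * a) * (1 + a) ≡ x * (4 * a * (1 + a)) + a * (y * (4 * (1 + a)))
  ring₁ = solve-∀
  ring₂ : ∀ a → 4 * a * (1 + a) + 1 ≡ (1 + 2 * a) * (1 + 2 * a)
  ring₂ = solve-∀
  ring₃ : ∀ K a → K + a * K ≡ K * (1 + a)
  ring₃ = solve-∀

odds-blocks : ∀ K a z → 0 < a → ∑ₗ (odds a z) (λ q → blocks K (q * q)) ≤ K /₀ (4 * a) + z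
odds-blocks K a z a>0 = ≤-trans (≤-reflexive (count a z))
  (+-monoˡ-≤ z (/₀-greatest {4 * a} (*-mono-≤ {1} {4} (s≤s z≤n) a>0) (≤-trans (≤-reflexive (*-comm (4 * a) _)) (odds-reciprocals K a z))))
  where
  count : ∀ a z → ∑ₗ (odds a z) (λ q → blocks K (q * q)) ≡ ∑ₗ (odds a z) (λ q → K /₀ (q * q)) + z
  count a zero    = refl
  count a (suc z) = trans (cong (λ s → suc (K /₀ (suc (2 * a) * suc (2 * a))) + s) (count (suc a) z))
    (ring (K /₀ (suc (2 * a) * suc (2 * a))) _ z)
    where
    ring : ∀ x y z → 1 + x + (y + z) ≡ x + y + (1 + z)
    ring = solve-∀

∑ₗ-++ : ∀ xs ys f → ∑ₗ (xs ++ ys) f ≡ ∑ₗ xs f + ∑ₗ ys f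
∑ₗ-++ []       ys f = refl
∑ₗ-++ (x ∷ xs) ys f = trans (cong (f x +_) (∑ₗ-++ xs ys f)) (sym (+-assoc (f x) _ _))

odd-half : ∀ q → ¬ 2 ∣ q → q ≡ suc (2 * (q / 2))
odd-half q odd = trans (m≡m%n+[m/n]*n q 2) (cong₂ _+_ rem (*-comm (q / 2) 2))
  where
  rem : q % 2 ≡ 1
  rem with q % 2 in e | m%n<n q 2
  ... | 0 | _ = ⊥-elim (odd (m%n≡0⇒n∣m q 2 e))
  ... | 1 | _ = refl
  ... | suc (suc _) | s≤s (s≤s ())

square-coprime-2 : ∀ q → ¬ 2 ∣ q → Coprime (q * q) 2
square-coprime-2 q odd {d} (d∣q² , d∣2) with prime⇒irreducible prime[2] d∣2
... | inj₁ e    = e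
... | inj₂ refl = ⊥-elim ([ odd , odd ]′ (euclidsLemma q q prime[2] d∣q²))

odd⇒>0 : ∀ q → ¬ 2 ∣ q → 0 < q
odd⇒>0 zero    odd = ⊥-elim (odd (2 ∣0))
odd⇒>0 (suc q) _   = s≤s z≤n

square-nonZero : ∀ q → ¬ 2 ∣ q → NonZero (q * q)
square-nonZero q odd = >-nonZero (*-mono-≤ (odd⇒>0 q odd) (odd⇒>0 q odd))

φ-≤-product : ∀ E → φ E ≤ product E
φ-≤-product []      = ≤-refl
φ-≤-product (r ∷ E) = *-mono-≤ (m∸n≤m r 1) (φ-≤-product E)

*-∑ₗ-scale : ∀ QL K f M p σ → ∑ₗ QL (λ q → q * q * (blocks K (q * q) * blocks K (q * q) * (f * M) + blocks K (q * q) * p * σ))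
  ≡ f * M * ∑ₗ QL (λ q → q * q * (blocks K (q * q) * blocks K (q * q))) + p * (∑ₗ QL (λ q → q * q * blocks K (q * q)) * σ)
*-∑ₗ-scale []       K f M p σ = sym (trans (cong₂ _+_ (*-zeroʳ (f * M)) (*-zeroʳ p)) refl)
*-∑ₗ-scale (q ∷ QL) K f M p σ = trans (cong (q * q * (k * k * (f * M) + k * p * σ) +_) (*-∑ₗ-scale QL K f M p σ))
  (ring (q * q) k (f * M) p σ _ _)
  where
  k = blocks K (q * q)
  ring : ∀ d k fM p σ A S → d * (k * k * fM + k * p * σ) + (fM * A + p * (S * σ)) ≡ fM * (d * (k * k) + A) + p * ((d * k + S) * σ)
  ring = solve-∀

-- With t the block count of c one has K ≤ c t ≤ r t. This trades K M / r for M t, which no longer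
-- involves the unknown r.
dominated-sum : ∀ {R W} K f M p ρ → R ≼ W → M ≢ 0 → All (λ r → r ∣ M) R → All (0 <_) W →
  ∑ₗ R (λ r → K * K * (f * (M /₀ r)) + K * p * ρ) ≤ f * M * (K * ∑ₗ W (blocks K)) + p * (K * (length W * ρ))
dominated-sum K f M p ρ []  M≢0 _ _ = z≤n
dominated-sum K f M p ρ (_∷_ {r} {c} {R} {W} c≤r R≼W) M≢0 (r∣M ∷ R∣M) (c>0 ∷ W>0) = begin
  (K * K * (f * m) + K * p * ρ) + ∑ₗ R (λ r → K * K * (f * (M /₀ r)) + K * p * ρ)
    ≤⟨ +-mono-≤ (+-monoˡ-≤ (K * p * ρ) one) (dominated-sum K f M p ρ R≼W M≢0 R∣M W>0) ⟩
  (f * M * (K * t) + K * p * ρ) + (f * M * (K * ∑ₗ W (blocks K)) + p * (K * (length W * ρ)))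
    ≡⟨ ring (f * M) K t p ρ (∑ₗ W (blocks K)) (length W) ⟩
  f * M * (K * (t + ∑ₗ W (blocks K))) + p * (K * (suc (length W) * ρ)) ∎
  where
  open ≤-Reasoning
  m = M /₀ r
  t = blocks K c
  one : K * K * (f * m) ≤ f * M * (K * t)
  one = begin
    K * K * (f * m)         ≡⟨ r₁ K f m ⟩
    f * K * (K * m)         ≤⟨ *-monoʳ-≤ (f * K) (*-monoˡ-≤ m (≤-trans (≤d*blocks K c c>0) (*-monoˡ-≤ t c≤r))) ⟩
    f * K * (r * t * m)     ≡⟨ r₂ f K r t m ⟩
    f * (r * m) * (K * t)   ≡⟨ cong (λ z → f * z * (K * t)) (*-/₀ r∣M M≢0) ⟩
    f * M * (K * t)         ∎
    where
    r₁ : ∀ K f m → K * K * (f * m) ≡ f * K * (K * m)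
    r₁ = solve-∀
    r₂ : ∀ f K r t m → f * K * (r * t * m) ≡ f * (r * m) * (K * t)
    r₂ = solve-∀
  ring : ∀ fM K t p ρ s l → (fM * (K * t) + K * p * ρ) + (fM * (K * s) + p * (K * (l * ρ))) ≡ fM * (K * (t + s)) + p * (K * ((1 + l) * ρ))
  ring = solve-∀

module Rest (p : ℕ) (pp : Prime p) (E : List ℕ) (E-prime : All Prime E) (E-coprime : AllPairs Coprime E)
            (E-∣ : All (_∣ p ∸ 1) E) where
  open PrimitiveRoots p pp using (p∸1≢0)

  e f M : ℕ
  e = product E
  f = φ E
  M = (p ∸ 1) /₀ e

  index : e * M ≡ p ∸ 1
  index = *-/₀ (product-∣ E-coprime E-∣) p∸1≢0

  M≢0 : M ≢ 0
  M≢0 z = p∸1≢0 (trans (sym index) (trans (cong (e *_) z) (*-zeroʳ e)))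

  IsRest : ℕ → Set
  IsRest r = Prime r × r ∣ p ∸ 1 × ¬ r ∈ E

  IsRest? : ∀ r → Dec (IsRest r)
  IsRest? r = prime? r ×-dec r ∣? (p ∸ 1) ×-dec ¬? (r ∈? E)

  R : List ℕ
  R = selectFrom IsRest? 0 p

  R-rest : All IsRest R
  R-rest = selectFrom-P IsRest? 0 p

  R-sorted : AllPairs _<_ R
  R-sorted = selectFrom-sorted IsRest? 0 p

  complete : ∀ q → Prime q → q ∣ p ∸ 1 → q ∈ E ⊎ q ∈ R
  complete q qp q∣ with q ∈? E
  ... | yes q∈E = inj₁ q∈E
  ... | no q∉E  = inj₂ (selectFrom-complete IsRest? 0 p q z≤n (≤-<-trans (∣⇒≤ {{≢-nonZero p∸1≢0}} q∣) (∸-monoʳ-< (s≤s z≤n) (>-nonZero⁻¹ p {{prime⇒nonZero pp}}))) (qp , q∣ , q∉E))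

  rest-∣M : ∀ {r} → IsRest r → r ∣ M
  rest-∣M {r} (rp , r∣ , r∉E) with euclidsLemma e M rp (subst (r ∣_) (sym index) r∣)
  ... | inj₁ d = ⊥-elim (r∉E (factorisationHasAllPrimeFactors rp d E-prime))
  ... | inj₂ d = d

  R-ok : All (λ r → (r ∣ M) × (r ≢ 0) × All (Coprime r) E) R
  R-ok = All.map ok R-rest
    where
    ok : ∀ {r} → IsRest r → (r ∣ M) × (r ≢ 0) × All (Coprime r) E
    ok {r} rest@(rp , _ , r∉E) = rest-∣M rest , ≢-nonZero⁻¹ r {{prime⇒nonZero rp}} ,
      All.tabulate {P = Coprime r} (λ {q} q∈E → prime-coprime rp (All.lookup E-prime q∈E) λ { refl → r∉E q∈E })

  R-product-≤ : product R ≤ M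
  R-product-≤ = ∣⇒≤ {{≢-nonZero M≢0}} (product-∣ (sorted-primes-coprime R (All.map proj₁ R-rest) R-sorted) (All.map rest-∣M R-rest))

  module _ (W : List ℕ) (R≼W : R ≼ W) (W>0 : All (0 <_) W) (K : ℕ) (K<p : K < p)
           (σ ρ : ℕ) (σ-bound : f * p ≤ σ * σ + f * (f * M)) (ρ-bound : f * p ≤ ρ * ρ) (2<p : 2 < p)
           (QL QT : List ℕ) (QL-odd : All (λ q → ¬ 2 ∣ q) QL) (QL-< : All (_< p) QL) (QT-odd : All (λ q → ¬ 2 ∣ q) QT)
           (cover : ∀ q → Prime q → q ≢ 2 → q * q ≤ 4 * K → q ∈ QL ⊎ q ∈ QT)
           (T : ℕ) (T-bound : ∑ₗ QT (λ q → blocks K (q * q)) ≤ T) where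

    -- The sieve criterion with the unknown list of remaining primes replaced by a dominating list
    -- W.
    smallRoot-from : f * M * (K * ∑ₗ W (blocks K) + ∑ₗ QL (λ q → q * q * (blocks K (q * q) * blocks K (q * q))))
        + p * (K * (length W * ρ) + ∑ₗ QL (λ q → q * q * blocks K (q * q)) * σ + K * T + K * σ) < f * M * (K * K) →
      Below (4 * K ∸ 3) p → SmallRoot p
    smallRoot-from ineq = SieveConclusion.smallRoot p pp E M E-coprime (All.map prime⇒nonZero E-prime) index R R-ok complete
      K (<⇒≤ K<p) σ σ-bound QL QT ρ ρ-bound (λ d → <⇒≱ 2<p (∣⇒≤ d))
      (All.zipWith low (QL-odd , QL-<)) (All.map tail-ok QT-odd) cover
      (≤-<-trans bound (<-≤-trans ineq (≤-reflexive (*-comm (f * M) (K * K)))))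
      where
      not-∣ : ∀ q → ¬ 2 ∣ q → q < p → ¬ p ∣ q
      not-∣ q odd q<p d = <⇒≱ q<p (∣⇒≤ {{>-nonZero (odd⇒>0 q odd)}} d)
      blocks≤p : ∀ q → blocks K (q * q) ≤ p
      blocks≤p q = ≤-trans (s≤s (quot≤ K (q * q))) K<p
        where
        quot≤ : ∀ m d → m /₀ d ≤ m
        quot≤ m zero    = z≤n
        quot≤ m (suc d) = m/n≤m m (suc d)
      tail-ok : ∀ {q} → ¬ 2 ∣ q → NonZero (q * q) × Coprime (q * q) 2
      tail-ok {q} odd = square-nonZero q odd , λ {d} → square-coprime-2 q odd {d}
      low : ∀ {q} → (¬ 2 ∣ q) × (q < p) → NonZero (q * q) × Coprime (q * q) 2 × ¬ (p ∣ q * q) × blocks K (q * q) ≤ p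
      low {q} (odd , q<p) = square-nonZero q odd , (λ {d} → square-coprime-2 q odd {d}) ,
        (λ d → [ not-∣ q odd q<p , not-∣ q odd q<p ]′ (euclidsLemma q q pp d)) , blocks≤p q
      open ≤-Reasoning
      SA = ∑ₗ QL (λ q → q * q * (blocks K (q * q) * blocks K (q * q)))
      SS = ∑ₗ QL (λ q → q * q * blocks K (q * q))
      t = ∑ₗ W (blocks K)
      ring : ∀ fM K t p w SA Sσ T σ → (fM * (K * t) + p * (K * w)) + ((fM * SA + p * Sσ) + p * (K * T)) + K * p * σ
                                    ≡ fM * (K * t + SA) + p * (K * w + Sσ + K * T + K * σ)
      ring = solve-∀
      bound : ∑ₗ R (λ r → K * K * (f * (M /₀ r)) + K * p * ρ)
            + (∑ₗ QL (λ q → q * q * (blocks K (q * q) * blocks K (q * q) * (f * M) + blocks K (q * q) * p * σ))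
              + p * ∑ₗ QT (λ q → K * blocks K (q * q))) + K * p * σ
            ≤ f * M * (K * t + SA) + p * (K * (length W * ρ) + SS * σ + K * T + K * σ)
      bound = ≤-trans
        (+-monoˡ-≤ (K * p * σ) (+-mono-≤ (dominated-sum K f M p ρ R≼W M≢0 (All.map rest-∣M R-rest) W>0)
          (+-mono-≤ (≤-reflexive (*-∑ₗ-scale QL K f M p σ))
            (*-monoʳ-≤ p (≤-trans (≤-reflexive (sym (*-∑ₗ K QT _))) (*-monoʳ-≤ K T-bound))))))
        (≤-reflexive (ring (f * M) K t p (length W * ρ) SA (SS * σ) T σ))

-- Since M = (p - 1) / e, the claim compares e B p / (p - 1) with f (K² - A). The ratio p / (p - 1)
-- decreases, so the left end P₁ of the interval is the worst case.
accept-numeric : ∀ e f M A B K p P₁ → 0 < e → e * M ≡ p ∸ 1 → 1 ≤ P₁ → P₁ ≤ p →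
  e * B * P₁ + f * (P₁ ∸ 1) * A < f * (P₁ ∸ 1) * (K * K) → f * M * A + p * B < f * M * (K * K)
accept-numeric e f M A B K (suc p′) (suc P′) e>0 eM _ (s≤s P′≤p′) lt = begin-strict
  f * M * A + suc p′ * B      <⟨ +-monoʳ-< (f * M * A) core ⟩
  f * M * A + f * M * X       ≡⟨ *-distribˡ-+ (f * M) A X ⟨
  f * M * (A + X)             ≡⟨ cong (f * M *_) A+X ⟩
  f * M * (K * K)             ∎
  where
  open ≤-Reasoning
  A<K² : A < K * K
  A<K² = *-cancelˡ-< (f * P′) A (K * K) (≤-<-trans (m≤n+m _ (e * B * suc P′)) lt)
  X = K * K ∸ A
  A+X : A + X ≡ K * K
  A+X = m+[n∸m]≡n (<⇒≤ A<K²)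
  lt′ : e * B * suc P′ < f * P′ * X
  lt′ = +-cancelʳ-< (f * P′ * A) _ _ (<-≤-trans lt (≤-reflexive
    (trans (cong (f * P′ *_) (sym A+X)) (trans (*-distribˡ-+ (f * P′) A X) (+-comm (f * P′ * A) _)))))
  ring₁ : ∀ e P p B → e * (1 + P) * ((1 + p) * B) ≡ (1 + p) * (e * B * (1 + P))
  ring₁ = solve-∀
  ring₂ : ∀ p f P X → (1 + p) * (f * P * X) ≡ (P + p * P) * (f * X)
  ring₂ = solve-∀
  ring₃ : ∀ p f P X → (p + p * P) * (f * X) ≡ (1 + P) * p * (f * X)
  ring₃ = solve-∀
  ring₄ : ∀ e M f P X → (1 + P) * (e * M) * (f * X) ≡ e * (1 + P) * (f * M * X)
  ring₄ = solve-∀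
  core : suc p′ * B < f * M * X
  core = *-cancelˡ-< (e * suc P′) _ _ (begin-strict
    e * suc P′ * (suc p′ * B)      ≡⟨ ring₁ e P′ p′ B ⟩
    suc p′ * (e * B * suc P′)      <⟨ *-monoʳ-< (suc p′) lt′ ⟩
    suc p′ * (f * P′ * X)          ≡⟨ ring₂ p′ f P′ X ⟩
    (P′ + p′ * P′) * (f * X)       ≤⟨ *-monoˡ-≤ (f * X) (+-monoˡ-≤ (p′ * P′) P′≤p′) ⟩
    (p′ + p′ * P′) * (f * X)       ≡⟨ ring₃ p′ f P′ X ⟩
    suc P′ * p′ * (f * X)          ≡⟨ cong (λ z → suc P′ * z * (f * X)) eM ⟨
    suc P′ * (e * M) * (f * X)     ≡⟨ ring₄ e M f P′ X ⟩
    e * suc P′ * (f * M * X)       ∎)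

worst-positive : ∀ E X b qs W → worst E X b qs ≡ just W → All (0 <_) qs → All (0 <_) W
worst-positive E X b (q ∷ qs) W eq (q>0 ∷ pos) with elem q E ∨ elem q X
... | true = worst-positive E X b qs W eq pos
... | false with b <ᵇ q
worst-positive E X b (q ∷ qs) .[] refl (q>0 ∷ pos) | false | true = []
... | false with worst E X (b /₀ q) qs in eW
worst-positive E X b (q ∷ qs) _ refl (q>0 ∷ pos) | false | false | just W′ = q>0 ∷ worst-positive E X (b /₀ q) qs W′ eW pos

scan-sound : ∀ X e c m → scan X e c m ≡ true → ∀ i → i < c → check X (m + e * i) ≡ true
scan-sound X e (suc c) m eq zero    _ =
  subst (λ n → check X n ≡ true) (sym (trans (cong (m +_) (*-zeroʳ e)) (+-identityʳ m))) (proj₁ (∧-true eq))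
scan-sound X e (suc c) m eq (suc i) (s≤s i<c) =
  subst (λ n → check X n ≡ true) (ring e m i) (scan-sound X e c (e + m) (proj₂ (∧-true {check X m} eq)) i i<c)
  where
  ring : ∀ e m i → e + m + e * i ≡ m + e * (1 + i)
  ring = solve-∀

check-sound-at : ∀ X p → Prime p → 2 < p → All (λ x → ¬ x ∣ p ∸ 1) X → check X (p ∸ 1) ≡ true → SmallRoot p
check-sound-at X (suc m) pp = check-sound X m pp

Below-mono : ∀ {g n p} → n ≤ p → Below g n → Below g p
Below-mono {g} {n} {p} n≤p (below lt) = below (mono 25 22 lt)
  where
  mono : ∀ a b → g ^ a < n ^ b → g ^ a < p ^ b
  mono a b lt = <-≤-trans lt (^-monoˡ-≤ b n≤p)

/₀-monoˡ-≤ : ∀ d {m n} → m ≤ n → m /₀ d ≤ n /₀ d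
/₀-monoˡ-≤ zero    _   = z≤n
/₀-monoˡ-≤ (suc d) m≤n = /-monoˡ-≤ (suc d) m≤n

module RangeSound (L a₀ : ℕ) (L≡ : L ≡ suc (2 * a₀)) (a₀>0 : 0 < a₀) (table : List ℕ) (sorted : AllPairs _<_ (2 ∷ table)) (bounded : All (_< L) (2 ∷ table))
                  (odd : All (λ q → ¬ 2 ∣ q) table) (table-complete : ∀ r → Prime r → r ∈ 2 ∷ table ⊎ L ≤ r)
                  (bits P₁ P₂ K z : ℕ) (2<L : 2 < L) (L<P₁ : L < P₁) (K<P₁ : K < P₁) (size : Below (4 * K ∸ 3) P₁)
                  (z-bound : 4 * K < (L + 2 * z) * (L + 2 * z))
                  (p : ℕ) (pp : Prime p) (P₁≤p : P₁ ≤ p) (p<P₂ : p < P₂) where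

  tail : ℕ
  tail = ∑ₗ table (λ q → blocks K (q * q)) + (K /₀ (4 * a₀) + z)

  open Range table bits P₁ P₂ K tail

  private
    c₀ = K /₀ (4 * a₀) + z
    aT bT kT : ℕ → ℕ
    aT q = q * q * (blocks K (q * q) * blocks K (q * q))
    bT q = q * q * blocks K (q * q)
    kT q = blocks K (q * q)
    2<p : 2 < p
    2<p = <-trans 2<L (<-≤-trans L<P₁ P₁≤p)

  -- The state of `walk`: QL has been moved to the estimate, qs still has the trivial bound.
  Split : List ℕ → List ℕ → Set
  Split QL qs = All (λ q → ¬ 2 ∣ q × q < L) QL × All (λ q → ¬ 2 ∣ q × q < L) qs × (∀ q → q ∈ table → q ∈ QL ⊎ q ∈ qs)

  module _ (e f σ ρ t s : ℕ) where
    walk-sound : ∀ c qs QL → Split QL qs →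
      walk c qs e f σ ρ t s (∑ₗ QL aT) (∑ₗ QL bT) (∑ₗ qs kT + c₀) ≡ true →
      ∃[ QL ] ∃[ qs ] (Split QL qs × accept e f σ ρ t s (∑ₗ QL aT) (∑ₗ QL bT) (∑ₗ qs kT + c₀) ≡ true)
    walk-sound (suc c) []       QL split eq = QL , [] , split , eq
    walk-sound (suc c) (q ∷ qs) QL split@(oL , oq ∷ oqs , cov) eq
      with ∨-true {accept e f σ ρ t s (∑ₗ QL aT) (∑ₗ QL bT) (∑ₗ (q ∷ qs) kT + c₀)} eq
    ... | inj₁ acc  = QL , q ∷ qs , split , acc
    ... | inj₂ rest = walk-sound c qs (q ∷ QL) (oq ∷ oL , oqs , cov′)
      (subst (λ T → walk c qs e f σ ρ t s (aT q + ∑ₗ QL aT) (bT q + ∑ₗ QL bT) T ≡ true) T≡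
        (subst₂ (λ A S → walk c qs e f σ ρ t s A S (∑ₗ (q ∷ qs) kT + c₀ ∸ kT q) ≡ true) (+-comm (∑ₗ QL aT) (aT q)) (+-comm (∑ₗ QL bT) (bT q)) rest))
      where
      T≡ : ∑ₗ (q ∷ qs) kT + c₀ ∸ kT q ≡ ∑ₗ qs kT + c₀
      T≡ = trans (cong (_∸ kT q) (+-assoc (kT q) (∑ₗ qs kT) c₀)) (m+n∸m≡n (kT q) _)
      cov′ : ∀ r → r ∈ table → r ∈ q ∷ QL ⊎ r ∈ qs
      cov′ r r∈ with cov r r∈
      ... | inj₁ i         = inj₁ (there i)
      ... | inj₂ (here e)  = inj₁ (here e)
      ... | inj₂ (there i) = inj₂ i

  split₀ : Split [] table
  split₀ = [] , All.zip (odd , All.tail bounded) , λ q → inj₂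

  cover : ∀ QL qs → Split QL qs → ∀ q → Prime q → q ≢ 2 → q * q ≤ 4 * K → q ∈ QL ⊎ q ∈ qs ++ odds a₀ z
  cover QL qs (_ , _ , cov) q qp q≢2 q²≤ with table-complete q qp
  ... | inj₁ (here e)  = ⊥-elim (q≢2 e)
  ... | inj₁ (there i) = [ inj₁ , inj₂ ∘ ∈-++⁺ˡ ]′ (cov q i)
  ... | inj₂ L≤q    = inj₂ (∈-++⁺ʳ qs (subst (_∈ odds a₀ z) (sym q≡) (odds-complete a₀ z b b≥ b<)))
    where
    ¬2∣q : ¬ 2 ∣ q
    ¬2∣q d with prime⇒irreducible qp d
    ... | inj₂ e = q≢2 (sym e)
    b = q / 2
    q≡ : q ≡ suc (2 * b)
    q≡ = odd-half q ¬2∣q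
    b≥ : a₀ ≤ b
    b≥ = *-cancelˡ-≤ 2 (≤-pred (subst₂ _≤_ L≡ q≡ L≤q))
    q< : q < L + 2 * z
    q< = ≰⇒> λ le → <⇒≱ z-bound (≤-trans (*-mono-≤ le le) q²≤)
    b< : b < a₀ + z
    b< = *-cancelˡ-< 2 b (a₀ + z) (subst (2 * b <_) (sym (*-distribˡ-+ 2 a₀ z)) (≤-pred (subst₂ (λ x y → x < y + 2 * z) q≡ L≡ q<)))

  module _ (E X : List ℕ) (E-prime : All Prime E) (E-coprime : AllPairs Coprime E)
           (E-∣ : All (_∣ p ∸ 1) E) (¬X : All (λ x → ¬ x ∣ p ∸ 1) X) where
    open Rest p pp E E-prime E-coprime E-∣

    private
      e>0 : 0 < e
      e>0 = productOfPrimes≥1 E-prime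

    crit-with-sound : ∀ σ ρ W → worst E X (P₂ /₀ e) (2 ∷ table) ≡ just W → crit-with e f σ ρ (just W) ≡ true → SmallRoot p
    crit-with-sound σ ρ W eW eq = conclude (walk-sound e f σ ρ (∑ₗ W (blocks K)) (length W) 11 table [] split₀ walked)
      where
      pos : All (0 <_) (2 ∷ table)
      pos = s≤s z≤n ∷ All.map (λ {q} → odd⇒>0 q) odd
      σ-check = ≤ᵇ-true (f * (e ∸ f) * P₂ + f * f) (e * (σ * σ)) (proj₁ (∧-true eq))
      rest = proj₂ (∧-true {f * (e ∸ f) * P₂ + f * f ≤ᵇ e * (σ * σ)} eq)
      ρ-check = ≤ᵇ-true (f * P₂) (ρ * ρ) (proj₁ (∧-true rest))
      walked = proj₂ (∧-true {f * P₂ ≤ᵇ ρ * ρ} rest)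
      ρ-bound : f * p ≤ ρ * ρ
      ρ-bound = ≤-trans (*-monoʳ-≤ f (<⇒≤ p<P₂)) ρ-check
      p≡ : p ≡ suc (e * M)
      p≡ = trans (sym (m+[n∸m]≡n {1} {p} (<⇒≤ (<-trans (s≤s (s≤s z≤n)) 2<p)))) (cong suc (sym index))
      σ-bound : f * p ≤ σ * σ + f * (f * M)
      σ-bound = *-cancelˡ-≤ e {{>-nonZero e>0}} (begin
        e * (f * p)                                  ≡⟨ cong (λ z → z * (f * p)) (m∸n+n≡m (φ-≤-product E)) ⟨
        (e ∸ f + f) * (f * p)                        ≡⟨ r₁ (e ∸ f) f p ⟩
        f * (e ∸ f) * p + f * f * p                  ≡⟨ cong (λ z → f * (e ∸ f) * p + f * f * z) p≡ ⟩
        f * (e ∸ f) * p + f * f * suc (e * M)        ≡⟨ r₂ (f * (e ∸ f) * p) f e M ⟩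
        f * (e ∸ f) * p + f * f + e * (f * (f * M))  ≤⟨ +-monoˡ-≤ _ (≤-trans (+-monoˡ-≤ (f * f) (*-monoʳ-≤ (f * (e ∸ f)) (<⇒≤ p<P₂))) σ-check) ⟩
        e * (σ * σ) + e * (f * (f * M))              ≡⟨ *-distribˡ-+ e _ _ ⟨
        e * (σ * σ + f * (f * M))                    ∎)
        where
        open ≤-Reasoning
        r₁ : ∀ d f p → (d + f) * (f * p) ≡ f * d * p + f * f * p
        r₁ = solve-∀
        r₂ : ∀ x f e M → x + f * f * (1 + e * M) ≡ x + f * f + e * (f * (f * M))
        r₂ = solve-∀
      Π≤ : product R ≤ P₂ /₀ e
      Π≤ = ≤-trans R-product-≤ (/₀-greatest e>0 (≤-trans (≤-reflexive index) (≤-trans (m∸n≤m p 1) (<⇒≤ p<P₂))))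
      mem : ∀ {r} → IsRest r → ¬ r ∈ E × ¬ r ∈ X × (r ∈ 2 ∷ table ⊎ L ≤ r)
      mem {r} (rp , r∣ , r∉E) = r∉E , (λ r∈X → All.lookup ¬X r∈X r∣) , table-complete r rp
      R≼W : R ≼ W
      R≼W = worst-dominates E X (P₂ /₀ e) (2 ∷ table) W R eW sorted bounded pos R-sorted (All.map proj₁ R-rest) (All.map mem R-rest) Π≤
      conclude : ∃[ QL ] ∃[ qs ] (Split QL qs × accept e f σ ρ (∑ₗ W (blocks K)) (length W) (∑ₗ QL aT) (∑ₗ QL bT) (∑ₗ qs kT + c₀) ≡ true) → SmallRoot p
      conclude (QL , qs , split@(oL , oq , _) , acc) = smallRoot-from W R≼W (worst-positive E X _ _ W eW pos) K (<-≤-trans K<P₁ P₁≤p) σ ρ σ-bound ρ-bound 2<p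
        QL (qs ++ odds a₀ z) (All.map proj₁ oL) (All.map (λ (_ , q<) → <-≤-trans q< (≤-trans (<⇒≤ L<P₁) P₁≤p)) oL)
        (++⁺ (All.map proj₁ oq) (odds-odd a₀ z)) (cover QL qs split) (∑ₗ qs kT + c₀)
        (≤-trans (≤-reflexive (∑ₗ-++ qs (odds a₀ z) kT)) (+-monoʳ-≤ (∑ₗ qs kT) (odds-blocks K a₀ z a₀>0)))
        (accept-numeric e f M _ _ K p P₁ e>0 index (≤-trans (s≤s z≤n) L<P₁) P₁≤p (<ᵇ-true _ _ acc))
        (Below-mono P₁≤p size)

    crit-sound : crit E X ≡ true → SmallRoot p
    crit-sound eq = go (worst E X (P₂ /₀ e) (2 ∷ table)) refl eq
      where
      σ = ceilSqrt bits (suc ((f * (e ∸ f) * P₂ + f * f) /₀ e))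
      ρ = ceilSqrt bits (f * P₂)
      go : ∀ w → worst E X (P₂ /₀ e) (2 ∷ table) ≡ w → crit-with e f σ ρ w ≡ true → SmallRoot p
      go (just W) eW = crit-with-sound σ ρ W eW

  passes-sound : ∀ E X → All Prime E → AllPairs Coprime E → All (_∣ p ∸ 1) E → All (λ x → ¬ x ∣ p ∸ 1) X →
                 passes E X ≡ true → SmallRoot p
  passes-sound (l ∷ E) X (lp ∷ Ep) (lc ∷ Ec) (l∣ ∷ E∣) ¬X eq with ∨-true {passes E X} eq
  ... | inj₁ eq′ = passes-sound E X Ep Ec E∣ ¬X eq′
  ... | inj₂ eq′ = crit-sound (l ∷ E) X (lp ∷ Ep) (lc ∷ Ec) (l∣ ∷ E∣) ¬X (proj₂ (∧-true {length E ≤ᵇ 3} eq′))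

  scanClass-sound : ∀ X e → e ∣ p ∸ 1 → All (λ x → ¬ x ∣ p ∸ 1) X → scanClass X e ≡ true → SmallRoot p
  scanClass-sound X e e∣ ¬X eq = check-sound-at X p pp 2<p ¬X
    (subst (λ m → check X m ≡ true) m≡ (scan-sound X e _ _ eq i (s≤s (∸-monoˡ-≤ a (/₀-monoˡ-≤ e (≤-trans (m∸n≤m p 1) (<⇒≤ p<P₂)))))))
    where
    a = (P₁ ∸ 1) /₀ e
    b = (p ∸ 1) /₀ e
    i = b ∸ a
    p∸1≢0 : p ∸ 1 ≢ 0
    p∸1≢0 z = <⇒≢ (m<n⇒0<n∸m (<-trans (s≤s (s≤s z≤n)) 2<p)) (sym z)
    m≡ : e * a + e * i ≡ p ∸ 1
    m≡ = trans (sym (*-distribˡ-+ e a i)) (trans (cong (e *_) (m+[n∸m]≡n (/₀-monoˡ-≤ e (∸-monoˡ-≤ 1 P₁≤p)))) (*-/₀ e∣ p∸1≢0))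

  choose-sound : ∀ x y w → proj₂ (choose x y w) ≡ true → (proj₂ x ≡ true × proj₂ y ≡ true) ⊎ proj₂ w ≡ true
  choose-sound (a , u) (b , v) (c , w) eq with a + b <ᵇ c
  ... | true  = inj₁ (∧-true eq)
  ... | false = inj₂ eq

  -- A leaf is either an accepted criterion or a scan of the whole class of p with e ∣ p - 1; the
  -- two children of a node cover l ∣ p - 1 and its negation.
  solve-sound : ∀ ls E X e → e ≡ product E → All Prime ls → AllPairs Coprime ls → All (λ l → All (Coprime l) E) ls →
    All Prime E → AllPairs Coprime E → All (_∣ p ∸ 1) E → All (λ x → ¬ x ∣ p ∸ 1) X →
    proj₂ (solve ls E X e) ≡ true → SmallRoot p
  branch-sound : ∀ ls E X e b → e ≡ product E → All Prime ls → AllPairs Coprime ls → All (λ l → All (Coprime l) E) ls →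
    All Prime E → AllPairs Coprime E → All (_∣ p ∸ 1) E → All (λ x → ¬ x ∣ p ∸ 1) X →
    proj₂ (branch ls E X e b) ≡ true → SmallRoot p
  solve-sound ls E X e e≡ lp lc lE Ep Ec E∣ ¬X eq with passes E X in pass
  ... | true  = passes-sound E X Ep Ec E∣ ¬X pass
  ... | false = branch-sound ls E X e (passes E (ls ++ X)) e≡ lp lc lE Ep Ec E∣ ¬X eq
  branch-sound []       E X e b e≡ lp lc lE Ep Ec E∣ ¬X eq = scanClass-sound X e (subst (_∣ p ∸ 1) (sym e≡) (product-∣ Ec E∣)) ¬X eq
  branch-sound (l ∷ ls) E X e false e≡ lp lc lE Ep Ec E∣ ¬X eq = scanClass-sound X e (subst (_∣ p ∸ 1) (sym e≡) (product-∣ Ec E∣)) ¬X eq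
  branch-sound (l ∷ ls) E X e true e≡ (lp ∷ lsp) (lc ∷ lsc) (lE ∷ lsE) Ep Ec E∣ ¬X eq
    with choose-sound (solve ls (l ∷ E) X (l * e)) (solve ls E (l ∷ X) e) (30 + (P₂ ∸ P₁) /₀ e , scanClass X e) eq
  ... | inj₂ sc = scanClass-sound X e (subst (_∣ p ∸ 1) (sym e≡) (product-∣ Ec E∣)) ¬X sc
  ... | inj₁ (yesl , nol) with l ∣? (p ∸ 1)
  ...   | yes l∣ = solve-sound ls (l ∷ E) X (l * e) (cong (l *_) e≡) lsp lsc (All.zipWith join (lc , lsE)) (lp ∷ Ep) (lE ∷ Ec) (l∣ ∷ E∣) ¬X yesl
    where
    join : ∀ {m} → Coprime l m × All (Coprime m) E → All (Coprime m) (l ∷ E)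
    join (c , cs) = Cop.sym c ∷ cs
  ...   | no ¬l∣ = solve-sound ls E (l ∷ X) e e≡ lsp lsc lsE Ep Ec E∣ (¬l∣ ∷ ¬X) nol

module IntervalSound (L a₀ end : ℕ) (L≡ : L ≡ suc (2 * a₀)) (a₀>0 : 0 < a₀) (2<L : 2 < L) (table ls : List ℕ)
                     (sorted : AllPairs _<_ (2 ∷ table)) (bounded : All (_< L) (2 ∷ table))
                     (odd : All (λ q → ¬ 2 ∣ q) table) (table-complete : ∀ r → Prime r → r ∈ 2 ∷ table ⊎ L ≤ r)
                     (ls-prime : All Prime ls) (ls-coprime : AllPairs Coprime ls) (ls-2 : All (λ l → All (Coprime l) (2 ∷ [])) ls) where
  open Interval L a₀ end table ls

  interval-z-sound : ∀ b P₁ P₂ K z → interval-z b P₁ P₂ K z ≡ true →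
    ∀ p → Prime p → P₁ ≤ p → p < P₂ → SmallRoot p
  interval-z-sound b P₁ P₂ K z eq p pp P₁≤p p<P₂ =
    RangeSound.solve-sound L a₀ L≡ a₀>0 table sorted bounded odd table-complete (b / 2 + 8) P₁ P₂ K z 2<L L<P₁ K<P₁
      (isBelow-true (4 * K ∸ 3) P₁ (proj₁ (∧-true eq₂))) (<ᵇ-true (4 * K) _ (proj₁ (∧-true eq₃))) p pp P₁≤p p<P₂
      ls (2 ∷ []) [] 2 refl ls-prime ls-coprime ls-2 (prime[2] ∷ []) ([] ∷ []) (2∣ ∷ []) []
      (proj₂ (∧-true {4 * K <ᵇ (L + 2 * z) * (L + 2 * z)} eq₃))
    where
    eq₁ = proj₂ (∧-true {L <ᵇ P₁} eq)
    eq₂ = proj₂ (∧-true {K <ᵇ P₁} eq₁)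
    eq₃ = proj₂ (∧-true {isBelow (4 * K ∸ 3) P₁} eq₂)
    L<P₁ : L < P₁
    L<P₁ = <ᵇ-true L P₁ (proj₁ (∧-true eq))
    K<P₁ : K < P₁
    K<P₁ = <ᵇ-true K P₁ (proj₁ (∧-true eq₁))
    2<p : 2 < p
    2<p = <-trans 2<L (<-≤-trans L<P₁ P₁≤p)
    2∣ : 2 ∣ p ∸ 1
    2∣ = subst (2 ∣_) (sym (cong (_∸ 1) (odd-half p (λ d → [ (λ ()) , (λ e → <⇒≢ 2<p e) ]′ (prime⇒irreducible pp d))))) (m∣m*n (p / 2))

  run-sound : ∀ c P → Interval.run L a₀ end table ls c P ≡ true → ∀ p → Prime p → P ≤ p → p < end → SmallRoot p
  run-sound zero    P eq p pp P≤p p<end = ⊥-elim (<⇒≱ p<end (≤-trans (≤ᵇ-true end P eq) P≤p))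
  run-sound (suc c) P eq p pp P≤p p<end with p <? next P
  ... | yes p<P′ = interval-z-sound (bitLength P (next P)) P (next P) K _ (proj₁ (∧-true eq)) p pp P≤p p<P′
    where
    K = climb (bitLength P (next P)) (λ K → isBelow (4 * K ∸ 3) P) 0
  ... | no p≮P′  = run-sound c (next P) (proj₂ (∧-true {interval (bitLength P (next P)) P (next P)} eq)) p pp (≮⇒≥ p≮P′) p<end

branchPrimes-prime : All Prime branchPrimes
branchPrimes-prime = from-yes (All.all? prime? branchPrimes)

branchPrimes-coprime : AllPairs Coprime (2 ∷ branchPrimes)
branchPrimes-coprime = sorted-primes-coprime (2 ∷ branchPrimes) (prime[2] ∷ branchPrimes-prime) (sorted-sound (2 ∷ branchPrimes) refl)

scan-small : ∀ c → scan [] 2 c 2 ≡ true → ∀ p → Prime p → 2 < p → p < 2 * c + 2 → SmallRoot p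
scan-small c eq p pp 2<p p< = check-sound-at [] p pp 2<p []
  (subst (λ m → check [] m ≡ true) m≡ (scan-sound [] 2 c 2 eq (h ∸ 1) h<))
  where
  odd : ¬ 2 ∣ p
  odd d = [ (λ ()) , <⇒≢ 2<p ]′ (prime⇒irreducible pp d)
  h = p / 2
  p≡ : p ≡ suc (2 * h)
  p≡ = odd-half p odd
  1≤h : 1 ≤ h
  1≤h = *-cancelˡ-≤ 2 (≤-pred (subst (3 ≤_) p≡ 2<p))
  m≡ : 2 + 2 * (h ∸ 1) ≡ p ∸ 1
  m≡ = trans (ring (h ∸ 1)) (trans (cong (2 *_) (m∸n+n≡m 1≤h)) (sym (cong (_∸ 1) p≡)))
    where
    ring : ∀ x → 2 + 2 * x ≡ 2 * (x + 1)
    ring = solve-∀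
  h< : h ∸ 1 < c
  h< = *-cancelˡ-< 2 (h ∸ 1) c (<⇒≤ (≤-trans (≤-reflexive m≡)
    (∸-monoˡ-≤ 1 (≤-pred (≤-trans p< (≤-reflexive (+-comm (2 * c) 2)))))))

-- Large primes

largest : ∀ {P : ℕ → Set} → (∀ n → Dec (P n)) → ∀ a n → P a → ¬ P (a + n) → ∃[ k ] (a ≤ k × P k × ¬ P (suc k))
largest {P} P? a zero    Pa ¬P = ⊥-elim (¬P (subst P (sym (+-identityʳ a)) Pa))
largest {P} P? a (suc n) Pa ¬P with P? (a + n)
... | yes Pn = a + n , m≤m+n a n , Pn , subst (¬_ ∘ P) (+-suc a n) ¬P
... | no ¬Pn = largest P? a n Pa ¬Pn

-- The crude factor 4 comes from (x + 1)² ≤ 4 x² for x ≥ 1, and from N ≥ 1 when x = 0.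
ceilingSqrt : ∀ N → 0 < N → ∃[ ρ ] (N ≤ ρ * ρ × ρ * ρ ≤ 4 * N)
ceilingSqrt N N>0 with largest (λ x → x * x <? N) 0 N N>0 (≤⇒≯ (m≤m*n N N {{>-nonZero N>0}}))
... | x , _ , x²<N , ¬< = suc x , ≮⇒≥ ¬< , bound x x²<N
  where
  ring : ∀ x → (1 + (1 + x)) * (1 + (1 + x)) + (3 * x * x + 4 * x) ≡ 4 * ((1 + x) * (1 + x))
  ring = solve-∀
  bound : ∀ x → x * x < N → suc x * suc x ≤ 4 * N
  bound zero    _    = ≤-trans N>0 (m≤m+n N _)
  bound (suc x) x²<N = ≤-trans (≤-trans (m≤m+n _ _) (≤-reflexive (ring x))) (*-monoʳ-≤ 4 (<⇒≤ x²<N))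

-- K is taken at the edge of the size condition. Its failure at K + 1 gives the lower bound, because
-- 4 (K + 1) - 3 = 4 K + 1.
maximal-K : ∀ p → 1 < p → ∃[ K ] (0 < K × Below (4 * K ∸ 3) p × p ^ 22 ≤ (4 * K + 1) ^ 25)
maximal-K p 1<p with largest {λ K → Below (4 * K ∸ 3) p} Below? 1 p base stop
  where
  Below? : ∀ K → Dec (Below (4 * K ∸ 3) p)
  Below? K with (4 * K ∸ 3) ^ 25 <? p ^ 22
  ... | yes lt = yes (below lt)
  ... | no ¬lt = no λ b → ¬lt (Below.power-< b)
  base : Below 1 p
  base = below (one 22 (s≤s z≤n))
    where
    one : ∀ b → 0 < b → 1 < p ^ b
    one (suc b) _ = <-≤-trans 1<p (m≤m*n p (p ^ b) {{m^n≢0 p b {{>-nonZero (<-trans (s≤s z≤n) 1<p)}}}})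
  stop : ¬ Below (4 * (1 + p) ∸ 3) p
  stop b = <⇒≱ (Below⇒< (>-nonZero (≤-trans (<-trans (s≤s z≤n) 1<p) big)) b) big
    where
    big : p ≤ 4 * (1 + p) ∸ 3
    big = ≤-trans (m≤n+m p 1) (≤-trans (m≤m+n (1 + p) (3 * p)) (≤-reflexive (sym (cong (_∸ 3) (ring p)))))
      where
      ring : ∀ p → 4 * (1 + p) ≡ 3 + (1 + p + 3 * p)
      ring = solve-∀
... | K , K>0 , bel , ¬bel = K , K>0 , bel , next K ¬bel
  where
  next : ∀ K → ¬ Below (4 * suc K ∸ 3) p → p ^ 22 ≤ (4 * K + 1) ^ 25
  next K ¬b = gen (4 * suc K ∸ 3) (4 * K + 1) (cong (_∸ 3) (ring K)) ¬b
    where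
    ring : ∀ K → 4 * (1 + K) ≡ 3 + (4 * K + 1)
    ring = solve-∀
    gen : ∀ a b → a ≡ b → ¬ Below a p → p ^ 22 ≤ b ^ 25
    gen a .a refl ¬b = ≮⇒≥ (λ lt → ¬b (below lt))

-- Raised to common exponents the hypotheses read p^88 ≤ Z^100 ≤ X^100 p^75, and 88 - 75 = 13.
power-compare : ∀ p Z X → 0 < p → p ^ 22 ≤ Z ^ 25 → Z ^ 4 ≤ X ^ 4 * p ^ 3 → p ^ 13 ≤ X ^ 100
power-compare p Z X p>0 h₁ h₂ = *-cancelʳ-≤ (p ^ 13) (X ^ 100) (p ^ 75) {{m^n≢0 p 75 {{>-nonZero p>0}}}} (begin
  p ^ 13 * p ^ 75        ≡⟨ trans (sym (^-distribˡ-+-* p 13 75)) (sym (^-*-assoc p 22 4)) ⟩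
  (p ^ 22) ^ 4           ≤⟨ ^-monoˡ-≤ 4 h₁ ⟩
  (Z ^ 25) ^ 4           ≡⟨ trans (^-*-assoc Z 25 4) (sym (^-*-assoc Z 4 25)) ⟩
  (Z ^ 4) ^ 25           ≤⟨ ^-monoˡ-≤ 25 h₂ ⟩
  (X ^ 4 * p ^ 3) ^ 25   ≡⟨ trans (^-distribʳ-* 25 (X ^ 4) (p ^ 3)) (cong₂ _*_ (^-*-assoc X 4 25) (^-*-assoc p 3 25)) ⟩
  X ^ 100 * p ^ 75       ∎)
  where open ≤-Reasoning

-- With ρ² ≤ 4 f p and f² ≤ p we have ρ⁴ ≤ 16 p³, so a K below c m² ρ would make p¹³ ≤ (8 c m²)¹⁰⁰.
K-lower-bound : ∀ c p f m ρ K → 0 < p → f * f ≤ p → ρ * ρ ≤ 4 * (f * p) → p ^ 22 ≤ (4 * K + 1) ^ 25 →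
                (8 * (c * (m * m))) ^ 100 < p ^ 13 → c * (m * m * ρ) ≤ K
K-lower-bound c p f m ρ K p>0 f²≤p ρ²≤ max big with c * (m * m * ρ) ≤? K
... | yes le = le
... | no  gt = ⊥-elim (<⇒≱ big (power-compare p Z (8 * (c * (m * m))) p>0 (≤-trans max (^-monoˡ-≤ 25 4K+1≤)) Z⁴≤))
  where
  open ≤-Reasoning
  Z = 4 * (c * (m * m * ρ))
  4K+1≤ : 4 * K + 1 ≤ Z
  4K+1≤ = ≤-trans (+-monoʳ-≤ (4 * K) (s≤s (z≤n {3}))) (≤-trans (≤-reflexive (trans (+-comm (4 * K) 4) (sym (*-suc 4 K)))) (*-monoʳ-≤ 4 (≰⇒> gt)))
  r₁ : ∀ c m ρ → let Z = 4 * (c * (m * m * ρ)) in Z * (Z * (Z * (Z * 1))) ≡ 256 * (c * (m * m) * (c * (m * m)) * (c * (m * m) * (c * (m * m)))) * (ρ * ρ * (ρ * ρ))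
  r₁ = solve-∀
  r₂ : ∀ w f p → 256 * w * (4 * (f * p) * (4 * (f * p))) ≡ 256 * 16 * w * (p * p * (f * f))
  r₂ = solve-∀
  r₃ : ∀ c m p → 256 * 16 * (c * (m * m) * (c * (m * m)) * (c * (m * m) * (c * (m * m)))) * (p * p * p)
       ≡ let X = 8 * (c * (m * m)) in X * (X * (X * (X * 1))) * (p * (p * (p * 1)))
  r₃ = solve-∀
  w = c * (m * m) * (c * (m * m)) * (c * (m * m) * (c * (m * m)))
  Z⁴≤ : Z ^ 4 ≤ (8 * (c * (m * m))) ^ 4 * p ^ 3
  Z⁴≤ = begin
    Z ^ 4                                           ≡⟨ r₁ c m ρ ⟩
    256 * w * (ρ * ρ * (ρ * ρ))                     ≤⟨ *-monoʳ-≤ (256 * w) (*-mono-≤ ρ²≤ ρ²≤) ⟩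
    256 * w * (4 * (f * p) * (4 * (f * p)))         ≡⟨ r₂ w f p ⟩
    256 * 16 * w * (p * p * (f * f))                ≤⟨ *-monoʳ-≤ (256 * 16 * w) (*-monoʳ-≤ (p * p) f²≤p) ⟩
    256 * 16 * w * (p * p * p)                      ≡⟨ r₃ c m p ⟩
    (8 * (c * (m * m))) ^ 4 * p ^ 3                 ∎

-- For m ≥ 9 one has (m + 1)² ≤ (5/4) m², and (5/4)⁴ = 625/256 is less than 3.
three-power-dominates : ∀ c a → 9 ≤ a → ∀ b → (c * (a * a)) ^ 4 ≤ 3 ^ b → ∀ d → (c * ((a + d) * (a + d))) ^ 4 ≤ 3 ^ (b + d)
three-power-dominates c a 9≤a b base zero    = subst₂ (λ x y → (c * (x * x)) ^ 4 ≤ 3 ^ y) (sym (+-identityʳ a)) (sym (+-identityʳ b)) base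
three-power-dominates c a 9≤a b base (suc d) = subst₂ (λ x y → (c * (x * x)) ^ 4 ≤ 3 ^ y) (sym (+-suc a d)) (sym (+-suc b d))
  (step (a + d) (≤-trans 9≤a (m≤m+n a d)) (three-power-dominates c a 9≤a b base d))
  where
  step : ∀ m → 9 ≤ m → (c * (m * m)) ^ 4 ≤ 3 ^ (b + d) → (c * (suc m * suc m)) ^ 4 ≤ 3 * 3 ^ (b + d)
  step m 9≤m ih = *-cancelˡ-≤ 256 (begin
    256 * v ^ 4                     ≡⟨ r₁ v ⟩
    (4 * v) ^ 4                     ≤⟨ ^-monoˡ-≤ 4 4v≤5u ⟩
    (5 * u) ^ 4                     ≡⟨ r₂ u ⟩
    625 * u ^ 4                     ≤⟨ *-monoˡ-≤ (u ^ 4) (≤ᵇ⇒≤ 625 768 tt) ⟩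
    768 * u ^ 4                     ≤⟨ *-monoʳ-≤ 768 ih ⟩
    768 * 3 ^ (b + d)               ≡⟨ *-assoc 256 3 (3 ^ (b + d)) ⟩
    256 * (3 * 3 ^ (b + d))         ∎)
    where
    open ≤-Reasoning
    u = c * (m * m)
    v = c * (suc m * suc m)
    r₁ : ∀ v → 256 * (v * (v * (v * (v * 1)))) ≡ 4 * v * (4 * v * (4 * v * (4 * v * 1)))
    r₁ = solve-∀
    r₂ : ∀ u → 5 * u * (5 * u * (5 * u * (5 * u * 1))) ≡ 625 * (u * (u * (u * (u * 1))))
    r₂ = solve-∀
    r₃ : ∀ c x → 4 * (c * ((10 + x) * (10 + x))) + c * (5 + 10 * x + x * x) ≡ 5 * (c * ((9 + x) * (9 + x)))
    r₃ = solve-∀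
    4v≤5u : 4 * v ≤ 5 * u
    4v≤5u = subst (λ m → 4 * (c * (suc m * suc m)) ≤ 5 * (c * (m * m))) (m+[n∸m]≡n 9≤m)
      (≤-trans (m≤m+n _ _) (≤-reflexive (r₃ c (m ∸ 9))))

-- In eighths of F K²: the remaining primes take four, the squares of the small q two, those of the
-- large q one. The last eighth must exceed the lower order terms; there 144 m² ρ = 16 m · 9 m ρ
-- collects fewer than 9 m discrepancies and the roundings of the tail.
large-numeric : ∀ F K p m ρ t A S y s j → p ≤ 2 * (F * m) → 2 * t ≤ K + 2 * m → 4 * A ≤ K * K + 12 * (j * K) →
  S ≤ 2 * (j * K) → 16 * m * y ≤ K → suc s ≡ m → suc j ≡ 4 * m → 0 < K → 0 < F → 104 * m + 144 * (m * m * ρ) < K →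
  F * (K * t + A) + p * (K * (s * ρ) + S * ρ + K * (y + ρ) + K * ρ) < F * (K * K)
large-numeric F K p m ρ t A S y s j p≤ t≤ A≤ S≤ y≤ refl j≡ K>0 F>0 big = *-cancelˡ-< 8 _ _ (begin-strict
  8 * (F * (K * t + A) + p * (K * (s * ρ) + S * ρ + K * (y + ρ) + K * ρ))
    ≡⟨ r₁ F K t A (p * (K * (s * ρ) + S * ρ + K * (y + ρ) + K * ρ)) ⟩
  (4 * (F * K) * (2 * t) + 2 * F * (4 * A)) + 8 * (p * (K * (s * ρ) + S * ρ + K * (y + ρ) + K * ρ))
    ≤⟨ +-mono-≤ (+-mono-≤ (*-monoʳ-≤ (4 * (F * K)) t≤) (*-monoʳ-≤ (2 * F) A≤))
         (*-monoʳ-≤ 8 (*-mono-≤ p≤ (+-monoˡ-≤ (K * ρ) (+-monoˡ-≤ (K * (y + ρ)) (+-monoʳ-≤ (K * (s * ρ)) (*-monoˡ-≤ ρ S≤)))))) ⟩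
  (4 * (F * K) * (K + 2 * m) + 2 * F * (K * K + 12 * (j * K))) + 8 * (2 * (F * m) * (K * (s * ρ) + 2 * (j * K) * ρ + K * (y + ρ) + K * ρ))
    ≡⟨ r₂ F K m j s ρ y ⟩
  F * K * (6 * K + 8 * m + 24 * j + 16 * m * ((s + 2 * j + 2) * ρ) + 16 * m * y)
    ≤⟨ *-monoʳ-≤ (F * K) (+-mono-≤ (+-mono-≤ (+-monoʳ-≤ (6 * K + 8 * m) (*-monoʳ-≤ 24 j≤)) (*-monoʳ-≤ (16 * m) (*-monoˡ-≤ ρ sum≤))) y≤) ⟩
  F * K * (6 * K + 8 * m + 24 * (4 * m) + 16 * m * (9 * m * ρ) + K)
    ≡⟨ cong (F * K *_) (r₃ K m ρ) ⟩
  F * K * (7 * K + (104 * m + 144 * (m * m * ρ)))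
    <⟨ *-monoʳ-< (F * K) {{>-nonZero (*-mono-≤ F>0 K>0)}} (+-monoʳ-< (7 * K) big) ⟩
  F * K * (7 * K + K)
    ≡⟨ r₄ F K ⟩
  8 * (F * (K * K)) ∎)
  where
  open ≤-Reasoning
  j≤ : j ≤ 4 * m
  j≤ = ≤-trans (n≤1+n j) (≤-reflexive j≡)
  sum≤ : s + 2 * j + 2 ≤ 9 * m
  sum≤ = ≤-trans (≤-trans (n≤1+n _) (≤-reflexive (ring s j))) (≤-reflexive (trans (cong (λ z → suc s + 2 * z) j≡) (ring′ s)))
    where
    ring : ∀ s j → 1 + (s + 2 * j + 2) ≡ 1 + s + 2 * (1 + j)
    ring = solve-∀
    ring′ : ∀ s → 1 + s + 2 * (4 * (1 + s)) ≡ 9 * (1 + s)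
    ring′ = solve-∀
  r₁ : ∀ F K t A B → 8 * (F * (K * t + A) + B) ≡ (4 * (F * K) * (2 * t) + 2 * F * (4 * A)) + 8 * B
  r₁ = solve-∀
  r₂ : ∀ F K m j s ρ y → (4 * (F * K) * (K + 2 * m) + 2 * F * (K * K + 12 * (j * K))) + 8 * (2 * (F * m) * (K * (s * ρ) + 2 * (j * K) * ρ + K * (y + ρ) + K * ρ))
     ≡ F * K * (6 * K + 8 * m + 24 * j + 16 * m * ((s + 2 * j + 2) * ρ) + 16 * m * y)
  r₂ = solve-∀
  r₃ : ∀ K m ρ → 6 * K + 8 * m + 24 * (4 * m) + 16 * m * (9 * m * ρ) + K ≡ 7 * K + (104 * m + 144 * (m * m * ρ))
  r₃ = solve-∀
  r₄ : ∀ F K → F * K * (7 * K + K) ≡ 8 * (F * (K * K))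
  r₄ = solve-∀

sorted-head-≤ : ∀ {r d D} → All (d <_) D → r ∈ d ∷ D → d ≤ r
sorted-head-≤ d< (here e)  = ≤-reflexive (sym e)
sorted-head-≤ d< (there j) = <⇒≤ (All.lookup d< j)

subset-dominated : ∀ R D → AllPairs _<_ R → AllPairs _<_ D → All (_∈ D) R → R ≼ D
subset-dominated []      D        _        _        _         = []
subset-dominated (r ∷ R) (d ∷ D) (r< ∷ sR) (d< ∷ sD) (i ∷ is) = d≤r ∷ subset-dominated R D sR sD (All.zipWith later (r< , is))
  where
  d≤r : d ≤ r
  d≤r = sorted-head-≤ d< i
  later : ∀ {s} → (r < s) × (s ∈ d ∷ D) → s ∈ D
  later (r<s , k) = ∈-tail k λ s≡d → <⇒≱ r<s (subst (_≤ r) (sym s≡d) d≤r)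

≼-length : ∀ {R W} → R ≼ W → length R ≤ length W
≼-length []      = z≤n
≼-length (_ ∷ d) = s≤s (≼-length d)

≼-replicate : ∀ {R k L} → length R ≤ k → All (L ≤_) R → R ≼ replicate k L
≼-replicate {[]}                _       _        = []
≼-replicate {r ∷ R} {suc k} (s≤s le) (L≤r ∷ ge) = L≤r ∷ ≼-replicate le ge

∑ₗ-replicate : ∀ k L f → ∑ₗ (replicate k L) f ≡ k * f L
∑ₗ-replicate zero    L f = refl
∑ₗ-replicate (suc k) L f = cong (f L +_) (∑ₗ-replicate k L f)

allPairs-++⁻ : ∀ xs {ys : List ℕ} → AllPairs _<_ (xs ++ ys) → AllPairs _<_ xs × AllPairs _<_ ys × All (λ x → All (x <_) ys) xs
allPairs-++⁻ []       ps        = [] , ps , []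
allPairs-++⁻ (x ∷ xs) (x< ∷ ps) with allPairs-++⁻ xs ps
... | sx , sy , sep = ++⁻ˡ xs x< ∷ sx , sy , ++⁻ʳ xs x< ∷ sep

separated-product-≤ : ∀ xs ys → All (λ x → All (x <_) ys) xs → length xs ≤ length ys → All (0 <_) ys → product xs ≤ product ys
separated-product-≤ []       []       _            _        _         = ≤-refl
separated-product-≤ []       (y ∷ ys) _            _        (y>0 ∷ p) = *-mono-≤ y>0 (separated-product-≤ [] ys [] z≤n p)
separated-product-≤ (x ∷ xs) (y ∷ ys) ((x<y ∷ _) ∷ sep) (s≤s le) (_ ∷ p) =
  *-mono-≤ (<⇒≤ x<y) (separated-product-≤ xs ys (All.map All.tail sep) le p)

-- Distinct odd numbers in increasing order grow by at least 2 at each place.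
drop-odd-≥ : ∀ a n xs → AllPairs _<_ xs → All (λ q → ¬ 2 ∣ q) xs → All (suc (2 * a) ≤_) xs → All (suc (2 * (a + n)) ≤_) (drop n xs)
drop-odd-≥ a zero    xs       _        _         ge       = subst (λ z → All (suc (2 * z) ≤_) xs) (sym (+-identityʳ a)) ge
drop-odd-≥ a (suc n) []       _        _         _        = []
drop-odd-≥ a (suc n) (x ∷ xs) (x< ∷ s) (_ ∷ odd) (a≤ ∷ _) =
  subst (λ z → All (suc (2 * z) ≤_) (drop n xs)) (sym (+-suc a n)) (drop-odd-≥ (suc a) n xs s odd (All.zipWith next (x< , odd)))
  where
  next : ∀ {y} → (x < y) × ¬ 2 ∣ y → suc (2 * suc a) ≤ y
  next {y} (x<y , y-odd) = subst (suc (2 * suc a) ≤_) (sym (odd-half y y-odd)) (s≤s (*-monoʳ-≤ 2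
    (*-cancelˡ-< 2 a (y / 2) (≤-pred (subst (suc (2 * a) <_) (odd-half y y-odd) (≤-<-trans a≤ x<y))))))

-- The entry at place i, counted from 0, is at least c + 1 + i, so the product of the x / (x - 1) is
-- at most a telescoping product with value (c + length) / c.
totient-ratio : ∀ c xs → AllPairs _<_ xs → All (suc c ≤_) xs → product xs * c ≤ φ xs * (c + length xs)
totient-ratio c []       _        _ = ≤-reflexive (trans (*-identityˡ c) (trans (sym (+-identityʳ c)) (sym (+-identityʳ (c + 0)))))
totient-ratio c (suc x ∷ xs) (x< ∷ s) (s≤s c≤x ∷ _) = begin
  suc x * product xs * c                      ≡⟨ r₁ x (product xs) c ⟩
  product xs * (c + x * c)                    ≤⟨ *-monoʳ-≤ (product xs) (+-monoˡ-≤ (x * c) c≤x) ⟩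
  product xs * (x + x * c)                    ≡⟨ r₂ x (product xs) c ⟩
  x * (product xs * suc c)                    ≤⟨ *-monoʳ-≤ x (totient-ratio (suc c) xs s (All.map (≤-trans (s≤s (s≤s c≤x))) x<)) ⟩
  x * (φ xs * (suc c + length xs))            ≡⟨ trans (sym (*-assoc x (φ xs) _)) (cong (x * φ xs *_) (sym (+-suc c (length xs)))) ⟩
  x * φ xs * (c + suc (length xs))            ∎
  where
  open ≤-Reasoning
  r₁ : ∀ x P c → (1 + x) * P * c ≡ P * (c + x * c)
  r₁ = solve-∀
  r₂ : ∀ x P c → P * (x + x * c) ≡ x * (P * (1 + c))
  r₂ = solve-∀

power-≤-product : ∀ b xs → All (b ≤_) xs → b ^ length xs ≤ product xs
power-≤-product b []       _          = ≤-refl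
power-≤-product b (x ∷ xs) (b≤x ∷ ge) = *-mono-≤ b≤x (power-≤-product b xs ge)

odds-< : ∀ a z → All (_< suc (2 * (a + z))) (odds a z)
odds-< a zero    = []
odds-< a (suc z) = s≤s (*-monoʳ-< 2 (m<m+n a (s≤s z≤n))) ∷ subst (λ w → All (_< suc (2 * w)) (odds (suc a) z)) (sym (+-suc a z)) (odds-< (suc a) z)

module _ (K : ℕ) where
  private
    aT bT : ℕ → ℕ
    aT q = q * q * (blocks K (q * q) * blocks K (q * q))
    bT q = q * q * blocks K (q * q)

  -- With u = ⌊K / d⌋, the expansion d (u + 1)² = d u · u + 2 d u + d and d ≤ K leave K u + 3 K per
  -- term.
  odds-squares : ∀ a j → All (λ q → q * q ≤ K) (odds a j) →
    ∑ₗ (odds a j) aT ≤ K * ∑ₗ (odds a j) (λ q → K /₀ (q * q)) + 3 * (j * K)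
  odds-squares a zero    _         = z≤n
  odds-squares a (suc j) (le ∷ les) = begin
    d * (suc u * suc u) + ∑ₗ (odds (suc a) j) aT           ≤⟨ +-mono-≤ one (odds-squares (suc a) j les) ⟩
    (K * u + 3 * K) + (K * v + 3 * (j * K))                ≡⟨ ring K u v j ⟩
    K * (u + v) + 3 * (suc j * K)                          ∎
    where
    open ≤-Reasoning
    d = suc (2 * a) * suc (2 * a)
    u = K /₀ d
    v = ∑ₗ (odds (suc a) j) (λ q → K /₀ (q * q))
    du≤K : d * u ≤ K
    du≤K = ≤-trans (≤-reflexive (*-comm d u)) (/₀-*-≤ K d)
    one : d * (suc u * suc u) ≤ K * u + 3 * K
    one = begin
      d * (suc u * suc u)               ≡⟨ r d u ⟩
      d * u * u + (2 * (d * u) + d)     ≤⟨ +-mono-≤ (*-monoˡ-≤ u du≤K) (+-mono-≤ (*-monoʳ-≤ 2 du≤K) le) ⟩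
      K * u + (2 * K + K)               ≡⟨ r′ K u ⟩
      K * u + 3 * K                     ∎
      where
      r : ∀ d u → d * ((1 + u) * (1 + u)) ≡ d * u * u + (2 * (d * u) + d)
      r = solve-∀
      r′ : ∀ K u → K * u + (2 * K + K) ≡ K * u + 3 * K
      r′ = solve-∀
    ring : ∀ K u v j → (K * u + 3 * K) + (K * v + 3 * (j * K)) ≡ K * (u + v) + 3 * ((1 + j) * K)
    ring = solve-∀

  odds-linear : ∀ a j → All (λ q → q * q ≤ K) (odds a j) → ∑ₗ (odds a j) bT ≤ 2 * (j * K)
  odds-linear a zero    _          = z≤n
  odds-linear a (suc j) (le ∷ les) = begin
    d * suc u + ∑ₗ (odds (suc a) j) bT   ≤⟨ +-mono-≤ (≤-trans (≤-reflexive (*-suc d u)) (+-mono-≤ le (≤-trans (≤-reflexive (*-comm d u)) (/₀-*-≤ K d)))) (odds-linear (suc a) j les) ⟩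
    (K + K) + 2 * (j * K)                ≡⟨ ring K j ⟩
    2 * (suc j * K)                      ∎
    where
    open ≤-Reasoning
    d = suc (2 * a) * suc (2 * a)
    u = K /₀ d
    ring : ∀ K j → (K + K) + 2 * (j * K) ≡ 2 * ((1 + j) * K)
    ring = solve-∀

power-bound-small : ∀ X p → X < 2 ^ 26 → 2 ^ 200 ≤ p → X ^ 100 < p ^ 13
power-bound-small X p X< p≥ = begin-strict
  X ^ 100          <⟨ ^-monoˡ-< 100 X< ⟩
  (2 ^ 26) ^ 100   ≡⟨ trans (^-*-assoc 2 26 100) (sym (^-*-assoc 2 200 13)) ⟩
  (2 ^ 200) ^ 13   ≤⟨ ^-monoˡ-≤ 13 p≥ ⟩
  p ^ 13           ∎
  where open ≤-Reasoning

power-bound-large : ∀ X p n → 0 < n → X ^ 4 ≤ 3 ^ n → 3 ^ (2 * n) ≤ p → X ^ 100 < p ^ 13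
power-bound-large X p n n>0 X≤ p≥ = begin-strict
  X ^ 100             ≡⟨ ^-*-assoc X 4 25 ⟨
  (X ^ 4) ^ 25        ≤⟨ ^-monoˡ-≤ 25 X≤ ⟩
  (3 ^ n) ^ 25        ≡⟨ ^-*-assoc 3 n 25 ⟩
  3 ^ (n * 25)        <⟨ ^-monoʳ-< 3 (s≤s (s≤s z≤n)) (*-monoʳ-< n {{>-nonZero n>0}} (≤ᵇ⇒≤ 26 26 tt)) ⟩
  3 ^ (n * 26)        ≡⟨ cong (3 ^_) (ring n) ⟩
  3 ^ (2 * n * 13)    ≡⟨ ^-*-assoc 3 (2 * n) 13 ⟨
  (3 ^ (2 * n)) ^ 13  ≤⟨ ^-monoˡ-≤ 13 p≥ ⟩
  p ^ 13              ∎
  where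
  open ≤-Reasoning
  ring : ∀ n → n * 26 ≡ 2 * n * 13
  ring = solve-∀

-- For n ≤ b the bound p ≥ 2²⁰⁰ suffices, as (2²⁰⁰)¹³ = (2²⁶)¹⁰⁰. For more primes, p ≥ 3^(2n)
-- outgrows the polynomial in n.
power-bound : ∀ c b p n → c * ((2 + b) * (2 + b)) < 2 ^ 26 → 6 ≤ b → (c * ((3 + b) * (3 + b))) ^ 4 ≤ 3 ^ (1 + b) →
              2 ^ 200 ≤ p → 3 ^ (2 * n) ≤ p → (c * ((2 + n) * (2 + n))) ^ 100 < p ^ 13
power-bound c b p n small 6≤b base p≥ 3≤ with n ≤? b
... | yes n≤b = power-bound-small (c * ((2 + n) * (2 + n))) p
  (≤-<-trans (*-monoʳ-≤ c (*-mono-≤ (s≤s (s≤s n≤b)) (s≤s (s≤s n≤b)))) small) p≥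
... | no n≰b = power-bound-large (c * ((2 + n) * (2 + n))) p n (≤-trans (s≤s z≤n) (≰⇒> n≰b))
  (subst (λ k → (c * ((2 + k) * (2 + k))) ^ 4 ≤ 3 ^ k) (m+[n∸m]≡n (≰⇒> n≰b))
    (three-power-dominates c (3 + b) (s≤s (s≤s (s≤s 6≤b))) (1 + b) base (n ∸ suc b))) 3≤

K-large : ∀ c b p n f ρ K → 8 * c * ((2 + b) * (2 + b)) < 2 ^ 26 → 6 ≤ b → (8 * c * ((3 + b) * (3 + b))) ^ 4 ≤ 3 ^ (1 + b) →
          2 ^ 200 ≤ p → 3 ^ (2 * n) ≤ p → 0 < p → f * f ≤ p → ρ * ρ ≤ 4 * (f * p) → p ^ 22 ≤ (4 * K + 1) ^ 25 →
          c * ((2 + n) * (2 + n) * ρ) ≤ K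
K-large c b p n f ρ K small 6≤b base p≥ 3≤ p>0 f²≤p ρ≤ max = K-lower-bound c p f (2 + n) ρ K p>0 f²≤p ρ≤ max
  (subst (λ X → X ^ 100 < p ^ 13) (*-assoc 8 c ((2 + n) * (2 + n))) (power-bound (8 * c) b p n small 6≤b base p≥ 3≤))

module Large (p : ℕ) (pp : Prime p) (2<p : 2 < p) where

  p-odd : ¬ 2 ∣ p
  p-odd d = [ (λ ()) , <⇒≢ 2<p ]′ (prime⇒irreducible pp d)

  2∣p∸1 : 2 ∣ p ∸ 1
  2∣p∸1 = subst (2 ∣_) (sym (cong (_∸ 1) (odd-half p p-odd))) (m∣m*n (p / 2))

  module Odd = Rest p pp (2 ∷ []) (prime[2] ∷ []) ([] ∷ []) (2∣p∸1 ∷ [])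

  B : List ℕ
  B = Odd.R

  prime-odd : ∀ {q} → Prime q → ¬ q ∈ 2 ∷ [] → ¬ 2 ∣ q
  prime-odd qp q∉ d = [ (λ ()) , (λ e → q∉ (here (sym e))) ]′ (prime⇒irreducible qp d)

  B-odd : All (λ q → ¬ 2 ∣ q) B
  B-odd = All.map (λ (qp , _ , q∉) → prime-odd qp q∉) Odd.R-rest

  B-≥3 : All (3 ≤_) B
  B-≥3 = All.map (λ {q} (qp , _ , q∉) → ≤∧≢⇒< (nonTrivial⇒n>1 q {{prime⇒nonTrivial qp}}) (λ e → q∉ (here (sym e)))) Odd.R-rest

  -- m bounds e / φ(e): `totient-ratio` with c = 2, applied to the n odd primes of E, gives (2 + n)
  -- / 2, and the prime 2 doubles it.
  n m : ℕ
  n = length B / 2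
  m = 2 + n

  E′ D E : List ℕ
  E′ = take n B
  D = drop n B
  E = 2 ∷ E′

  B≡ : E′ ++ D ≡ B
  B≡ = take++drop≡id n B

  split : AllPairs _<_ E′ × AllPairs _<_ D × All (λ x → All (x <_) D) E′
  split = allPairs-++⁻ E′ (subst (AllPairs _<_) (sym B≡) Odd.R-sorted)

  rest-E′ : All Odd.IsRest E′
  rest-E′ = ++⁻ˡ E′ (subst (All Odd.IsRest) (sym B≡) Odd.R-rest)

  B-length : length B ≡ length B % 2 + n * 2
  B-length = m≡m%n+[m/n]*n (length B) 2

  2n≤ : 2 * n ≤ length B
  2n≤ = ≤-trans (≤-reflexive (*-comm 2 n)) (≤-trans (m≤n+m (n * 2) _) (≤-reflexive (sym B-length)))

  E′-length : length E′ ≡ n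
  E′-length = trans (length-take n B) (m≤n⇒m⊓n≡m (≤-trans (m≤m+n n (n + 0)) 2n≤))

  D-length-≤ : length D ≤ suc n
  D-length-≤ = ≤-trans (≤-reflexive (length-drop n B)) (m≤n+o⇒m∸n≤o (length B) n (≤-trans (≤-reflexive B-length)
    (≤-trans (+-monoˡ-≤ (n * 2) (≤-pred (m%n<n (length B) 2))) (≤-reflexive (ring n)))))
    where
    ring : ∀ n → 1 + n * 2 ≡ n + (1 + n)
    ring = solve-∀

  D-length-≥ : n ≤ length D
  D-length-≥ = subst (n ≤_) (sym (length-drop n B)) (m+n≤o⇒m≤o∸n n (≤-trans (≤-reflexive (cong (n +_) (sym (+-identityʳ n)))) 2n≤))

  D-≥ : All (suc (2 * (1 + n)) ≤_) D
  D-≥ = drop-odd-≥ 1 n B Odd.R-sorted B-odd B-≥3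

  B-product-≤ : product B ≤ p
  B-product-≤ = ≤-trans Odd.R-product-≤ (≤-trans (≤-trans (m≤n*m Odd.M 2) (≤-reflexive Odd.index)) (m∸n≤m p 1))

  E-prime : All Prime E
  E-prime = prime[2] ∷ All.map proj₁ rest-E′

  E-coprime : AllPairs Coprime E
  E-coprime = All.map {P = Odd.IsRest} two rest-E′ ∷ sorted-primes-coprime E′ (All.map proj₁ rest-E′) (proj₁ split)
    where
    two : ∀ {q} → Odd.IsRest q → Coprime 2 q
    two (qp , _ , q∉) = prime-coprime prime[2] qp (λ e → q∉ (here (sym e)))

  E-∣ : All (_∣ p ∸ 1) E
  E-∣ = 2∣p∸1 ∷ All.map (proj₁ ∘ proj₂) rest-E′

  open Rest p pp E E-prime E-coprime E-∣

  R⊆D : All (_∈ D) R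
  R⊆D = All.map in-D R-rest
    where
    in-D : ∀ {r} → IsRest r → r ∈ D
    in-D {r} (rp , r∣ , r∉E) with Odd.complete r rp r∣
    ... | inj₁ (here e) = ⊥-elim (r∉E (here e))
    ... | inj₂ r∈B with ∈-++⁻ E′ (subst (r ∈_) (sym B≡) r∈B)
    ...   | inj₁ r∈E′ = ⊥-elim (r∉E (there r∈E′))
    ...   | inj₂ r∈D  = r∈D

  -- At most n + 1 primes remain, and each lies above n smaller odd primes, so it is at least 2 n +
  -- 3. Together they take less than half of the density.
  W : List ℕ
  W = replicate (suc n) (suc (2 * (1 + n)))

  R≼W : R ≼ W
  R≼W = ≼-replicate (≤-trans (≼-length (subset-dominated R D R-sorted (proj₁ (proj₂ split)) R⊆D)) D-length-≤)
    (All.map (All.lookup D-≥) R⊆D)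

  f≤E′ : f ≤ product E′
  f≤E′ = ≤-trans (≤-reflexive (+-identityʳ (φ E′))) (φ-≤-product E′)

  -- E′ is the smaller half of the odd primes, so its product is at most that of D, and the two
  -- products multiply to at most p.
  f²≤p : f * f ≤ p
  f²≤p = begin
    f * f                      ≤⟨ *-mono-≤ f≤E′ (≤-trans f≤E′ (separated-product-≤ E′ D (proj₂ (proj₂ split))
                                    (≤-trans (≤-reflexive E′-length) D-length-≥) (All.map (≤-trans (s≤s z≤n)) D-≥))) ⟩
    product E′ * product D     ≡⟨ product-++ E′ D ⟨
    product (E′ ++ D)          ≡⟨ cong product B≡ ⟩
    product B                  ≤⟨ B-product-≤ ⟩
    p                          ∎
    where open ≤-Reasoning

  e≤fm : e ≤ f * m
  e≤fm = begin
    2 * product E′             ≡⟨ *-comm 2 (product E′) ⟩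
    product E′ * 2             ≤⟨ totient-ratio 2 E′ (proj₁ split) (++⁻ˡ E′ (subst (All (3 ≤_)) (sym B≡) B-≥3)) ⟩
    φ E′ * (2 + length E′)     ≡⟨ cong₂ (λ a b → a * (2 + b)) (sym (+-identityʳ (φ E′))) E′-length ⟩
    f * m                      ∎
    where open ≤-Reasoning

  3^2n≤p : 3 ^ (2 * n) ≤ p
  3^2n≤p = ≤-trans (^-monoʳ-≤ 3 2n≤) (≤-trans (power-≤-product 3 B B-≥3) B-product-≤)

  F : ℕ
  F = f * M

  p≤2Fm : p ≤ 2 * (F * m)
  p≤2Fm = begin
    p                    ≡⟨ m+[n∸m]≡n {1} {p} (<⇒≤ (<-trans (s≤s (s≤s z≤n)) 2<p)) ⟨
    1 + (p ∸ 1)          ≤⟨ +-monoˡ-≤ (p ∸ 1) (∸-monoˡ-≤ 1 (<⇒≤ 2<p)) ⟩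
    (p ∸ 1) + (p ∸ 1)    ≡⟨ cong (λ z → z + z) index ⟨
    e * M + e * M        ≤⟨ +-mono-≤ (*-monoˡ-≤ M e≤fm) (*-monoˡ-≤ M e≤fm) ⟩
    f * m * M + f * m * M ≡⟨ ring f m M ⟩
    2 * (F * m)          ∎
    where
    open ≤-Reasoning
    ring : ∀ f m M → f * m * M + f * m * M ≡ 2 * (f * M * m)
    ring = solve-∀

  F>0 : 0 < F
  F>0 = n≢0⇒n>0 λ z → <⇒≢ (<-trans (s≤s z≤n) 2<p) (sym (n≤0⇒n≡0 (≤-trans p≤2Fm (≤-reflexive (cong (λ z → 2 * (z * m)) z)))))

  f>0 : 0 < f
  f>0 = n≢0⇒n>0 λ z → <⇒≢ F>0 (sym (cong (_* M) z))

  -- The small q are the odd numbers from 3 to 2 j + 1 = 8 m - 1. The tail then has density at most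
  -- 1 / (16 m), which p ≤ 2 F m turns into one eighth of the main term.
  j : ℕ
  j = 4 * m ∸ 1

  j≡ : suc j ≡ 4 * m
  j≡ = m+[n∸m]≡n {1} {4 * m} (s≤s z≤n)

  -- The constant 272 exceeds 104 + 144 = 248, as `large-numeric` demands, and 64, so that q² ≤ K
  -- for all q ≤ 8 m.
  conclude : ∀ K ρ → 0 < K → 0 < ρ → Below (4 * K ∸ 3) p → f * p ≤ ρ * ρ →
    272 * (m * m * ρ) ≤ K → SmallRoot p
  conclude K ρ K>0 ρ>0 below-p ρ-bound K≥ = smallRoot-from W R≼W W>0 K K<p ρ ρ (≤-trans ρ-bound (m≤m+n (ρ * ρ) _)) ρ-bound 2<p
      (odds 1 j) (odds (1 + j) ρ) (odds-odd 1 j) (All.map (λ {q} q< → ≤-<-trans (q≤K q q<) K<p) QL-<) (odds-odd (1 + j) ρ) cover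
      (K /₀ (4 * (1 + j)) + ρ) (odds-blocks K (1 + j) ρ (s≤s z≤n))
      (subst (λ s → F * (K * ∑ₗ W (blocks K) + A) + p * (K * (s * ρ) + S * ρ + K * (K /₀ (4 * (1 + j)) + ρ) + K * ρ) < F * (K * K)) (sym (length-replicate (suc n)))
        (large-numeric F K p m ρ (∑ₗ W (blocks K)) A S (K /₀ (4 * (1 + j))) (suc n) j p≤2Fm t≤ A≤ (odds-linear K 1 j squares) y≤ refl j≡ K>0 F>0 big))
      below-p
    where
    open ≤-Reasoning
    A = ∑ₗ (odds 1 j) (λ q → q * q * (blocks K (q * q) * blocks K (q * q)))
    S = ∑ₗ (odds 1 j) (λ q → q * q * blocks K (q * q))
    x = m * m * ρ
    m≤x : m ≤ x
    m≤x = ≤-trans (m≤m*n m m) (m≤m*n (m * m) ρ {{>-nonZero ρ>0}})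
    mm≤x : m * m ≤ x
    mm≤x = m≤m*n (m * m) ρ {{>-nonZero ρ>0}}
    x>0 : 0 < x
    x>0 = ≤-trans (s≤s z≤n) m≤x
    big : 104 * m + 144 * x < K
    big = begin-strict
      104 * m + 144 * x      ≤⟨ +-monoˡ-≤ (144 * x) (*-monoʳ-≤ 104 m≤x) ⟩
      104 * x + 144 * x      ≡⟨ *-distribʳ-+ x 104 144 ⟨
      248 * x                <⟨ *-monoˡ-< x {{>-nonZero x>0}} (≤ᵇ⇒≤ 249 272 tt) ⟩
      272 * x                ≤⟨ K≥ ⟩
      K                      ∎
    64mm≤K : 64 * (m * m) ≤ K
    64mm≤K = ≤-trans (*-mono-≤ (≤ᵇ⇒≤ 64 272 tt) mm≤x) K≥
    K<p : K < p
    K<p = ≤-<-trans (K≤ K K>0) (Below⇒< (>-nonZero (≤-trans K>0 (K≤ K K>0))) below-p)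
      where
      K≤ : ∀ K → 0 < K → K ≤ 4 * K ∸ 3
      K≤ (suc k) _ = ≤-trans (m≤m+n (suc k) (3 * k)) (≤-reflexive (sym (cong (_∸ 3) (ring k))))
        where
        ring : ∀ k → 4 * (1 + k) ≡ 3 + (1 + k + 3 * k)
        ring = solve-∀
    W>0 : All (0 <_) W
    W>0 = positive (suc n)
      where
      positive : ∀ k → All (0 <_) (replicate k (suc (2 * (1 + n))))
      positive zero    = []
      positive (suc k) = s≤s z≤n ∷ positive k
    QL-< : All (_< suc (8 * m)) (odds 1 j)
    QL-< = subst (λ w → All (_< suc w) (odds 1 j)) (trans (cong (2 *_) j≡) (sym (*-assoc 2 4 m))) (odds-< 1 j)
    q²≤K : ∀ q → q < suc (8 * m) → q * q ≤ K
    q²≤K q q< = ≤-trans (*-mono-≤ (≤-pred q<) (≤-pred q<)) (≤-trans (≤-reflexive (ring m)) 64mm≤K)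
      where
      ring : ∀ m → 8 * m * (8 * m) ≡ 64 * (m * m)
      ring = solve-∀
    q≤K : ∀ q → q < suc (8 * m) → q ≤ K
    q≤K zero    _  = z≤n
    q≤K (suc q) q< = ≤-trans (m≤m*n (suc q) (suc q)) (q²≤K (suc q) q<)
    squares : All (λ q → q * q ≤ K) (odds 1 j)
    squares = All.map (λ {q} → q²≤K q) QL-<
    cover : ∀ q → Prime q → q ≢ 2 → q * q ≤ 4 * K → q ∈ odds 1 j ⊎ q ∈ odds (1 + j) ρ
    cover q qp q≢2 q²≤ = subst (λ w → w ∈ odds 1 j ⊎ w ∈ odds (1 + j) ρ) (sym q≡) which
      where
      q-odd : ¬ 2 ∣ q
      q-odd = prime-odd qp (λ { (here e) → q≢2 e })
      b = q / 2
      q≡ : q ≡ suc (2 * b)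
      q≡ = odd-half q q-odd
      b>0 : 1 ≤ b
      b>0 = *-cancelˡ-< 2 0 b (≤-pred (subst (1 <_) q≡ (nonTrivial⇒n>1 q {{prime⇒nonTrivial qp}})))
      -- As f ≥ 1, p ≤ ρ²; so q² ≤ 4 K < 4 p confines q below 2 ρ, and ρ odd numbers suffice for the
      -- tail.
      b<ρ : b < ρ
      b<ρ = ≰⇒> λ ρ≤b → <⇒≱ (begin-strict
        4 * K                           <⟨ *-monoʳ-< 4 K<p ⟩
        4 * p                           ≤⟨ *-monoʳ-≤ 4 (≤-trans (m≤n*m p f {{>-nonZero f>0}}) ρ-bound) ⟩
        4 * (ρ * ρ)                     ≤⟨ *-monoʳ-≤ 4 (*-mono-≤ ρ≤b ρ≤b) ⟩
        4 * (b * b)                     ≤⟨ m≤m+n _ (4 * b + 1) ⟩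
        4 * (b * b) + (4 * b + 1)       ≡⟨ ring b ⟩
        suc (2 * b) * suc (2 * b)       ≡⟨ cong₂ _*_ q≡ q≡ ⟨
        q * q                           ∎) q²≤
        where
        ring : ∀ b → 4 * (b * b) + (4 * b + 1) ≡ (1 + 2 * b) * (1 + 2 * b)
        ring = solve-∀
      which : suc (2 * b) ∈ odds 1 j ⊎ suc (2 * b) ∈ odds (1 + j) ρ
      which with b <? 1 + j
      ... | yes b< = inj₁ (odds-complete 1 j b b>0 b<)
      ... | no b≮  = inj₂ (odds-complete (1 + j) ρ b (≮⇒≥ b≮) (<-≤-trans b<ρ (m≤n+m ρ (1 + j))))
    t≤ : 2 * ∑ₗ W (blocks K) ≤ K + 2 * m
    t≤ = begin
      2 * ∑ₗ W (blocks K)           ≡⟨ cong (2 *_) (∑ₗ-replicate (suc n) (suc (2 * (1 + n))) (blocks K)) ⟩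
      2 * (suc n * suc u)           ≡⟨ ring n u ⟩
      u * (2 * (1 + n)) + 2 * (1 + n) ≤⟨ +-mono-≤ (≤-trans (*-monoʳ-≤ u (n≤1+n (2 * (1 + n)))) (/₀-*-≤ K (suc (2 * (1 + n))))) (*-monoʳ-≤ 2 (n≤1+n (1 + n))) ⟩
      K + 2 * m                     ∎
      where
      u = K /₀ suc (2 * (1 + n))
      ring : ∀ n u → 2 * ((1 + n) * (1 + u)) ≡ u * (2 * (1 + n)) + 2 * (1 + n)
      ring = solve-∀
    A≤ : 4 * A ≤ K * K + 12 * (j * K)
    A≤ = begin
      4 * A                               ≤⟨ *-monoʳ-≤ 4 (odds-squares K 1 j squares) ⟩
      4 * (K * v + 3 * (j * K))           ≡⟨ ring K v j ⟩
      K * (v * 4) + 12 * (j * K)          ≤⟨ +-monoˡ-≤ (12 * (j * K)) (*-monoʳ-≤ K (odds-reciprocals K 1 j)) ⟩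
      K * K + 12 * (j * K)                ∎
      where
      v = ∑ₗ (odds 1 j) (λ q → K /₀ (q * q))
      ring : ∀ K v j → 4 * (K * v + 3 * (j * K)) ≡ K * (v * 4) + 12 * (j * K)
      ring = solve-∀
    y≤ : 16 * m * (K /₀ (4 * (1 + j))) ≤ K
    y≤ = ≤-trans (≤-reflexive (sixteen m j (K /₀ (4 * (1 + j))) j≡)) (/₀-*-≤ K (4 * (1 + j)))
      where
      sixteen : ∀ m j u → suc j ≡ 4 * m → 16 * m * u ≡ u * (4 * suc j)
      sixteen m j u e = trans (ring m u) (cong (λ z → u * (4 * z)) (sym e))
        where
        ring : ∀ m u → 16 * m * u ≡ u * (4 * (4 * m))
        ring = solve-∀

  smallRoot-large : 2 ^ 200 ≤ p → SmallRoot p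
  smallRoot-large p≥ = go (maximal-K p (<-trans (s≤s (s≤s z≤n)) 2<p)) (ceilingSqrt (f * p) (*-mono-≤ f>0 p>0))
    where
    p>0 : 0 < p
    p>0 = <-trans (s≤s z≤n) 2<p
    positive : ∀ a ρ → 0 < a → a ≤ ρ * ρ → 0 < ρ
    positive a zero    a>0 a≤ = ⊥-elim (<⇒≱ a>0 a≤)
    positive a (suc ρ) _   _  = s≤s z≤n
    go : ∃[ K ] (0 < K × Below (4 * K ∸ 3) p × p ^ 22 ≤ (4 * K + 1) ^ 25) →
         ∃[ ρ ] (f * p ≤ ρ * ρ × ρ * ρ ≤ 4 * (f * p)) → SmallRoot p
    go (K , K>0 , below-p , max) (ρ , ρ≥ , ρ≤) = conclude K ρ K>0 (positive (f * p) ρ (*-mono-≤ f>0 p>0) ρ≥) below-p ρ≥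
      -- Up to n = 158 the bound 8 · 272 · 160² < 2²⁶ applies; from n = 159 on, the powers of 3
      -- dominate.
      (K-large 272 158 p n f ρ K (<ᵇ⇒< (8 * 272 * (160 * 160)) (2 ^ 26) tt) (≤ᵇ⇒≤ 6 158 tt)
        (≤ᵇ⇒≤ ((8 * 272 * (161 * 161)) ^ 4) (3 ^ 159) tt) p≥ 3^2n≤p p>0 f²≤p ρ≤ max)

-- The three ranges of p

-- 285 intervals: 114 of ratio about 1.1 from 20000 past 10⁹, then 171 doublings past 2²⁰⁰. Here 551
-- is a₀, with 1103 = 2 · 551 + 1.
run-verified : Interval.run 1103 551 (2 ^ 200) oddPrimes branchPrimes 285 20000 ≡ true
run-verified = refl

-- Reaches every odd p up to 20001, which overlaps the start of the intervals.
scan-verified : scan [] 2 10000 2 ≡ true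
scan-verified = refl

-- The required order p - 1 is 1, so the root is 1 itself.
smallRoot-2 : SmallRoot 2
smallRoot-2 = 1 , (s≤s z≤n , squarefree , primitiveRoot 1 refl test) , isBelow-true 1 2 refl
  where
  open PrimitiveRoots 2 prime[2]
  ¬∣1 : ∀ q → Prime q → ¬ q ∣ 1
  ¬∣1 q qp d = <⇒≢ (nonTrivial⇒n>1 q {{prime⇒nonTrivial qp}}) (sym (∣1⇒≡1 d))
  squarefree : SquareFree 1
  squarefree q qp d = ¬∣1 q qp (∣-trans (m∣m*n q) d)
  test : ∀ q m → Prime q → q * m ≡ 1 → ¬ (1 ^ m % 2 ≡ 1)
  test q m qp e _ = ¬∣1 q qp (subst (q ∣_) e (m∣m*n m))

smallRoot : ∀ p → Prime p → SmallRoot p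
smallRoot p pp with p ≟ 2
... | yes p≡2 = subst SmallRoot (sym p≡2) smallRoot-2
... | no p≢2 with p <? 20002
... | yes p< = scan-small 10000 scan-verified p pp (≤∧≢⇒< (nonTrivial⇒n>1 p {{prime⇒nonTrivial pp}}) (≢-sym p≢2)) p<
... | no p≮ = [ mid , large ]′ (<-≤-connex p (2 ^ 200))
  where
  2<p : 2 < p
  2<p = ≤∧≢⇒< (nonTrivial⇒n>1 p {{prime⇒nonTrivial pp}}) (≢-sym p≢2)
  large : 2 ^ 200 ≤ p → SmallRoot p
  large = Large.smallRoot-large p pp 2<p
  mid : p < 2 ^ 200 → SmallRoot p
  mid = IntervalSound.run-sound 1103 551 (2 ^ 200) refl (s≤s z≤n) (≤ᵇ⇒≤ 3 1103 tt) oddPrimes branchPrimes oddPrimes-sorted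
    (≤ᵇ⇒≤ 3 1103 tt ∷ All.map (proj₁ ∘ proj₂) oddPrimes-range) (All.map (proj₂ ∘ proj₂) oddPrimes-range) oddPrimes-complete
    branchPrimes-prime (AllPairs.tail branchPrimes-coprime) (All.map (λ {l} c → sym-coprime l c ∷ []) (AllPairs.head branchPrimes-coprime))
    285 20000 run-verified p pp (≤-trans (≤ᵇ⇒≤ 20000 20002 tt) (≮⇒≥ p≮))
    where
    sym-coprime : ∀ l → Coprime 2 l → Coprime l 2
    sym-coprime l c = Cop.sym c

theorem0p1 : ∀ (p : ℕ) → Prime p →
    ∃[ g ] (IsLeastSqFreePrimRoot p g × (g ^ 25 < p ^ 22))
theorem0p1 p pp = go (smallRoot p pp)
  where
  go : SmallRoot p → ∃[ g ] (IsLeastSqFreePrimRoot p g × (g ^ 25 < p ^ 22))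
  go (g , candidate , g-below) with least-candidate p g candidate
  ... | h , h≤g , least = h , least , Below.power-< (≤-Below h≤g g-below)
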